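{- Let $1/n\ll c\ll\mu\ll1$ and let $t_1,t_2\in\mathbb N$ satisfy $t_1+t_2=n$ and $t_1\ge t_2$. If $G$ is a red/blue coloured complete graph with $\max\{t_1+2t_2,2t_1\}-1$ vertices which is Type I $(\mu,t_1,t_2)$-extremal, then $G$ contains a monochromatic copy of every $n$-vertex tree $T$ with $\Delta(T)\le cn$ whose bipartition classes have sizes $t_1$ and $t_2$.
   Context: Hierarchy notation "$1/n\ll c\ll\mu\ll1$": each parameter is chosen sufficiently small in terms of those to its right (i.e. there are non-decreasing functions such that the statement holds whenever $\mu$ is at most some absolute constant, $c\le f(\mu)$ and $1/n\le f'(c)$). For a red/blue coloured graph, $d_{\mathrm{red}}(u,S)$, $d_{\mathrm{blue}}(u,S)$ denote numbers of red/blue neighbours of $u$ in $S$. With $n=t_1+t_2$, a red/blue coloured complete graph $G$ is Type I $(\mu,t_1,t_2)$-extremal if there are disjoint $U_1,U_2\subseteq V(G)$ with $|U_1|\ge(1-\mu)n$, $|U_2|\ge(1-\mu)t_2$, $d_{\mathrm{red}}(u,U_1)\le\mu n$ for every $u\in U_1$, and $d_{\mathrm{blue}}(u,U_{3-i})\le\mu n$ for every $i\in[2]$ and $u\in U_i$; or the same holds with red and blue swapped. -}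

module Defs where

open import Data.Nat using (ℕ; suc; _+_; _∸_; _≥_; _⊔_)
open import Data.Bool using (Bool; true; false; _∧_; not)
open import Data.Fin using (Fin)
open import Data.Fin.Subset using (Subset; ∣_∣; _∩_; ∁; _∈_; Empty)
open import Data.Vec using (tabulate)
open import Data.List using (List; _∷_; []; length; _∷ʳ_)
open import Data.List.Relation.Unary.Linked using (Linked)
open import Data.List.Relation.Unary.Unique.Propositional using (Unique)
open import Data.Product using (Σ; _×_; ∃; ∃-syntax; _,_)
open import Data.Sum using (_⊎_)
open import Data.Integer using (+_)
open import Data.Rational using (ℚ; _/_; _≤_; _<_; _*_; _-_; 1ℚ; 0ℚ)
open import Relation.Nullary using (¬_)
open import Data.Empty using (⊥)
open import Relation.Nullary.Decidable using (⌊_⌋)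
open import Relation.Binary.PropositionalEquality using (_≡_; _≢_)
open import Function.Definitions using (Injective)
import Data.Fin as F

ℕ→ℚ : ℕ → ℚ
ℕ→ℚ k = + k / 1

data Colour : Set where
  red blue : Colour

_==ᶜ_ : Colour → Colour → Bool
red  ==ᶜ red  = true
blue ==ᶜ blue = true
_    ==ᶜ _    = false

-- A red/blue colouring of the complete graph on vertex set Fin N:
-- every pair of distinct vertices gets a colour, symmetrically.
-- (The value on the diagonal is irrelevant and never used.)
record ColouredKN (N : ℕ) : Set where
  field
    col   : Fin N → Fin N → Colour
    symm  : ∀ u v → col u v ≡ col v u
open ColouredKN public

nbhd : ∀ {N} → ColouredKN N → Colour → Fin N → Subset N
nbhd G c u = tabulate (λ v → not ⌊ u F.≟ v ⌋ ∧ (col G u v ==ᶜ c))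

deg : ∀ {N} → ColouredKN N → Colour → Fin N → Subset N → ℕ
deg G c u S = ∣ S ∩ nbhd G c u ∣

Disjoint : ∀ {N} → Subset N → Subset N → Set
Disjoint A B = Empty (A ∩ B)

ExtremalWith : ∀ {N} → Colour → Colour → ℚ → ℕ → ℕ → ColouredKN N → Set
ExtremalWith r b μ t₁ t₂ G =
  let n = t₁ + t₂ in
  Σ _ λ U₁ → Σ _ λ U₂ →
    Disjoint U₁ U₂
    × ((1ℚ - μ) * ℕ→ℚ n ≤ ℕ→ℚ ∣ U₁ ∣)
    × ((1ℚ - μ) * ℕ→ℚ t₂ ≤ ℕ→ℚ ∣ U₂ ∣)
    × (∀ u → u ∈ U₁ → ℕ→ℚ (deg G r u U₁) ≤ μ * ℕ→ℚ n)
    × (∀ u → u ∈ U₁ → ℕ→ℚ (deg G b u U₂) ≤ μ * ℕ→ℚ n)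
    × (∀ u → u ∈ U₂ → ℕ→ℚ (deg G b u U₁) ≤ μ * ℕ→ℚ n)

TypeIExtremal : ∀ {N} → ℚ → ℕ → ℕ → ColouredKN N → Set
TypeIExtremal μ t₁ t₂ G =
  ExtremalWith red blue μ t₁ t₂ G ⊎ ExtremalWith blue red μ t₁ t₂ G

record Graph (n : ℕ) : Set where
  field
    adj     : Fin n → Fin n → Bool
    adj-sym : ∀ u v → adj u v ≡ adj v u
    adj-irr : ∀ u → adj u u ≡ false
open Graph public

Adj : ∀ {n} → Graph n → Fin n → Fin n → Set
Adj T u v = adj T u v ≡ true

data Walk {n} (T : Graph n) : Fin n → Fin n → Set where
  []  : ∀ {u} → Walk T u u
  _∷_ : ∀ {u v w} → Adj T u v → Walk T v w → Walk T u w

Connected : ∀ {n} → Graph n → Set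
Connected T = ∀ u v → Walk T u v

IsCycle : ∀ {n} → Graph n → List (Fin n) → Set
IsCycle T [] = ⊥
IsCycle T (x ∷ xs) =
  (length (x ∷ xs) ≥ 3) × Unique (x ∷ xs) × Linked (Adj T) ((x ∷ xs) ∷ʳ x)

Acyclic : ∀ {n} → Graph n → Set
Acyclic T = ∀ xs → ¬ IsCycle T xs

IsTree : ∀ {n} → Graph n → Set
IsTree T = Connected T × Acyclic T

degree : ∀ {n} → Graph n → Fin n → ℕ
degree T v = ∣ tabulate (adj T v) ∣

MaxDegreeAtMost : ∀ {n} → Graph n → ℚ → Set
MaxDegreeAtMost {n} T c = ∀ v → ℕ→ℚ (degree T v) ≤ c * ℕ→ℚ n

HasBipartition : ∀ {n} → Graph n → ℕ → ℕ → Set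
HasBipartition {n} T t₁ t₂ =
  Σ (Subset n) λ X →
    (∀ u v → Adj T u v → ¬ ((u ∈ X) ⇔ (v ∈ X)))
    × ∣ X ∣ ≡ t₁ × ∣ ∁ X ∣ ≡ t₂
  where
  _⇔_ : Set → Set → Set
  A ⇔ B = (A → B) × (B → A)

MonoCopy : ∀ {n N} → ColouredKN N → Graph n → Set
MonoCopy {n} {N} G T =
  Σ Colour λ c → Σ (Fin n → Fin N) λ f →
    Injective _≡_ _≡_ f × (∀ u v → Adj T u v → col G (f u) (f v) ≡ c)

{-# OPTIONS --safe #-}
-- Write b for the colour that nearly fills U₁ and r for the other colour, and X₁, X₂ for the classes of T.
-- Edges that violate the extremal structure obstruct a copy of T in one colour and create room for a
-- copy in the other colour; the proof balances the two effects exactly.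
--
-- If |X₂| is linear in n and X₂ contains many leaves, T without these leaves is embedded twice at
-- once, in b inside U₁ and in r between U₁ and U₂, with the same images for X₁. At least 2|L| − 1
-- vertices remain for the set L of leaves, and each of them is joined in b or in r to at least half of
-- the images of the neighbours of L, counted with multiplicity. One colour therefore has |L| such
-- vertices, and exchanging partners turns any bijection into a placement of the leaves.
--
-- If |X₂| is linear but contains few leaves, then T has linearly many vertices of bounded degree
-- whose neighbours have bounded degree, hence many such cores with disjoint neighbourhoods. The
-- vertices missing from U₁ are attached to U₁ at cores by stars in b. If this succeeds, T is completed
-- in b inside U₁; if it gets stuck, so few b-edges leave U₁ that T embeds in r between U₁ and its
-- complement.
--
-- If |X₂| is tiny, either T embeds in b, or the graph consists of two near-cliques in b, each of about
-- |X₁| vertices, with nearly all edges between them in r. If neither of the two bipartite embeddings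
-- in r can be completed by the leaves, some vertex w sees many neighbours of leaves in b for both
-- embeddings. With a vertex of T that has branches of linear total size placed at w, the branches can
-- be divided between the two near-cliques, which leaves linear slack on both sides.
module Submission where

open import Defs
open import Data.Nat using (ℕ; >-nonZero; zero; suc; _+_; _∸_; _≥_; _⊔_; _*_; _≤_; _<_; z≤n; s≤s; _≤ᵇ_)
open import Data.Nat.Properties
  using (≤-refl; ≤-trans; ≤-reflexive; ≤-total; <-trans; ≤-<-trans; <⇒≤; ≰⇒>; ≮⇒≥; <-irrefl; <-cmp;
         ≤-antisym; n<1+n; m≤n⇒m<n∨m≡n; <⇒≱; +-comm; +-assoc; +-identityʳ; +-mono-≤; +-monoˡ-≤; +-monoʳ-≤;
         m≤m+n; m≤n+m; +-cancelʳ-≤; +-0-commutativeMonoid; *-comm; *-assoc; *-zeroʳ; *-identityˡ;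
         *-identityʳ; *-monoˡ-≤; *-monoʳ-≤; *-distribˡ-+; *-distribʳ-+; *-cancelʳ-≤; ≤ᵇ⇒≤; ∸-monoˡ-≤;
         m+n∸m≡n; m≤n+m∸n; n∸n≡0; m∸n≤m; +-∸-assoc; m≤m⊔n; m≤n⊔m; m≤n⇒m⊔n≡n; m∸n+n≡m; m≤n⇒m∸n≡0;
         module ≤-Reasoning)
open import Data.Bool using (Bool; true; false; _∧_; not; T; if_then_else_; _xor_)
open import Data.Nat.DivMod using (_/_; m≡m%n+[m/n]*n; m%n<n; m*n/n≡m; /-monoˡ-≤; m/n*n≤m)
open import Data.Fin using (Fin; zero; suc; toℕ)
open import Data.Fin.Properties using (toℕ-injective; toℕ<n)
open import Data.Vec using (Vec; []; _∷_; lookup; tabulate)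
open import Data.Vec.Properties using (lookup∘tabulate; lookup-zipWith; []=⇒lookup; lookup⇒[]=)
open import Data.List using (List; []; _∷_; length; _∷ʳ_)
open import Data.Product using (Σ; _×_; ∃; _,_; proj₁; proj₂)
open import Data.Sum using (_⊎_; inj₁; inj₂)
open import Data.Empty using (⊥; ⊥-elim)
open import Data.Unit using (⊤; tt)
open import Function using (_∘_; id; case_of_)
open import Relation.Nullary using (¬_; Dec; yes; no; contradiction)
open import Relation.Nullary.Decidable using (⌊_⌋)
open import Relation.Unary using (Decidable)
open import Relation.Binary.Definitions using (tri<; tri≈; tri>)
open import Relation.Binary.PropositionalEquality
  using (_≡_; _≢_; refl; sym; trans; cong; cong₂; subst; subst₂)
import Data.Fin as F
open import Algebra.Properties.CommutativeMonoid.Sum +-0-commutativeMonoid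
  using (∑-distrib-+; ∑-comm; sum-cong-≗)
import Algebra.Properties.CommutativeMonoid.Sum as Sum
import Data.Bool as B
import Data.Fin.Properties as Finₚ
import Data.Integer as ℤ
import Data.Integer.Properties as ℤₚ
import Data.Nat as ℕ
import Data.Rational as ℚ
import Data.Rational.Properties as ℚₚ
import Data.Rational.Unnormalised as ℚᵘ
import Data.Rational.Unnormalised.Properties as ℚᵘₚ
import Relation.Nullary.Decidable as Decidableₚ
open import Data.List.Relation.Unary.All as All using (All; []; _∷_)
open import Data.List.Relation.Unary.All.Properties using (∷ʳ⁺)
open import Data.List.Relation.Unary.AllPairs using ([]; _∷_)
open import Data.List.Relation.Unary.Linked using (Linked; []; [-]; _∷_)
open import Data.List.Relation.Unary.Unique.Propositional using (Unique)
open import Data.Fin.Subset using (Subset; ∣_∣; _∩_; _∈_)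
open import Data.Rational using (ℚ; 0ℚ; 1ℚ)
open import Data.Nat.Coprimality using (1-coprimeTo)

-- Linear arithmetic

-- The obstacle is that nothing is known about the vertices outside U₁ and U₂, while U₁ may have
-- slightly fewer than n vertices, so a plain greedy embedding runs out of space. The main remedy is
-- a reservoir of leaves or cores: without it the greedy step has slack, and it is returned by a
-- matching that tolerates sides of equal size. Such a matching needs only that the pairs missed at
-- a vertex on either side together number fewer than |L|; cores with disjoint neighbourhoods behave
-- like leaves in this respect.
--
-- The exact number N of vertices matters in three counts: the free vertices of the leaf argument,
-- the t₂ vertices that a stuck attachment leaves outside U₁, and two sets of t₁ failing vertices
-- among 2t₁ - 1. All other inequalities have room to spare and are settled by linear arithmetic on
-- fixed scales: about n/10³⁶ for the error m, n/10¹⁰ for the maximum degree, and t₂ = n/10⁶ as the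
-- border between a large and a tiny second class.

infixl 7 _⊛_
infixl 6 _⊕_
infix 4 _⊑_
infix 3 _⊢_

data Lin (k : ℕ) : Set where
  var : Fin k → Lin k
  con : ℕ → Lin k
  _⊕_ : Lin k → Lin k → Lin k
  _⊛_ : Lin k → ℕ → Lin k

data Ineq (k : ℕ) : Set where
  _⊑_ : Lin k → Lin k → Ineq k

data Problem (k : ℕ) : Set where
  _⊢_ : List (Ineq k) → Ineq k → Problem k

eval : ∀ {k} → Lin k → Vec ℕ k → ℕ
eval (var i) ρ = lookup ρ i
eval (con c) ρ = c
eval (a ⊕ b) ρ = eval a ρ + eval b ρ
eval (a ⊛ c) ρ = eval a ρ * c

Holds : ∀ {k} → Ineq k → Vec ℕ k → Set
Holds (a ⊑ b) ρ = eval a ρ ≤ eval b ρ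

Meaning : ∀ {k} → Problem k → Vec ℕ k → Set
Meaning ([] ⊢ g) ρ = Holds g ρ
Meaning (h ∷ hs ⊢ g) ρ = Holds h ρ → Meaning (hs ⊢ g) ρ

-- The constant term comes first.
Normal : ℕ → Set
Normal k = Vec ℕ (suc k)

infixl 6 _⊞_
_⊞_ : ∀ {k} → Vec ℕ k → Vec ℕ k → Vec ℕ k
[] ⊞ [] = []
(x ∷ xs) ⊞ (y ∷ ys) = x + y ∷ xs ⊞ ys

infixl 7 _⊠_
_⊠_ : ∀ {k} → Vec ℕ k → ℕ → Vec ℕ k
[] ⊠ c = []
(x ∷ xs) ⊠ c = x * c ∷ xs ⊠ c

zeros : ∀ k → Vec ℕ k
zeros zero = []
zeros (suc k) = 0 ∷ zeros k

unit : ∀ {k} → Fin k → Vec ℕ k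
unit {suc k} zero = 1 ∷ zeros k
unit (suc i) = 0 ∷ unit i

dot : ∀ {k} → Vec ℕ k → Vec ℕ k → ℕ
dot [] [] = 0
dot (c ∷ cs) (x ∷ xs) = x * c + dot cs xs

normal : ∀ {k} → Lin k → Normal k
normal (var i) = 0 ∷ unit i
normal {k} (con c) = c ∷ zeros k
normal (a ⊕ b) = normal a ⊞ normal b
normal (a ⊛ c) = normal a ⊠ c

swap-middle : ∀ a b c d → (a + b) + (c + d) ≡ (a + c) + (b + d)
swap-middle a b c d = trans (+-assoc a b (c + d))
  (trans (cong (a +_) (trans (sym (+-assoc b c d)) (trans (cong (_+ d) (+-comm b c)) (+-assoc c b d))))
         (sym (+-assoc a c (b + d))))

dot-⊞ : ∀ {k} (a b ρ : Vec ℕ k) → dot (a ⊞ b) ρ ≡ dot a ρ + dot b ρ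
dot-⊞ [] [] [] = refl
dot-⊞ (a ∷ as) (b ∷ bs) (x ∷ ρ) =
  trans (cong₂ _+_ (*-distribˡ-+ x a b) (dot-⊞ as bs ρ)) (swap-middle (x * a) (x * b) _ _)

dot-⊠ : ∀ {k} (a : Vec ℕ k) c ρ → dot (a ⊠ c) ρ ≡ dot a ρ * c
dot-⊠ [] c [] = refl
dot-⊠ (a ∷ as) c (x ∷ ρ) =
  trans (cong₂ _+_ (sym (*-assoc x a c)) (dot-⊠ as c ρ)) (sym (*-distribʳ-+ c (x * a) _))

dot-zeros : ∀ {k} (ρ : Vec ℕ k) → dot (zeros k) ρ ≡ 0
dot-zeros [] = refl
dot-zeros (x ∷ ρ) = cong₂ _+_ (*-zeroʳ x) (dot-zeros ρ)

dot-unit : ∀ {k} (i : Fin k) ρ → dot (unit i) ρ ≡ lookup ρ i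
dot-unit zero (x ∷ ρ) = trans (cong₂ _+_ (*-identityʳ x) (dot-zeros ρ)) (+-identityʳ x)
dot-unit (suc i) (x ∷ ρ) = cong₂ _+_ (*-zeroʳ x) (dot-unit i ρ)

normal-correct : ∀ {k} (a : Lin k) ρ → dot (normal a) (1 ∷ ρ) ≡ eval a ρ
normal-correct (var i) ρ = dot-unit i ρ
normal-correct (con c) ρ = trans (cong₂ _+_ (*-identityˡ c) (dot-zeros ρ)) (+-identityʳ c)
normal-correct (a ⊕ b) ρ =
  trans (dot-⊞ (normal a) (normal b) (1 ∷ ρ)) (cong₂ _+_ (normal-correct a ρ) (normal-correct b ρ))
normal-correct (a ⊛ c) ρ = trans (dot-⊠ (normal a) c (1 ∷ ρ)) (cong (_* c) (normal-correct a ρ))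

infix 4 _≼ᵇ_
_≼ᵇ_ : ∀ {k} → Vec ℕ k → Vec ℕ k → Bool
[] ≼ᵇ [] = true
(x ∷ xs) ≼ᵇ (y ∷ ys) = (x ≤ᵇ y) ∧ (xs ≼ᵇ ys)

T-∧ˡ : ∀ a {b} → T (a ∧ b) → T a
T-∧ˡ true _ = tt

T-∧ʳ : ∀ a {b} → T (a ∧ b) → T b
T-∧ʳ true t = t

dot-mono : ∀ {k} (a b ρ : Vec ℕ k) → T (a ≼ᵇ b) → dot a ρ ≤ dot b ρ
dot-mono [] [] [] _ = z≤n
dot-mono (a ∷ as) (b ∷ bs) (x ∷ ρ) t =
  +-mono-≤ (*-monoʳ-≤ x (≤ᵇ⇒≤ a b (T-∧ˡ (a ≤ᵇ b) t))) (dot-mono as bs ρ (T-∧ʳ (a ≤ᵇ b) t))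

-- The hypotheses scaled by the multipliers (missing multipliers count as 0) are added to
-- the goal scaled by 1 + c; a gap of c in the constant term is harmless over ℕ.
certified : ∀ {k} → Problem k → ℕ → List ℕ → Normal k → Normal k → Bool
certified {k} (h ∷ hs ⊢ g) c [] l r = certified (hs ⊢ g) c [] l r
certified ((a ⊑ b) ∷ hs ⊢ g) c (m ∷ ms) l r =
  certified (hs ⊢ g) c ms (l ⊞ normal a ⊠ m) (r ⊞ normal b ⊠ m)
certified {k} ([] ⊢ (a ⊑ b)) c _ l r = normal a ⊠ suc c ⊞ r ≼ᵇ (normal b ⊠ suc c ⊞ l) ⊞ (c ∷ zeros k)

-- `l` and `r` collect both sides of the scaled hypotheses. At the end the coefficientwise
-- comparison yields A(1 + c) ≤ B(1 + c) + c, and integrality removes the last c.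
linear-lemma : ∀ {k} (p : Problem k) c ms l r → T (certified p c ms l r) →
  ∀ ρ → dot l (1 ∷ ρ) ≤ dot r (1 ∷ ρ) → Meaning p ρ
linear-lemma (h ∷ hs ⊢ g) c [] l r t ρ lr _ = linear-lemma (hs ⊢ g) c [] l r t ρ lr
linear-lemma ((a ⊑ b) ∷ hs ⊢ g) c (m ∷ ms) l r t ρ lr ab =
  linear-lemma (hs ⊢ g) c ms _ _ t ρ
    (subst₂ _≤_ (sym (step l a)) (sym (step r b)) (+-mono-≤ lr (*-monoˡ-≤ m ab)))
  where
  step : ∀ u e → dot (u ⊞ normal e ⊠ m) (1 ∷ ρ) ≡ dot u (1 ∷ ρ) + eval e ρ * m
  step u e = trans (dot-⊞ u _ (1 ∷ ρ)) (cong (dot u (1 ∷ ρ) +_)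
    (trans (dot-⊠ (normal e) m (1 ∷ ρ)) (cong (_* m) (normal-correct e ρ))))
linear-lemma {k} ([] ⊢ (a ⊑ b)) c ms l r t ρ lr = goal
  where
  A = eval a ρ
  B = eval b ρ
  L = dot l (1 ∷ ρ)
  R = dot r (1 ∷ ρ)
  scaled : ∀ e → dot (normal e ⊠ suc c) (1 ∷ ρ) ≡ eval e ρ * suc c
  scaled e = trans (dot-⊠ (normal e) (suc c) (1 ∷ ρ)) (cong (_* suc c) (normal-correct e ρ))
  left : dot (normal a ⊠ suc c ⊞ r) (1 ∷ ρ) ≡ A * suc c + R
  left = trans (dot-⊞ (normal a ⊠ suc c) r (1 ∷ ρ)) (cong (_+ R) (scaled a))
  right : dot ((normal b ⊠ suc c ⊞ l) ⊞ (c ∷ zeros k)) (1 ∷ ρ) ≡ (B * suc c + L) + c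
  right = trans (dot-⊞ (normal b ⊠ suc c ⊞ l) _ (1 ∷ ρ)) (cong₂ _+_
    (trans (dot-⊞ (normal b ⊠ suc c) l (1 ∷ ρ)) (cong (_+ L) (scaled b)))
    (trans (cong₂ _+_ (*-identityˡ c) (dot-zeros ρ)) (+-identityʳ c)))
  bound : A * suc c + R ≤ (B * suc c + c) + R
  bound = ≤-trans (≤-reflexive (sym left)) (≤-trans (dot-mono (normal a ⊠ suc c ⊞ r) ((normal b ⊠ suc c ⊞ l) ⊞ (c ∷ zeros k)) (1 ∷ ρ) t) (≤-trans (≤-reflexive right)
    (≤-trans (≤-reflexive (trans (+-assoc (B * suc c) L c) (trans (cong (B * suc c +_) (+-comm L c)) (sym (+-assoc (B * suc c) c L)))))
             (+-monoʳ-≤ (B * suc c + c) lr))))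
  short : A * suc c < suc B * suc c
  short = ≤-trans (s≤s (+-cancelʳ-≤ R (A * suc c) (B * suc c + c) bound))
                  (≤-reflexive (trans (cong suc (+-comm (B * suc c) c)) refl))
  goal : A ≤ B
  goal with A ℕ.≤? B
  ... | yes A≤B = A≤B
  ... | no A≰B = contradiction (≤-trans short (*-monoˡ-≤ (suc c) (≰⇒> A≰B))) (<-irrefl refl)

-- Curried vectors: a problem is written as a function of named variables, and the resulting
-- inequality is applied to plain numbers.
Args : ℕ → ℕ → Set → Set
Args zero j A = A
Args (suc k) j A = Lin j → Args k j A

apply : ∀ {k j A} → Args k j A → Vec (Lin j) k → A
apply f [] = f
apply f (x ∷ xs) = apply (f x) xs

Closed : ∀ {k} → (Vec ℕ k → Set) → Set
Closed {zero} P = P []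
Closed {suc k} P = ∀ x → Closed (λ xs → P (x ∷ xs))

close : ∀ {k} {P : Vec ℕ k → Set} → (∀ ρ → P ρ) → Closed P
close {zero} p = p []
close {suc k} p x = close (λ xs → p (x ∷ xs))

-- Linear arithmetic over ℕ by a Farkas certificate: multipliers 1 + c of the goal and ms
-- of the hypotheses.
linear : ∀ k (f : Args k k (Problem k)) c ms →
  let p = apply f (tabulate var) in
  {_ : T (certified p c ms (zeros _) (zeros _))} → Closed (Meaning p)
linear k f c ms {t} = close (λ ρ → linear-lemma (apply f (tabulate var)) c ms (zeros _) (zeros _) t ρ ≤-refl)

-- Counting

-- Decision procedures and sums are opaque, so that they stay folded in normal forms.
infixr 1 _⊎-dec_
infixr 2 _×-dec_ _→-dec_
infix 4 _≤?_ _<?_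

opaque

  ¬? : {A : Set} → Dec A → Dec (¬ A)
  ¬? = Decidableₚ.¬?

  _×-dec_ : {A B : Set} → Dec A → Dec B → Dec (A × B)
  _×-dec_ = Decidableₚ._×-dec_

  _⊎-dec_ : {A B : Set} → Dec A → Dec B → Dec (A ⊎ B)
  _⊎-dec_ = Decidableₚ._⊎-dec_

  _→-dec_ : {A B : Set} → Dec A → Dec B → Dec (A → B)
  _→-dec_ = Decidableₚ._→-dec_

  any? : ∀ {n} {P : Fin n → Set} → Decidable P → Dec (∃ P)
  any? = Finₚ.any?

  all? : ∀ {n} {P : Fin n → Set} → Decidable P → Dec (∀ i → P i)
  all? = Finₚ.all?

  _≤?_ : ∀ m n → Dec (m ≤ n)
  _≤?_ = ℕ._≤?_

  _<?_ : ∀ m n → Dec (m < n)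
  _<?_ = ℕ._<?_

  sum : ∀ {n} → (Fin n → ℕ) → ℕ
  sum = Sum.sum +-0-commutativeMonoid

𝟙 : {A : Set} → Dec A → ℕ
𝟙 (yes _) = 1
𝟙 (no _) = 0

opaque
  # : ∀ {n} {P : Fin n → Set} → Decidable P → ℕ
  # P? = sum (λ i → 𝟙 (P? i))

opaque
  unfolding # sum _×-dec_

  sum-𝟙 : ∀ {n} {P : Fin n → Set} (P? : Decidable P) → sum (𝟙 ∘ P?) ≡ # P?
  sum-𝟙 P? = refl

𝟙≤1 : {A : Set} (a : Dec A) → 𝟙 a ≤ 1
𝟙≤1 (yes _) = ≤-refl
𝟙≤1 (no _) = z≤n

𝟙-yes : {A : Set} (a : Dec A) → A → 1 ≤ 𝟙 a
𝟙-yes (yes _) _ = ≤-refl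
𝟙-yes (no ¬a) a = contradiction a ¬a

opaque
  unfolding sum

  sum-mono : ∀ {n} {f g : Fin n → ℕ} → (∀ i → f i ≤ g i) → sum f ≤ sum g
  sum-mono {zero} h = z≤n
  sum-mono {suc n} h = +-mono-≤ (h zero) (sum-mono (h ∘ suc))

  sum-*ˡ : ∀ {n} c (f : Fin n → ℕ) → sum (λ i → c * f i) ≡ c * sum f
  sum-*ˡ {zero} c f = sym (*-zeroʳ c)
  sum-*ˡ {suc n} c f = trans (cong (c * f zero +_) (sum-*ˡ c (f ∘ suc))) (sym (*-distribˡ-+ c _ _))

  sum-term : ∀ {n} (f : Fin n → ℕ) i → f i ≤ sum f
  sum-term f zero = m≤m+n _ _
  sum-term f (suc i) = ≤-trans (sum-term (f ∘ suc) i) (m≤n+m _ _)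

  sum-+ : ∀ {n} (f g : Fin n → ℕ) → sum (λ i → f i + g i) ≡ sum f + sum g
  sum-+ = ∑-distrib-+

  sum-comm : ∀ {m n} (f : Fin m → Fin n → ℕ) → sum (λ i → sum (f i)) ≡ sum (λ j → sum (λ i → f i j))
  sum-comm = ∑-comm

  sum-cong : ∀ {n} {f g : Fin n → ℕ} → (∀ i → f i ≡ g i) → sum f ≡ sum g
  sum-cong = sum-cong-≗

opaque
  unfolding _×-dec_

  𝟙-× : {A B : Set} (a : Dec A) (b : Dec B) → 𝟙 (a ×-dec b) ≡ 𝟙 a * 𝟙 b
  𝟙-× (yes _) (yes _) = refl
  𝟙-× (yes _) (no _) = refl
  𝟙-× (no _) _ = refl

module _ {n} {P Q : Fin n → Set} (P? : Decidable P) (Q? : Decidable Q) where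
  opaque
    unfolding # sum _×-dec_

    #-mono : (∀ i → P i → Q i) → # P? ≤ # Q?
    #-mono h = sum-mono λ i → point (P? i) (Q? i) (h i)
      where
      point : ∀ {A B : Set} (a : Dec A) (b : Dec B) → (A → B) → 𝟙 a ≤ 𝟙 b
      point (yes a) b f = 𝟙-yes b (f a)
      point (no _) b f = z≤n

    pick : # Q? < # P? → ∃ λ i → P i × ¬ Q i
    pick h with any? (λ i → P? i ×-dec ¬? (Q? i))
    ... | yes w = w
    ... | no none = contradiction (#-mono covered) (<⇒≱ h)
      where
      covered : ∀ i → P i → Q i
      covered i p with Q? i
      ... | yes q = q
      ... | no ¬q = contradiction (i , p , ¬q) none

opaque
  unfolding # sum _×-dec_

  #-cong : ∀ {n} {P Q : Fin n → Set} (P? : Decidable P) (Q? : Decidable Q) →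
    (∀ i → P i → Q i) → (∀ i → Q i → P i) → # P? ≡ # Q?
  #-cong P? Q? f g = ≤-antisym (#-mono P? Q? f) (#-mono Q? P? g)

module _ {n} {P Q R : Fin n → Set} (P? : Decidable P) (Q? : Decidable Q) (R? : Decidable R) where
  opaque
    unfolding # sum _×-dec_

    #-cover : (∀ i → P i → Q i ⊎ R i) → # P? ≤ # Q? + # R?
    #-cover h = ≤-trans (sum-mono λ i → point (P? i) (Q? i) (R? i) (h i))
                        (≤-reflexive (sum-+ (𝟙 ∘ Q?) (𝟙 ∘ R?)))
      where
      point : ∀ {A B C : Set} (a : Dec A) (b : Dec B) (c : Dec C) → (A → B ⊎ C) → 𝟙 a ≤ 𝟙 b + 𝟙 c
      point (no _) b c f = z≤n
      point (yes a) b c f with f a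
      ... | inj₁ x = ≤-trans (𝟙-yes b x) (m≤m+n _ _)
      ... | inj₂ y = ≤-trans (𝟙-yes c y) (m≤n+m _ _)

    #-disjoint : (∀ i → Q i → P i) → (∀ i → R i → P i) → (∀ i → Q i → R i → ⊥) → # Q? + # R? ≤ # P?
    #-disjoint f g h = ≤-trans (≤-reflexive (sym (sum-+ (𝟙 ∘ Q?) (𝟙 ∘ R?))))
                               (sum-mono λ i → point (P? i) (Q? i) (R? i) (f i) (g i) (h i))
      where
      point : ∀ {A B C : Set} (a : Dec A) (b : Dec B) (c : Dec C) →
        (B → A) → (C → A) → (B → C → ⊥) → 𝟙 b + 𝟙 c ≤ 𝟙 a
      point a (yes b) (yes c) f g h = ⊥-elim (h b c)
      point a (yes b) (no _) f g h = 𝟙-yes a (f b)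
      point a (no _) (yes c) f g h = 𝟙-yes a (g c)
      point a (no _) (no _) f g h = z≤n

module _ {n} {P Q : Fin n → Set} (P? : Decidable P) (Q? : Decidable Q) where
  #-split : # P? ≡ # (λ i → P? i ×-dec Q? i) + # (λ i → P? i ×-dec ¬? (Q? i))
  #-split = ≤-antisym (#-cover P? _ _ cases) (#-disjoint P? _ _ (λ _ → proj₁) (λ _ → proj₁) (λ _ q ¬q → proj₂ ¬q (proj₂ q)))
    where
    cases : ∀ i → P i → P i × Q i ⊎ P i × ¬ Q i
    cases i p with Q? i
    ... | yes q = inj₁ (p , q)
    ... | no ¬q = inj₂ (p , ¬q)

opaque
  unfolding # sum _×-dec_

  #-all : ∀ {n} {P : Fin n → Set} (P? : Decidable P) → (∀ i → P i) → # P? ≡ n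
  #-all {zero} P? h = refl
  #-all {suc n} P? h = cong₂ _+_ (≤-antisym (𝟙≤1 (P? zero)) (𝟙-yes (P? zero) (h zero))) (#-all (P? ∘ suc) (h ∘ suc))

  #≤n : ∀ {n} {P : Fin n → Set} (P? : Decidable P) → # P? ≤ n
  #≤n {zero} P? = z≤n
  #≤n {suc n} P? = +-mono-≤ (𝟙≤1 (P? zero)) (#≤n (P? ∘ suc))

#-complement : ∀ {n} {P : Fin n → Set} (P? : Decidable P) → # P? + # (¬? ∘ P?) ≡ n
#-complement {n} {P} P? = ≤-antisym
  (≤-trans (#-disjoint everything P? (¬? ∘ P?) _ _ (λ _ p ¬p → ¬p p)) (#≤n everything))
  (≤-trans (≤-reflexive (sym (#-all everything _))) (#-cover everything P? (¬? ∘ P?) cases))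
  where
  everything : ∀ i → Dec ⊤
  everything _ = yes tt
  cases : ∀ i → ⊤ → P i ⊎ ¬ P i
  cases i _ with P? i
  ... | yes p = inj₁ p
  ... | no ¬p = inj₂ ¬p

opaque
  unfolding # sum _×-dec_

  #-empty : ∀ {n} {P : Fin n → Set} (P? : Decidable P) → (∀ i → ¬ P i) → # P? ≡ 0
  #-empty {zero} P? h = refl
  #-empty {suc n} P? h with P? zero
  ... | yes p = contradiction p (h zero)
  ... | no _ = #-empty (P? ∘ suc) (h ∘ suc)

  #-positive : ∀ {n} {P : Fin n → Set} (P? : Decidable P) {i} → P i → 1 ≤ # P?
  #-positive P? {i} p = ≤-trans (𝟙-yes (P? i) p) (sum-term (𝟙 ∘ P?) i)

  #-unique : ∀ {n} {P : Fin n → Set} (P? : Decidable P) → (∀ i j → P i → P j → i ≡ j) → # P? ≤ 1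
  #-unique {zero} P? h = z≤n
  #-unique {suc n} P? h with P? zero
  ... | yes p = ≤-reflexive (cong suc (#-empty (P? ∘ suc) λ i q → case h zero (suc i) p q of λ ()))
  ... | no _ = #-unique (P? ∘ suc) λ i j p q → Finₚ.suc-injective (h (suc i) (suc j) p q)

  nonempty : ∀ {n} {P : Fin n → Set} (P? : Decidable P) → 1 ≤ # P? → ∃ P
  nonempty {n} P? h with pick P? (λ _ → no id) (≤-trans (≤-reflexive (cong suc (#-empty {n} (λ _ → no id) λ _ → id))) h)
  ... | i , p , _ = i , p

  #-weighted : ∀ {n} {P : Fin n → Set} (P? : Decidable P) {f : Fin n → ℕ} {k} →
    (∀ i → P i → f i ≤ k) → sum (λ i → 𝟙 (P? i) * f i) ≤ # P? * k
  #-weighted P? {f} {k} h = ≤-trans (sum-mono λ i → point i (P? i) refl)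
    (≤-reflexive (trans (sum-*ˡ k (𝟙 ∘ P?)) (*-comm k _)))
    where
    point : ∀ i a → P? i ≡ a → 𝟙 a * f i ≤ k * 𝟙 a
    point i (yes p) _ = ≤-trans (≤-reflexive (*-identityˡ (f i))) (≤-trans (h i p) (≤-reflexive (sym (*-identityʳ k))))
    point i (no _) _ = z≤n

module _ {a b} {A : Fin a → Set} {R : Fin a → Fin b → Set}
         (A? : Decidable A) (R? : ∀ u y → Dec (R u y)) where
  opaque
    unfolding # sum _×-dec_

    count-pairs : sum (λ y → # (λ u → A? u ×-dec R? u y)) ≡ sum (λ u → 𝟙 (A? u) * # (R? u))
    count-pairs = trans (sum-comm (λ y u → 𝟙 (A? u ×-dec R? u y)))
      (sum-cong λ u → trans (sum-cong λ y → product (A? u) (R? u y)) (sum-*ˡ (𝟙 (A? u)) (𝟙 ∘ R? u)))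
      where
      product : ∀ {A B : Set} (a : Dec A) (b : Dec B) → 𝟙 (a ×-dec b) ≡ 𝟙 a * 𝟙 b
      product (yes _) (yes _) = refl
      product (yes _) (no _) = refl
      product (no _) _ = refl

    double-count : ∀ {P : Fin b → Set} (P? : Decidable P) {k l : ℕ} → (∀ u → A u → # (R? u) ≤ k) →
      (∀ y → P y → l ≤ # (λ u → A? u ×-dec R? u y)) → # P? * l ≤ # A? * k
    double-count {P} P? {k} {l} upper lower = begin
      # P? * l                                   ≡⟨ trans (*-comm (# P?) l) (sym (sum-*ˡ l (𝟙 ∘ P?))) ⟩
      sum (λ y → l * 𝟙 (P? y))                   ≤⟨ sum-mono (λ y → point y (P? y)) ⟩
      sum (λ y → # (λ u → A? u ×-dec R? u y))    ≡⟨ count-pairs ⟩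
      sum (λ u → 𝟙 (A? u) * # (R? u))            ≤⟨ #-weighted A? upper ⟩
      # A? * k                                   ∎
      where
      open ≤-Reasoning
      point : ∀ y (p : Dec (P y)) → l * 𝟙 p ≤ # (λ u → A? u ×-dec R? u y)
      point y (yes p) = ≤-trans (≤-reflexive (*-identityʳ l)) (lower y p)
      point y (no _) = ≤-trans (≤-reflexive (*-zeroʳ l)) z≤n

  union-bound-weighted : ∀ {P : Fin b → Set} (P? : Decidable P) {w : Fin a → ℕ} → (∀ u → A u → # (R? u) ≤ w u) →
    (∀ y → P y → ∃ λ u → A u × R u y) → # P? ≤ sum (λ u → 𝟙 (A? u) * w u)
  union-bound-weighted {P} P? {w} upper covered = begin
    # P?                                       ≡⟨ sym (sum-𝟙 P?) ⟩
    sum (𝟙 ∘ P?)                               ≤⟨ sum-mono (λ y → point y (P? y)) ⟩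
    sum (λ y → # (λ u → A? u ×-dec R? u y))    ≡⟨ count-pairs ⟩
    sum (λ u → 𝟙 (A? u) * # (R? u))            ≤⟨ sum-mono (λ u → term u (A? u)) ⟩
    sum (λ u → 𝟙 (A? u) * w u)                 ∎
    where
    open ≤-Reasoning
    point : ∀ y (p : Dec (P y)) → 𝟙 p ≤ # (λ u → A? u ×-dec R? u y)
    point y (yes p) = #-positive (λ u → A? u ×-dec R? u y) (proj₂ (covered y p))
    point y (no _) = z≤n
    term : ∀ u (p : Dec (A u)) → 𝟙 p * # (R? u) ≤ 𝟙 p * w u
    term u (yes p) = *-monoʳ-≤ 1 (upper u p)
    term u (no _) = z≤n

  union-bound : ∀ {P : Fin b → Set} (P? : Decidable P) {k} → (∀ u → A u → # (R? u) ≤ k) →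
    (∀ y → P y → ∃ λ u → A u × R u y) → # P? ≤ # A? * k
  union-bound P? upper covered = ≤-trans (union-bound-weighted P? upper covered) (#-weighted A? λ _ _ → ≤-refl)

module _ {a b} {P : Fin a → Set} {Q : Fin b → Set} {R : Fin a → Fin b → Set}
         (P? : Decidable P) (Q? : Decidable Q) (R? : ∀ i x → Dec (R i x)) where
  opaque
    unfolding # sum _×-dec_

    #-injection : (∀ i → P i → ∃ λ x → Q x × R i x) → (∀ i j x → P i → P j → R i x → R j x → i ≡ j) → # P? ≤ # Q?
    #-injection total inj = ≤-trans
      (union-bound Q? (λ x i → P? i ×-dec R? i x) P?
        (λ x _ → #-unique _ λ i j p q → inj i j x (proj₁ p) (proj₁ q) (proj₂ p) (proj₂ q))
        (λ i p → let x , q , r = total i p in x , q , p , r))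
      (≤-reflexive (*-identityʳ (# Q?)))

module _ {a b} {P : Fin a → Set} (P? : Decidable P) (f : Fin a → Fin b) where

  Image : Fin b → Set
  Image y = ∃ λ i → P i × f i ≡ y

  image? : Decidable Image
  image? y = any? λ i → P? i ×-dec (f i F.≟ y)

  #-image : # image? ≤ # P?
  #-image = ≤-trans (union-bound P? (λ i y → f i F.≟ y) image?
    (λ i _ → #-unique (λ y → f i F.≟ y) λ _ _ p q → trans (sym p) q) (λ _ → id)) (≤-reflexive (*-identityʳ (# P?)))

-- Subsets whose members are chosen one by one are given by Boolean functions.
∈? : ∀ {n} (q : Fin n → Bool) → Decidable (λ i → q i ≡ true)
∈? q i = q i B.≟ true

opaque
  unfolding # sum _×-dec_

  choose : ∀ {n} {P : Fin n → Set} (P? : Decidable P) k → k ≤ # P? →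
    ∃ λ q → (∀ i → q i ≡ true → P i) × # (∈? q) ≡ k
  choose {zero} P? .0 z≤n = (λ ()) , (λ ()) , refl
  choose {suc n} {P} P? k k≤ with P? zero
  choose {suc n} {P} P? zero k≤ | yes p = (λ _ → false) , (λ _ ()) , #-empty {n} (∈? (λ _ → false)) λ _ ()
  choose {suc n} {P} P? (suc k) (s≤s k≤) | yes p with choose (P? ∘ suc) k k≤
  ... | q , sound , size = q′ , sound′ , cong suc size
    where
    q′ : Fin (suc n) → Bool
    q′ zero = true
    q′ (suc i) = q i
    sound′ : ∀ i → q′ i ≡ true → P i
    sound′ zero _ = p
    sound′ (suc i) = sound i
  choose {suc n} {P} P? k k≤ | no ¬p with choose (P? ∘ suc) k k≤
  ... | q , sound , size = q′ , sound′ , size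
    where
    q′ : Fin (suc n) → Bool
    q′ zero = false
    q′ (suc i) = q i
    sound′ : ∀ i → q′ i ≡ true → P i
    sound′ zero ()
    sound′ (suc i) = sound i

-- Greedy choices and matchings

InjectiveOn : ∀ {a b} → (Fin a → Set) → (Fin a → Fin b) → Set
InjectiveOn P f = ∀ i j → P i → P j → f i ≡ f j → i ≡ j

update : ∀ {n} {A : Set} → (Fin n → A) → Fin n → A → Fin n → A
update f v y u with u F.≟ v
... | yes _ = y
... | no _ = f u

update-at : ∀ {n} {A : Set} (f : Fin n → A) v y → update f v y v ≡ y
update-at f v y with v F.≟ v
... | yes _ = refl
... | no v≢v = contradiction refl v≢v

update-other : ∀ {n} {A : Set} (f : Fin n → A) v y {u} → u ≢ v → update f v y u ≡ f u
update-other f v y {u} u≢v with u F.≟ v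
... | yes u≡v = contradiction u≡v u≢v
... | no _ = refl

-- The vertices of Q are placed in the order of their ranks; w u v bounds the number of
-- candidates for v that the position of u rules out.
module Greedy {n N} {K : Fin n → Fin N → Set} (K? : ∀ v y → Dec (K v y))
  {C : Fin n → Fin n → Fin N → Fin N → Set} (C? : ∀ u v x y → Dec (C u v x y))
  (C-sym : ∀ {u v x y} → C u v x y → C v u y x)
  {S Q : Fin n → Set} (S? : Decidable S) (Q? : Decidable Q) (S∩Q : ∀ v → S v → Q v → ⊥)
  (rank : Fin n → ℕ) (rank-injective : ∀ {u v} → rank u ≡ rank v → u ≡ v)
  where

  Valid : (Fin n → Set) → (Fin n → Fin N) → Set
  Valid P f = ∀ u v → P u → P v → u ≢ v → C u v (f u) (f v)

  Before : ℕ → Fin n → Set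
  Before t u = S u ⊎ Q u × rank u < t

  before? : ∀ t → Decidable (Before t)
  before? t u = S? u ⊎-dec (Q? u ×-dec (rank u <? t))

  module _ (w : Fin n → Fin n → ℕ) (f₀ : Fin n → Fin N)
    (f₀∈K : ∀ u → S u → K u (f₀ u)) (valid₀ : Valid S f₀)
    (bound : ∀ u v x → S u ⊎ Q u → Q v → u ≢ v → K u x →
             # (λ y → K? v y ×-dec ¬? (C? u v x y)) ≤ w u v)
    (room : ∀ v → Q v → sum (λ u → 𝟙 (before? (rank v) u) * w u v) < # (K? v)) where

    Stage : ℕ → Set
    Stage t = ∃ λ f → (∀ u → S u → f u ≡ f₀ u) × (∀ u → Before t u → K u (f u)) × Valid (Before t) f

    free-position : ∀ v (f : Fin n → Fin N) → Q v → (∀ u → Before (rank v) u → K u (f u)) →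
      ∃ λ y → K v y × (∀ u → Before (rank v) u → C u v (f u) y)
    free-position v f q f∈K = y , ky , ok
      where
      blocked? : Decidable (λ y → K v y × ∃ λ u → Before (rank v) u × (K v y × ¬ C u v (f u) y))
      blocked? y = K? v y ×-dec any? (λ u → before? (rank v) u ×-dec (K? v y ×-dec ¬? (C? u v (f u) y)))
      distinct : ∀ u → Before (rank v) u → u ≢ v
      distinct u (inj₁ s) refl = S∩Q u s q
      distinct u (inj₂ (_ , lt)) refl = <-irrefl refl lt
      weaken : ∀ {t} u → Before t u → S u ⊎ Q u
      weaken u (inj₁ s) = inj₁ s
      weaken u (inj₂ (q , _)) = inj₂ q
      few : # blocked? < # (K? v)
      few = ≤-<-trans (union-bound-weighted (before? (rank v)) (λ u y → K? v y ×-dec ¬? (C? u v (f u) y)) blocked?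
                        (λ u b → bound u v (f u) (weaken u b) q (distinct u b) (f∈K u b)) (λ _ → proj₂))
                      (room v q)
      opaque
        picked : ∃ λ y → K v y × ¬ (K v y × ∃ λ u → Before (rank v) u × (K v y × ¬ C u v (f u) y))
        picked = pick (K? v) blocked? few
      y : Fin N
      y = proj₁ picked
      ky : K v y
      ky = proj₁ (proj₂ picked)
      ok : ∀ u → Before (rank v) u → C u v (f u) y
      ok u b with C? u v (f u) y
      ... | yes c = c
      ... | no ¬c = contradiction (ky , u , b , ky , ¬c) (proj₂ (proj₂ picked))

    -- Induction on a rank threshold. Ranks are injective, so raising the threshold by one brings in
    -- at most one vertex.
    stage : ∀ t → Stage t
    stage zero = f₀ , (λ _ _ → refl) , (λ { u (inj₁ s) → f₀∈K u s ; u (inj₂ (_ , ())) }) ,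
      λ { u v (inj₁ s) (inj₁ s′) → valid₀ u v s s′ ; u v (inj₂ (_ , ())) _ ; u v _ (inj₂ (_ , ())) }
    stage (suc t) with stage t | any? (λ v → Q? v ×-dec (rank v ℕ.≟ t))
    ... | f , agree , inside , valid | no none =
      f , agree , (λ u b → inside u (shrink u b)) , λ u v b b′ → valid u v (shrink u b) (shrink v b′)
      where
      shrink : ∀ u → Before (suc t) u → Before t u
      shrink u (inj₁ s) = inj₁ s
      shrink u (inj₂ (q , s≤s le)) with m≤n⇒m<n∨m≡n le
      ... | inj₁ lt = inj₂ (q , lt)
      ... | inj₂ eq = contradiction (u , q , eq) none
    ... | f , agree , inside , valid | yes (v , q , refl) = f′ , agree′ , inside′ , valid′
      where
      opaque
        position : ∃ λ y → K v y × (∀ u → Before (rank v) u → C u v (f u) y)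
        position = free-position v f q inside
      y : Fin N
      y = proj₁ position
      f′ : Fin n → Fin N
      f′ = update f v y
      agree′ : ∀ u → S u → f′ u ≡ f₀ u
      agree′ u s = trans (update-other f v y λ { refl → S∩Q u s q }) (agree u s)
      old : ∀ u → Before (suc t) u → u ≡ v ⊎ Before t u × f′ u ≡ f u
      old u b with u F.≟ v
      old u b | yes refl = inj₁ refl
      old u (inj₁ s) | no u≢v = inj₂ (inj₁ s , refl)
      old u (inj₂ (q′ , s≤s le)) | no u≢v with m≤n⇒m<n∨m≡n le
      ... | inj₁ lt = inj₂ (inj₂ (q′ , lt) , refl)
      ... | inj₂ eq = contradiction (rank-injective eq) u≢v
      inside′ : ∀ u → Before (suc t) u → K u (f′ u)
      inside′ u b with old u b
      ... | inj₁ refl = subst (K u) (sym (update-at f v y)) (proj₁ (proj₂ position))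
      ... | inj₂ (b′ , eq) = subst (K u) (sym eq) (inside u b′)
      new : ∀ u → Before t u × f′ u ≡ f u → C u v (f′ u) (f′ v)
      new u (b , eq) = subst₂ (C u v) (sym eq) (sym (update-at f v y)) (proj₂ (proj₂ position) u b)
      valid′ : Valid (Before (suc t)) f′
      valid′ u u′ b b′ u≢u′ with old u b | old u′ b′
      ... | inj₁ refl | inj₁ refl = contradiction refl u≢u′
      ... | inj₁ refl | inj₂ o′ = C-sym (new u′ o′)
      ... | inj₂ o | inj₁ refl = new u o
      ... | inj₂ (o , eq) | inj₂ (o′ , eq′) = subst₂ (C u u′) (sym eq) (sym eq′) (valid u u′ o o′ u≢u′)

    opaque

      greedy : ∃ λ f → (∀ u → S u → f u ≡ f₀ u) × (∀ u → S u ⊎ Q u → K u (f u)) × Valid (λ u → S u ⊎ Q u) f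
      -- The sum of all ranks bounds each of them, so this threshold covers the whole of `Q`.
      greedy with stage (suc (sum rank))
      ... | f , agree , inside , valid =
        f , agree , (λ u p → inside u (widen u p)) , λ u v p p′ → valid u v (widen u p) (widen v p′)
        where
        widen : ∀ u → S u ⊎ Q u → Before (suc (sum rank)) u
        widen u (inj₁ s) = inj₁ s
        widen u (inj₂ q) = inj₂ (q , s≤s (sum-term rank u))

module _ {a b : ℕ} {L : Fin a → Set} (L? : Decidable L) where

  opaque

    -- Only distinctness is required, and at most |L| - 1 earlier choices compete for the |L|
    -- candidates of a vertex. The element `d` is a dummy value for a function that must be total.
    transversal : ∀ {R : Fin a → Fin b → Set} (R? : ∀ l r → Dec (R l r)) → Fin b → (∀ l → L l → # L? ≤ # (R? l)) →
      ∃ λ f → (∀ l → L l → R l (f l)) × InjectiveOn L f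
    transversal {R} R? d enough with G.greedy (λ _ _ → 1) (λ _ → d) (λ _ ()) (λ _ _ ()) bound room
      where
      module G = Greedy {K = R} R? {C = λ _ _ → _≢_} (λ _ _ x y → ¬? (x F.≟ y)) (λ p q → p (sym q))
                   {S = λ _ → ⊥} {Q = L} (λ _ → no id) L? (λ _ ()) toℕ toℕ-injective
      bound : ∀ u v x → ⊥ ⊎ L u → L v → u ≢ v → R u x → # (λ y → R? v y ×-dec ¬? (¬? (x F.≟ y))) ≤ 1
      bound u v x _ _ _ _ = #-unique _ λ y z p q → trans (sym (equal y p)) (equal z q)
        where
        equal : ∀ y → R v y × ¬ x ≢ y → x ≡ y
        equal y (_ , nn) with x F.≟ y
        ... | yes eq = eq
        ... | no ne = contradiction ne nn
      room : ∀ v → L v → sum (λ u → 𝟙 (G.before? (toℕ v) u) * 1) < # (R? v)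
      room v l = ≤-trans (s≤s (≤-trans (#-weighted (G.before? (toℕ v)) {f = λ _ → 1} (λ _ _ → ≤-refl)) (≤-reflexive (*-identityʳ _))))
        (≤-trans (≤-trans (≤-reflexive (+-comm 1 _))
          (≤-trans (+-monoʳ-≤ _ (#-positive (λ u → u F.≟ v) refl))
            (#-disjoint L? (G.before? (toℕ v)) (λ u → u F.≟ v) (λ { u (inj₂ (l , _)) → l }) (λ { u refl → l })
              λ { u (inj₂ (_ , lt)) refl → <-irrefl refl lt }))) (enough v l))
    ... | f , _ , inside , valid = f , (λ l p → inside l (inj₂ p)) , injective
      where
      injective : InjectiveOn L f
      injective i j p q eq with i F.≟ j
      ... | yes i≡j = i≡j
      ... | no i≢j = contradiction eq (valid i j (inj₂ p) (inj₂ q) i≢j)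

  inject : ∀ {R : Fin b → Set} (R? : Decidable R) → Fin b → # L? ≤ # R? → ∃ λ f → (∀ l → L l → R (f l)) × InjectiveOn L f
  inject R? d L≤R = transversal (λ _ → R?) d λ _ _ → L≤R

#-remove : ∀ {n} {P Q : Fin n → Set} (P? : Decidable P) (Q? : Decidable Q) {i} → P i →
  (∀ j → Q j → P j × j ≢ i) → # Q? < # P?
#-remove P? Q? {i} p h = ≤-trans (≤-reflexive (+-comm 1 _))
  (≤-trans (+-monoʳ-≤ _ (#-positive (λ j → j F.≟ i) refl))
    (#-disjoint P? Q? (λ j → j F.≟ i) (λ j → proj₁ ∘ h j) (λ { j refl → p }) λ j → proj₂ ∘ h j))

module _ {a b} {L : Fin a → Set} {R : Fin b → Set} {E : Fin a → Fin b → Set}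
  (L? : Decidable L) (R? : Decidable R) (E? : ∀ l r → Dec (E l r)) {α β : ℕ}
  (missˡ : ∀ l → L l → # (λ r → R? r ×-dec ¬? (E? l r)) ≤ α)
  (missʳ : ∀ r → R r → # (λ l → L? l ×-dec ¬? (E? l r)) ≤ β)
  (enough : α + β < # L?) where

  Unmatched : (Fin a → Fin b) → Fin a → Set
  Unmatched f l = L l × ¬ E l (f l)

  unmatched? : ∀ f → Decidable (Unmatched f)
  unmatched? f l = L? l ×-dec ¬? (E? l (f l))

  -- A bad vertex l exchanges its partner with a suitable vertex l′; this makes l good and
  -- keeps all other good vertices good.
  repair : ∀ k f → (∀ l → L l → R (f l)) → InjectiveOn L f → # (unmatched? f) ≤ k →
    ∃ λ g → (∀ l → L l → R (g l) × E l (g l)) × InjectiveOn L g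
  repair k f f∈R inj bound with any? (unmatched? f)
  ... | no none = f , (λ l p → f∈R l p , good l p) , inj
    where
    good : ∀ l → L l → E l (f l)
    good l p with E? l (f l)
    ... | yes e = e
    ... | no ¬e = contradiction (l , p , ¬e) none
  repair zero f f∈R inj bound | yes (l , bad) = contradiction (#-positive (unmatched? f) bad) (<⇒≱ (s≤s bound))
  repair (suc k) f f∈R inj bound | yes (l , l∈L , ¬e) = repair k g g∈R g-inj shrink
    where
    unsuitable? : Decidable (λ l′ → (L l′ × ¬ E l (f l′)) ⊎ (L l′ × ¬ E l′ (f l)))
    unsuitable? l′ = (L? l′ ×-dec ¬? (E? l (f l′))) ⊎-dec (L? l′ ×-dec ¬? (E? l′ (f l)))
    -- `f` is injective, so at most α vertices hold a partner that is not joined to `l`; at most β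
    -- vertices are not joined to `f l`.
    few : # unsuitable? < # L?
    few = ≤-<-trans (≤-trans
      (#-cover unsuitable? (λ l′ → L? l′ ×-dec ¬? (E? l (f l′))) (λ l′ → L? l′ ×-dec ¬? (E? l′ (f l))) λ _ → id)
      (+-mono-≤ (≤-trans (#-injection (λ l′ → L? l′ ×-dec ¬? (E? l (f l′))) (λ r → R? r ×-dec ¬? (E? l r))
                                      (λ i x → f i F.≟ x)
                                      (λ i p → f i , (f∈R i (proj₁ p) , proj₂ p) , refl)
                                      (λ i j x p q r s → inj i j (proj₁ p) (proj₁ q) (trans r (sym s))))
                         (missˡ l l∈L))
                (missʳ (f l) (f∈R l l∈L)))) enough
    opaque
      found : ∃ λ l′ → L l′ × ¬ ((L l′ × ¬ E l (f l′)) ⊎ (L l′ × ¬ E l′ (f l)))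
      found = pick L? unsuitable? few
    l′ : Fin a
    l′ = proj₁ found
    l′∈L : L l′
    l′∈L = proj₁ (proj₂ found)
    e : E l (f l′)
    e with E? l (f l′)
    ... | yes p = p
    ... | no ¬p = contradiction (inj₁ (l′∈L , ¬p)) (proj₂ (proj₂ found))
    e′ : E l′ (f l)
    e′ with E? l′ (f l)
    ... | yes p = p
    ... | no ¬p = contradiction (inj₂ (l′∈L , ¬p)) (proj₂ (proj₂ found))
    g : Fin a → Fin b
    g = update (update f l (f l′)) l′ (f l)
    data View (i : Fin a) : Set where
      first : i ≡ l → g i ≡ f l′ → View i
      second : i ≡ l′ → g i ≡ f l → View i
      other : i ≢ l → i ≢ l′ → g i ≡ f i → View i
    view : ∀ i → View i
    view i with i F.≟ l′
    ... | yes refl = second refl (update-at _ l′ (f l))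
    ... | no i≢l′ with i F.≟ l
    ...   | yes refl = first refl (trans (update-other _ l′ (f l) i≢l′) (update-at f l (f l′)))
    ...   | no i≢l = other i≢l i≢l′ (trans (update-other _ l′ (f l) i≢l′) (update-other f l (f l′) i≢l))
    g∈R : ∀ i → L i → R (g i)
    g∈R i p with view i
    ... | first _ eq = subst R (sym eq) (f∈R l′ l′∈L)
    ... | second _ eq = subst R (sym eq) (f∈R l l∈L)
    ... | other _ _ eq = subst R (sym eq) (f∈R i p)
    g-inj : InjectiveOn L g
    g-inj i j p q eq with view i | view j
    ... | first refl _ | first refl _ = refl
    ... | first refl x | second refl y = inj l l′ p q (trans (sym y) (trans (sym eq) x))
    ... | first refl x | other _ j≢ y = contradiction (inj j l′ q l′∈L (trans (sym y) (trans (sym eq) x))) j≢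
    ... | second refl x | first refl y = inj l′ l p q (trans (sym y) (trans (sym eq) x))
    ... | second refl _ | second refl _ = refl
    ... | second refl x | other j≢ _ y = contradiction (inj j l q l∈L (trans (sym y) (trans (sym eq) x))) j≢
    ... | other _ i≢ x | first refl y = contradiction (inj i l′ p l′∈L (trans (sym x) (trans eq y))) i≢
    ... | other i≢ _ x | second refl y = contradiction (inj i l p l∈L (trans (sym x) (trans eq y))) i≢
    ... | other _ _ x | other _ _ y = inj i j p q (trans (sym x) (trans eq y))
    still : ∀ i → Unmatched g i → Unmatched f i × i ≢ l
    still i (p , ¬q) with view i
    ... | first refl eq = contradiction (subst (E i) (sym eq) e) ¬q
    ... | second refl eq = contradiction (subst (E i) (sym eq) e′) ¬q
    ... | other i≢l _ eq = (p , λ r → ¬q (subst (E i) (sym eq) r)) , i≢l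
    shrink : # (unmatched? g) ≤ k
    shrink = ℕ.s≤s⁻¹ (≤-trans (#-remove (unmatched? f) (unmatched? g) (l∈L , ¬e) still) bound)

  opaque

    matching : # L? ≤ # R? → ∃ λ f → (∀ l → L l → R (f l) × E l (f l)) × InjectiveOn L f
    matching L≤R with inject L? R? (proj₁ (nonempty R? (≤-trans (≤-trans (s≤s z≤n) enough) L≤R))) L≤R
    ... | f , f∈R , inj = repair _ f f∈R inj ≤-refl

-- The instances of linear arithmetic are closed terms; they stay outside the long telescopes in which
-- they are used.
estimate-1 = linear 4 (λ m κ x3 half → (con 1 ⊕ (m ⊕ κ) ⊛ 2 ⊑ x3) ∷ (half ⊛ 2 ⊑ x3) ∷ [] ⊢ con 1 ⊕ (m ⊕ κ ⊕ half) ⊑ x3) 1 (1 ∷ 1 ∷ [])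

-- Elements of R outside the core C may be useless for many l, so only κ of them are used.
module _ {a b} {L : Fin a → Set} {R C : Fin b → Set} {E : Fin a → Fin b → Set}
  (L? : Decidable L) (R? : Decidable R) (C? : Decidable C) (E? : ∀ l r → Dec (E l r)) {m κ : ℕ}
  (R-many : # L? ≤ # R?)
  (R-half : ∀ r → R r → # (λ l → L? l ×-dec ¬? (E? l r)) * 2 ≤ # L?)
  (C-miss : ∀ l → L l → # (λ r → C? r ×-dec ¬? (E? l r)) ≤ m)
  (C-many : # L? ≤ # (λ r → R? r ×-dec C? r) + κ)
  (enough : (m + κ) * 2 < # L?) where

  complete-by-majority : ∃ λ f → (∀ l → L l → R (f l) × E l (f l)) × InjectiveOn L f
  complete-by-majority = proj₁ result , (λ l p → proj₁ (proj₁ (proj₁ (proj₂ result) l p)) , proj₂ (proj₁ (proj₂ result) l p)) , proj₂ (proj₂ result)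
    where
    RC? : Decidable (λ r → R r × C r)
    RC? r = R? r ×-dec C? r
    R∖C? : Decidable (λ r → R r × ¬ C r)
    R∖C? r = R? r ×-dec ¬? (C? r)
    k = # L? ∸ # RC?
    k≤ : k ≤ # R∖C?
    k≤ = ≤-trans (∸-monoˡ-≤ (# RC?) (≤-trans R-many (≤-reflexive (#-split R? C?)))) (≤-reflexive (m+n∸m≡n (# RC?) _))
    k≤κ : k ≤ κ
    k≤κ = ≤-trans (∸-monoˡ-≤ (# RC?) C-many) (≤-reflexive (m+n∸m≡n (# RC?) κ))
    extra = choose R∖C? k k≤
    q = proj₁ extra
    R′? : Decidable (λ r → R r × (C r ⊎ q r ≡ true))
    R′? r = R? r ×-dec (C? r ⊎-dec ∈? q r)
    size : # L? ≤ # R′?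
    size = ≤-trans (m≤n+m∸n (# L?) (# RC?)) (≤-trans (+-monoʳ-≤ (# RC?) (≤-reflexive (sym (proj₂ (proj₂ extra)))))
      (#-disjoint R′? RC? (∈? q) (λ { r (p , c) → p , inj₁ c }) (λ r t → proj₁ (proj₁ (proj₂ extra) r t) , inj₂ t)
        λ { r (_ , c) t → proj₂ (proj₁ (proj₂ extra) r t) c }))
    missˡ : ∀ l → L l → # (λ r → R′? r ×-dec ¬? (E? l r)) ≤ m + κ
    missˡ l p = ≤-trans (#-cover _ (λ r → C? r ×-dec ¬? (E? l r)) (∈? q)
        λ { r ((_ , inj₁ c) , ¬e) → inj₁ (c , ¬e) ; r ((_ , inj₂ t) , _) → inj₂ t })
      (+-mono-≤ (C-miss l p) (≤-trans (≤-reflexive (proj₂ (proj₂ extra))) k≤κ))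
    -- In the exchange argument α = m + κ and β = |L|/2. Since 2(m + κ) < |L|, a suitable partner
    -- remains although an element of `R` may miss half of `L`.
    half = # L? / 2
    missʳ : ∀ r → R r × (C r ⊎ q r ≡ true) → # (λ l → L? l ×-dec ¬? (E? l r)) ≤ half
    missʳ r (p , _) = ≤-trans (≤-reflexive (sym (m*n/n≡m _ 2))) (/-monoˡ-≤ 2 (R-half r p))
    room : m + κ + half < # L?
    room = estimate-1 m κ (# L?) half enough (m/n*n≤m (# L?) 2)
    result = matching L? R′? E? missˡ missʳ room size

-- Trees

module _ {n} (T : Graph n) where

  adj? : ∀ u v → Dec (Adj T u v)
  adj? u v = adj T u v B.≟ true

  Adj-sym : ∀ {u v} → Adj T u v → Adj T v u
  Adj-sym {u} {v} e = trans (adj-sym T v u) e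

  Adj-irrefl : ∀ {u} → ¬ Adj T u u
  Adj-irrefl {u} e with trans (sym e) (adj-irr T u)
  ... | ()

  -- The unique earlier neighbour is the parent, so an embedding that follows `rank` meets one
  -- adjacency constraint per vertex.
  record Ordering (root : Fin n) : Set where
    field
      rank           : Fin n → ℕ
      rank-root      : rank root ≡ 0
      rank-injective : ∀ {u v} → rank u ≡ rank v → u ≡ v
      earlier        : ∀ v → v ≢ root → ∃ λ u → Adj T v u × rank u < rank v
      earlier-unique : ∀ v {u w} → Adj T v u → Adj T v w → rank u < rank v → rank w < rank v → u ≡ w

  data Path : Fin n → Fin n → List (Fin n) → Set where
    stopᵖ : ∀ {u} → Path u u (u ∷ [])
    stepᵖ : ∀ {u v w ws} → Adj T u w → Path w v ws → Path u v (u ∷ ws)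

  snoc : ∀ {u v w ws} → Path u v ws → Adj T v w → Path u w (ws ∷ʳ w)
  snoc stopᵖ e = stepᵖ e stopᵖ
  snoc (stepᵖ e p) e′ = stepᵖ e (snoc p e′)

  path-linked : ∀ {x u v b ws} → Adj T x u → Path u v ws → Adj T v b → Linked (Adj T) (x ∷ ws ∷ʳ b)
  path-linked e stopᵖ e′ = e ∷ e′ ∷ [-]
  path-linked e (stepᵖ e₁ p) e′ = e ∷ path-linked e₁ p e′

  Unique-∷ʳ : ∀ {xs : List (Fin n)} {b} → Unique xs → All (_≢ b) xs → Unique (xs ∷ʳ b)
  Unique-∷ʳ [] [] = [] ∷ []
  Unique-∷ʳ (p ∷ ps) (q ∷ qs) = ∷ʳ⁺ p q ∷ Unique-∷ʳ ps qs

  close-cycle : ∀ {u v b ws} → u ≢ v → Path u v ws → Unique ws → All (_≢ b) ws → Adj T b u → Adj T v b → IsCycle T (b ∷ ws)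
  close-cycle u≢v stopᵖ _ _ _ _ = contradiction refl u≢v
  close-cycle u≢v (stepᵖ e p) uniq out bu vb =
    s≤s (s≤s (long p)) , (All.map (λ x≢b b≡x → x≢b (sym b≡x)) out ∷ uniq) , path-linked bu (stepᵖ e p) vb
    where
    long : ∀ {w v ws} → Path w v ws → 1 ≤ length ws
    long stopᵖ = s≤s z≤n
    long (stepᵖ _ _) = s≤s z≤n

  module _ (connected : Connected T) (acyclic : Acyclic T) (root : Fin n) where

    -- A subtree grows vertex by vertex, and `k` bounds the number of vertices still outside. Simple
    -- paths inside `S` are carried along because acyclicity is stated through cycles.
    record Stage (k : ℕ) : Set₁ where
      field
        S       : Fin n → Set
        S?      : Decidable S
        root∈S  : S root
        missing : # (¬? ∘ S?) ≤ k
        rank    : Fin n → ℕ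
        next    : ℕ
        at-root : rank root ≡ 0
        rank<   : ∀ u → S u → rank u < next
        inj     : ∀ u v → S u → S v → rank u ≡ rank v → u ≡ v
        earlier : ∀ v → S v → v ≢ root → ∃ λ u → S u × Adj T v u × rank u < rank v
        unique  : ∀ v {u w} → S v → S u → S w → Adj T v u → Adj T v w → rank u < rank v → rank w < rank v → u ≡ w
        paths   : ∀ u v → S u → S v → ∃ λ ws → Path u v ws × Unique ws × All S ws

    first-stage : Stage n
    first-stage = record
      { S = _≡ root ; S? = λ u → u F.≟ root ; root∈S = refl ; missing = #≤n _ ; rank = λ _ → 0 ; next = 1 ; at-root = refl
      ; rank< = λ _ _ → s≤s z≤n ; inj = λ { u v refl refl _ → refl } ; earlier = λ v eq ne → contradiction eq ne
      ; unique = λ { v _ _ _ _ _ () _ }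
      ; paths = λ { u v refl refl → root ∷ [] , stopᵖ , [] ∷ [] , refl ∷ [] } }

    crossing : ∀ {S : Fin n → Set} → Decidable S → ∀ {u v} → Walk T u v → S u → ¬ S v → ∃ λ a → ∃ λ b → S a × ¬ S b × Adj T a b
    crossing S? [] s ¬s = contradiction s ¬s
    crossing S? (_∷_ {u} {w} e p) s ¬s with S? w
    ... | yes s′ = crossing S? p s′ ¬s
    ... | no ¬s′ = u , w , s , ¬s′ , e

    extend : ∀ {k} (st : Stage k) → (∃ λ a → ∃ λ b → Stage.S st a × ¬ Stage.S st b × Adj T a b) → k ≢ 0 → Stage (ℕ.pred k)
    extend {zero} st _ k≢0 = contradiction refl k≢0
    extend {suc k} st (a , b , a∈S , b∉S , ab) _ = record
      { S = S′ ; S? = S′? ; root∈S = inj₁ root∈S ; missing = missing′ ; rank = rank′ ; next = suc next ; at-root = trans (old root root∈S) at-root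
      ; rank< = rank<′ ; inj = inj′ ; earlier = earlier′ ; unique = unique′ ; paths = paths′ }
      where
      open Stage st
      S′ : Fin n → Set
      S′ u = S u ⊎ u ≡ b
      S′? : Decidable S′
      S′? u = S? u ⊎-dec (u F.≟ b)
      missing′ : # (¬? ∘ S′?) ≤ k
      missing′ = ℕ.s≤s⁻¹ (≤-trans (#-remove (¬? ∘ S?) (¬? ∘ S′?) b∉S λ j h → (λ s → h (inj₁ s)) , λ eq → h (inj₂ eq)) missing)
      rank′ : Fin n → ℕ
      rank′ = update rank b next
      old : ∀ u → S u → rank′ u ≡ rank u
      old u s = update-other rank b next λ { refl → b∉S s }
      new : rank′ b ≡ next
      new = update-at rank b next
      rank<′ : ∀ u → S′ u → rank′ u < suc next
      rank<′ u (inj₁ s) = ≤-trans (≤-reflexive (cong suc (old u s))) (≤-trans (rank< u s) (<⇒≤ (n<1+n next)))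
      rank<′ u (inj₂ refl) = ≤-reflexive (cong suc new)
      lower : ∀ u → S u → rank′ u < rank′ b
      lower u s = subst₂ _<_ (sym (old u s)) (sym new) (rank< u s)
      inj′ : ∀ u v → S′ u → S′ v → rank′ u ≡ rank′ v → u ≡ v
      inj′ u v (inj₁ s) (inj₁ t) eq = inj u v s t (trans (sym (old u s)) (trans eq (old v t)))
      inj′ u v (inj₁ s) (inj₂ refl) eq = contradiction (lower u s) (<-irrefl eq)
      inj′ u v (inj₂ refl) (inj₁ t) eq = contradiction (lower v t) (<-irrefl (sym eq))
      inj′ u v (inj₂ refl) (inj₂ refl) eq = refl
      earlier′ : ∀ v → S′ v → v ≢ root → ∃ λ u → S′ u × Adj T v u × rank′ u < rank′ v
      earlier′ v (inj₁ s) ne with earlier v s ne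
      ... | u , t , e , lt = u , inj₁ t , e , subst₂ _<_ (sym (old u t)) (sym (old v s)) lt
      earlier′ v (inj₂ refl) ne = a , inj₁ a∈S , Adj-sym ab , lower a a∈S
      self : ∀ u → S u → rank′ b < rank′ u → ⊥
      self u s lt = <-irrefl refl (<-trans lt (lower u s))
      unique′ : ∀ v {u w} → S′ v → S′ u → S′ w → Adj T v u → Adj T v w → rank′ u < rank′ v → rank′ w < rank′ v → u ≡ w
      unique′ v {u} {w} (inj₁ s) (inj₁ t) (inj₁ t′) e e′ lt lt′ =
        unique v s t t′ e e′ (subst₂ _<_ (old u t) (old v s) lt) (subst₂ _<_ (old w t′) (old v s) lt′)
      unique′ v (inj₁ s) (inj₂ refl) _ _ _ lt _ = ⊥-elim (self v s lt)
      unique′ v (inj₁ s) (inj₁ _) (inj₂ refl) _ _ _ lt = ⊥-elim (self v s lt)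
      unique′ v (inj₂ refl) (inj₂ refl) _ e _ _ _ = contradiction e Adj-irrefl
      unique′ v (inj₂ refl) (inj₁ _) (inj₂ refl) _ e _ _ = contradiction e Adj-irrefl
      -- Two earlier neighbours of the new vertex `b` would close a cycle with the simple path in
      -- `S` between them.
      unique′ v {u} {w} (inj₂ refl) (inj₁ t) (inj₁ t′) e e′ _ _ with u F.≟ w
      ... | yes eq = eq
      ... | no u≢w with paths u w t t′
      ...   | ws , p , uniq , inS =
        ⊥-elim (acyclic (b ∷ ws) (close-cycle u≢w p uniq (All.map (λ { s refl → b∉S s }) inS) e (Adj-sym e′)))
      paths′ : ∀ u v → S′ u → S′ v → ∃ λ ws → Path u v ws × Unique ws × All S′ ws
      paths′ u v (inj₁ s) (inj₁ t) with paths u v s t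
      ... | ws , p , uniq , inS = ws , p , uniq , All.map inj₁ inS
      paths′ u v (inj₁ s) (inj₂ refl) with paths u a s a∈S
      ... | ws , p , uniq , inS = ws ∷ʳ b , snoc p ab , Unique-∷ʳ uniq (All.map (λ { s refl → b∉S s }) inS) , ∷ʳ⁺ (All.map inj₁ inS) (inj₂ refl)
      paths′ u v (inj₂ refl) (inj₁ t) with paths a v a∈S t
      ... | ws , p , uniq , inS = b ∷ ws , stepᵖ (Adj-sym ab) p , All.map (λ { s refl → b∉S s }) inS ∷ uniq , inj₂ refl ∷ All.map inj₁ inS
      paths′ u v (inj₂ refl) (inj₂ refl) = b ∷ [] , stopᵖ , [] ∷ [] , inj₂ refl ∷ []

    ordering-from : ∀ k → Stage k → Ordering root
    ordering-from k st with any? (¬? ∘ Stage.S? st)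
    ordering-from k st | no none = record
      { rank = rank ; rank-root = at-root ; rank-injective = λ {u} {v} → inj u v (all u) (all v)
      ; earlier = λ v ne → let u , _ , e , lt = earlier v (all v) ne in u , e , lt
      ; earlier-unique = λ v {u} {w} → unique v (all v) (all u) (all w) }
      where
      open Stage st
      all : ∀ u → S u
      all u with S? u
      ... | yes s = s
      ... | no ¬s = contradiction (u , ¬s) none
    ordering-from zero st | yes (v , ¬s) =
      contradiction (#-positive (¬? ∘ Stage.S? st) ¬s) (<⇒≱ (s≤s (Stage.missing st)))
    ordering-from (suc k) st | yes (v , ¬s) =
      ordering-from k (extend st (crossing (Stage.S? st) (connected root v) (Stage.root∈S st) ¬s) λ ())

    opaque

      ordering : Ordering root
      ordering = ordering-from n first-stage

module Rooted {n} (T : Graph n) {root} (O : Ordering T root) where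
  open Ordering O public

  deg′ : Fin n → ℕ
  deg′ v = # (adj? T v)

  Child : Fin n → Fin n → Set
  Child w v = Adj T w v × rank v < rank w

  child? : ∀ w v → Dec (Child w v)
  child? w v = adj? T w v ×-dec (rank v <? rank w)

  parent-unique : ∀ {w u v} → Child w u → Child w v → u ≡ v
  parent-unique {w} (e , lt) (e′ , lt′) = earlier-unique w e e′ lt lt′

  neighbour : ∀ {u v} → Adj T v u → Child v u ⊎ Child u v
  neighbour {u} {v} e with <-cmp (rank u) (rank v)
  ... | tri< lt _ _ = inj₁ (e , lt)
  ... | tri≈ _ eq _ = contradiction e (subst (λ w → ¬ Adj T v w) (rank-injective (sym eq)) (Adj-irrefl T))
  ... | tri> _ _ gt = inj₂ (Adj-sym T e , gt)

  degree≤ : ∀ v → deg′ v ≤ 1 + # (λ w → child? w v)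
  degree≤ v = ≤-trans (#-cover (adj? T v) (child? v) (λ w → child? w v) λ _ → neighbour)
    (+-monoˡ-≤ _ (#-unique (child? v) λ _ _ → parent-unique))

  nonleaf-child : ∀ v → 2 ≤ deg′ v → ∃ λ w → Child w v
  nonleaf-child v le = nonempty (λ w → child? w v) (ℕ.s≤s⁻¹ (≤-trans le (degree≤ v)))

  module _ (D : ℕ) where

    Hub : Fin n → Set
    Hub v = D < deg′ v

    hub? : Decidable Hub
    hub? v = D <? deg′ v

    NearHub : Fin n → Set
    NearHub v = ∃ λ h → Hub h × Adj T v h

    nearHub? : Decidable NearHub
    nearHub? v = any? λ h → hub? h ×-dec adj? T v h

    -- At most D² walks of length two start at such a vertex; this is what later allows many of them
    -- to be chosen with disjoint neighbourhoods.
    Calm : Fin n → Set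
    Calm v = ¬ Hub v × ¬ NearHub v

    calm? : Decidable Calm
    calm? v = ¬? (hub? v) ×-dec ¬? (nearHub? v)

estimate-2 = linear 9 (λ x1 x2 x3 x4 x5 x6 x7 x8 x9 → (x1 ⊑ x2 ⊕ x3) ∷ (x3 ⊑ x4 ⊕ x5) ∷ (x5 ⊑ x6 ⊕ x7) ∷ (x7 ⊑ x8 ⊕ x9) ∷ (x6 ⊑ x2) ∷ (x8 ⊑ x4) ∷ (x9 ⊑ x2) ∷ [] ⊢ x1 ⊑ x2 ⊛ 3 ⊕ x4 ⊛ 2) 0 (1 ∷ 1 ∷ 1 ∷ 1 ∷ 1 ∷ 1 ∷ 1 ∷ [])

module Hubs {n} (T : Graph n) {root} (O : Ordering T root) (D : ℕ) where
  open Rooted T O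

  -- All but one neighbour of a hub are children, and a vertex is a child of at most one other.
  hubs-few : # (hub? D) * D ≤ n
  hubs-few = ≤-trans (double-count (λ _ → yes tt) child? (hub? D)
    (λ w _ → #-unique (child? w) λ _ _ → parent-unique) lower)
    (≤-trans (≤-reflexive (*-identityʳ _)) (#≤n _))
    where
    lower : ∀ v → Hub D v → D ≤ # (λ w → yes tt ×-dec child? w v)
    lower v h = ≤-trans (ℕ.s≤s⁻¹ (≤-trans h (degree≤ v))) (#-mono (λ w → child? w v) _ λ _ c → tt , c)

  -- A nonleaf that is neither a hub nor calm has a hub as a child, or else its parent is
  -- a hub; in the latter case one of its children is calm or has a hub as a child.
  nonleaves-few : # (λ v → 2 ≤? deg′ v) ≤ # (hub? D) * 3 + # (calm? D) * 2
  nonleaves-few = estimate-2 (# nonleaf?) (# (hub? D)) (# rest₁?) (# (calm? D)) (# rest₂?) (# hubChild?) (# rest₃?) (# calmChild?) (# grandchild?) c₁ c₂ c₃ c₄ b₁ b₂ b₃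
    where
    nonleaf? : Decidable (λ v → 2 ≤ deg′ v)
    nonleaf? v = 2 ≤? deg′ v
    hubChild? : Decidable (λ v → ∃ λ h → Hub D h × Child h v)
    hubChild? v = any? λ h → hub? D h ×-dec child? h v
    calmChild? : Decidable (λ v → ∃ λ w → Calm D w × Child w v)
    calmChild? v = any? λ w → calm? D w ×-dec child? w v
    grandchild? : Decidable (λ v → ∃ λ h → Hub D h × ∃ λ w → Child h w × Child w v)
    grandchild? v = any? λ h → hub? D h ×-dec any? λ w → child? h w ×-dec child? w v
    rest₃? : Decidable (λ v → (∃ λ w → Calm D w × Child w v) ⊎ (∃ λ h → Hub D h × ∃ λ w → Child h w × Child w v))
    rest₃? v = calmChild? v ⊎-dec grandchild? v
    rest₂? : Decidable (λ v → (∃ λ h → Hub D h × Child h v) ⊎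
               ((∃ λ w → Calm D w × Child w v) ⊎ (∃ λ h → Hub D h × ∃ λ w → Child h w × Child w v)))
    rest₂? v = hubChild? v ⊎-dec rest₃? v
    rest₁? : Decidable (λ v → Calm D v ⊎ ((∃ λ h → Hub D h × Child h v) ⊎
               ((∃ λ w → Calm D w × Child w v) ⊎ (∃ λ h → Hub D h × ∃ λ w → Child h w × Child w v))))
    rest₁? v = calm? D v ⊎-dec rest₂? v
    c₁ : # nonleaf? ≤ # (hub? D) + # rest₁?
    c₁ = #-cover nonleaf? (hub? D) rest₁? cases
      where
      cases : ∀ v → 2 ≤ deg′ v → _ ⊎ _
      cases v two with hub? D v | calm? D v | hubChild? v
      ... | yes h | _ | _ = inj₁ h
      ... | no _ | yes z | _ = inj₂ (inj₁ z)
      ... | no _ | no _ | yes c = inj₂ (inj₂ (inj₁ c))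
      ... | no ¬h | no ¬z | no ¬c with nearHub? D v
      ...   | no ¬near = contradiction (¬h , ¬near) ¬z
      ...   | yes (h , hub , e) with neighbour e
      ...     | inj₂ below = contradiction (h , hub , below) ¬c
      ...     | inj₁ above with nonleaf-child v two
      ...       | w , wv with calm? D w | nearHub? D w
      ...         | yes zw | _ = inj₂ (inj₂ (inj₂ (inj₁ (w , zw , wv))))
      ...         | no ¬zw | no ¬near = contradiction ((λ hw → ¬c (w , hw , wv)) , ¬near) ¬zw
      ...         | no ¬zw | yes (h′ , hub′ , e′) with neighbour e′
      ...           | inj₁ above′ = contradiction (subst (Hub D) (parent-unique above′ wv) hub′) ¬h
      ...           | inj₂ below′ = inj₂ (inj₂ (inj₂ (inj₂ (h′ , hub′ , w , below′ , wv))))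
    c₂ : # rest₁? ≤ # (calm? D) + # rest₂?
    c₂ = #-cover rest₁? (calm? D) rest₂? λ _ → id
    c₃ : # rest₂? ≤ # hubChild? + # rest₃?
    c₃ = #-cover rest₂? hubChild? rest₃? λ _ → id
    c₄ : # rest₃? ≤ # calmChild? + # grandchild?
    c₄ = #-cover rest₃? calmChild? grandchild? λ _ → id
    b₁ : # hubChild? ≤ # (hub? D)
    b₁ = #-injection hubChild? (hub? D) (λ v h → child? h v) (λ _ → id) λ _ _ _ _ _ → parent-unique
    b₂ : # calmChild? ≤ # (calm? D)
    b₂ = #-injection calmChild? (calm? D) (λ v w → child? w v) (λ _ → id) λ _ _ _ _ _ → parent-unique
    b₃ : # grandchild? ≤ # (hub? D)
    b₃ = #-injection grandchild? (hub? D) (λ v h → any? λ w → child? h w ×-dec child? w v) (λ _ → id)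
      λ { _ _ h _ _ (w , hw , wi) (w′ , hw′ , wj) → parent-unique wi (subst (λ x → Child x _) (parent-unique hw′ hw) wj) }

-- Branches below a vertex

estimate-3 = linear 1 (λ x1 → [] ⊢ x1 ⊑ x1 ⊛ 3) 0 ([])

estimate-4 = linear 5 (λ x1 a x3 x4 n → (con 1 ⊕ x1 ⊑ a) ∷ (x3 ⊑ x1 ⊕ x4) ∷ (x4 ⊛ 3 ⊑ n) ∷ [] ⊢ x3 ⊛ 3 ⊑ a ⊛ 3 ⊕ n) 0 (3 ∷ 3 ∷ 1 ∷ [])

module Branching {n} (T : Graph n) {root} (O : Ordering T root) where
  open Rooted T O

  data Desc (x : Fin n) : Fin n → Set where
    here  : Desc x x
    there : ∀ {u w} → Child w u → Desc x u → Desc x w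

  desc-rank : ∀ {x w} → Desc x w → rank x ≤ rank w
  desc-rank here = ≤-refl
  desc-rank (there (_ , lt) d) = ≤-trans (desc-rank d) (<⇒≤ lt)

  desc? : ∀ x w → Dec (Desc x w)
  desc? x w = go (suc (rank w)) w ≤-refl
    where
    go : ∀ k w → rank w < k → Dec (Desc x w)
    go (suc k) w (s≤s le) with w F.≟ x | any? (child? w)
    ... | yes refl | _ = yes here
    ... | no w≢x | no none = no λ { here → w≢x refl ; (there c _) → none (_ , c) }
    ... | no w≢x | yes (u , c) with go k u (≤-trans (proj₂ c) le)
    ...   | yes d = yes (there c d)
    ...   | no ¬d = no λ { here → w≢x refl ; (there c′ d) → ¬d (subst (Desc x) (parent-unique c′ c) d) }

  desc-root : ∀ w → Desc root w
  desc-root w = go (suc (rank w)) w ≤-refl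
    where
    go : ∀ k w → rank w < k → Desc root w
    go (suc k) w (s≤s le) with w F.≟ root
    ... | yes refl = here
    ... | no ne with earlier w ne
    ...   | u , e , lt = there (e , lt) (go k u (≤-trans lt le))

  desc-branch : ∀ {x w} → Desc x w → w ≢ x → ∃ λ c → Child c x × Desc c w
  desc-branch here ne = contradiction refl ne
  desc-branch {x} (there {u} {w} c d) ne with u F.≟ x
  ... | yes refl = w , c , here
  ... | no u≢x with desc-branch d u≢x
  ...   | b , cb , db = b , cb , there c db

  branch-unique : ∀ {x c c′ w} → Child c x → Child c′ x → Desc c w → Desc c′ w → c ≡ c′
  branch-unique cx c′x here here = refl
  branch-unique cx c′x here (there c d) with parent-unique c cx
  ... | refl = contradiction (≤-trans (proj₂ c′x) (desc-rank d)) (<-irrefl refl)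
  branch-unique cx c′x (there c d) here with parent-unique c c′x
  ... | refl = contradiction (≤-trans (proj₂ cx) (desc-rank d)) (<-irrefl refl)
  branch-unique cx c′x (there c d) (there c′ d′) with parent-unique c c′
  ... | refl = branch-unique cx c′x d d′

  -- From the root, step to a child with at least n/3 descendants as long as there is one. The set
  -- of descendants shrinks strictly, so the walk stops, and it stops where every branch is small.
  pivot : ∃ λ v → n ≤ # (desc? v) * 3 × (∀ c → Child c v → # (desc? c) * 3 < n)
  pivot = go n root (#≤n _) (≤-trans (≤-reflexive (sym (trans (#-all (desc? root) desc-root) refl))) ((estimate-3 (# (desc? root)))))
    where
    go : ∀ k v → # (desc? v) ≤ k → n ≤ # (desc? v) * 3 → ∃ λ v → n ≤ # (desc? v) * 3 × (∀ c → Child c v → # (desc? c) * 3 < n)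
    go k v le big with any? (λ c → child? c v ×-dec (n ≤? # (desc? c) * 3))
    go k v le big | no none = v , big , λ c cv → ≰⇒> λ big′ → none (c , cv , big′)
    go zero v le big | yes _ = contradiction (#-positive (desc? v) {v} here) (<⇒≱ (s≤s le))
    go (suc k) v le big | yes (c , cv , big′) = go k c shrink big′
      where
      up : ∀ {w} → Desc c w → Desc v w
      up here = there cv here
      up (there e d) = there e (up d)
      shrink : # (desc? c) ≤ k
      shrink = ℕ.s≤s⁻¹ (≤-trans (#-remove (desc? v) (desc? c) here λ w d → up d , λ { refl → <-irrefl refl (≤-trans (proj₂ cv) (desc-rank d)) }) le)

  module Branches {S : Fin n → Set} (S? : Decidable S) where

    Below : Fin n → Set
    Below v = ∃ λ c → S c × Desc c v

    below? : Decidable Below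
    below? v = any? λ c → S? c ×-dec desc? c v

  open Branches public

  -- Adding the branches one by one, the size of their union cannot jump over an interval
  -- of length n / 3.
  trim : ∀ {S : Fin n → Set} (S? : Decidable S) → (∀ c → S c → # (desc? c) * 3 < n) → ∀ a → a ≤ # (below? S?) →
    ∃ λ t → let S′? = λ c → S? c ×-dec (toℕ c <? t) in a ≤ # (below? S′?) × # (below? S′?) * 3 ≤ a * 3 + n
  trim {S} S? small a big = go n (≤-trans big (#-mono (below? S?) (below? (upto n)) λ { v (c , s , d) → c , (s , toℕ<n c) , d }))
    where
    upto : ∀ t → Decidable (λ c → S c × toℕ c < t)
    upto t c = S? c ×-dec (toℕ c <? t)
    go : ∀ t → a ≤ # (below? (upto t)) → ∃ λ t → a ≤ # (below? (upto t)) × # (below? (upto t)) * 3 ≤ a * 3 + n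
    go zero le = 0 , le , ≤-trans (≤-reflexive (cong (_* 3) (#-empty (below? (upto 0)) λ { v (c , (_ , ()) , _) }))) z≤n
    go (suc t) le with a ≤? # (below? (upto t))
    ... | yes le′ = go t le′
    ... | no ≰ = suc t , le , (estimate-4 (# (below? (upto t))) a (# (below? (upto (suc t)))) (# (new? t)) n (≰⇒> ≰) step (new-small t))
      where
      new? : ∀ t → Decidable (λ v → ∃ λ c → (S c × toℕ c ≡ t) × Desc c v)
      new? t v = any? λ c → (S? c ×-dec (toℕ c ℕ.≟ t)) ×-dec desc? c v
      step : # (below? (upto (suc t))) ≤ # (below? (upto t)) + # (new? t)
      step = #-cover _ (below? (upto t)) (new? t) cases
        where
        cases : ∀ v → Below (upto (suc t)) v → Below (upto t) v ⊎ (∃ λ c → (S c × toℕ c ≡ t) × Desc c v)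
        cases v (c , (s , s≤s le) , d) with m≤n⇒m<n∨m≡n le
        ... | inj₁ lt = inj₁ (c , (s , lt) , d)
        ... | inj₂ eq = inj₂ (c , (s , eq) , d)
      new-small : ∀ t → # (new? t) * 3 ≤ n
      new-small t with any? (λ c → S? c ×-dec (toℕ c ℕ.≟ t))
      ... | no none = ≤-trans (≤-reflexive (cong (_* 3) (#-empty (new? t) λ { v (c , p , _) → none (c , p) }))) z≤n
      ... | yes (c , s , refl) = ≤-trans (*-monoˡ-≤ 3 (#-mono (new? t) (desc? c)
              λ { v (c′ , (_ , eq) , d) → subst (λ x → Desc x v) (toℕ-injective eq) d })) (<⇒≤ (small c s))

-- Embeddings into a coloured graph

infix 4 _≟ᶜ_
_≟ᶜ_ : (c d : Colour) → Dec (c ≡ d)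
red ≟ᶜ red = yes refl
red ≟ᶜ blue = no λ ()
blue ≟ᶜ red = no λ ()
blue ≟ᶜ blue = yes refl

module Host {N} (G : ColouredKN N) where

  Miss : Colour → Fin N → Fin N → Set
  Miss c x y = x ≢ y × col G x y ≢ c

  miss? : ∀ c x y → Dec (Miss c x y)
  miss? c x y = ¬? (x F.≟ y) ×-dec ¬? (col G x y ≟ᶜ c)

  Edge : Colour → Fin N → Fin N → Set
  Edge c x y = x ≢ y × col G x y ≡ c

  edge? : ∀ c x y → Dec (Edge c x y)
  edge? c x y = ¬? (x F.≟ y) ×-dec (col G x y ≟ᶜ c)

  Edge-sym : ∀ {c x y} → Edge c x y → Edge c y x
  Edge-sym {c} {x} {y} (ne , eq) = (λ e → ne (sym e)) , trans (symm G y x) eq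

-- The items carry their own adjacency `A` and a colour for each pair, so that one greedy run can
-- serve two copies of a tree in two colours.
module Embed {N} (G : ColouredKN N) {k} {A : Fin k → Fin k → Set} (A? : ∀ u v → Dec (A u v)) (A-sym : ∀ {u v} → A u v → A v u)
  (κ : Fin k → Fin k → Colour) (κ-sym : ∀ u v → κ u v ≡ κ v u) where
  open Host G

  Placed : (Fin k → Set) → (Fin k → Fin N) → Set
  Placed P f = ∀ u v → P u → P v → u ≢ v → f u ≢ f v × (A u v → col G (f u) (f v) ≡ κ u v)

  module _ {K : Fin k → Fin N → Set} (K? : ∀ v y → Dec (K v y))
    {S Q : Fin k → Set} (S? : Decidable S) (Q? : Decidable Q) (S∩Q : ∀ v → S v → Q v → ⊥)
    (rank : Fin k → ℕ) (rank-injective : ∀ {u v} → rank u ≡ rank v → u ≡ v)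
    {Same : Fin k → Fin k → Set} (same? : ∀ u v → Dec (Same u v)) (same-refl : ∀ v → Same v v)
    (disjoint-cells : ∀ u v x → ¬ Same u v → K u x → K v x → ⊥) (b m : ℕ)
    (f₀ : Fin k → Fin N) (f₀∈K : ∀ u → S u → K u (f₀ u)) (placed₀ : Placed S f₀)
    (few-missed : ∀ u v x → S u ⊎ Q u → Q v → A u v → K u x →
                  # (λ y → K? v y ×-dec miss? (κ u v) x y) ≤ m)
    (back : ∀ v → Q v → # (λ u → (S? u ⊎-dec (Q? u ×-dec (rank u <? rank v))) ×-dec A? u v) ≤ b)
    (room : ∀ v → Q v → # (λ u → (S? u ⊎-dec Q? u) ×-dec same? u v) + b * m ≤ # (K? v)) where

    private
      C : Fin k → Fin k → Fin N → Fin N → Set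
      C u v x y = x ≢ y × (A u v → col G x y ≡ κ u v)

      C? : ∀ u v x y → Dec (C u v x y)
      C? u v x y = ¬? (x F.≟ y) ×-dec (A? u v →-dec (col G x y ≟ᶜ κ u v))

      C-sym : ∀ {u v x y} → C u v x y → C v u y x
      C-sym {u} {v} {x} {y} (ne , h) =
        (λ e → ne (sym e)) , λ a → trans (symm G y x) (trans (h (A-sym a)) (κ-sym u v))

      module Gr = Greedy K? C? (λ {u} {v} → C-sym {u} {v}) S? Q? S∩Q rank rank-injective

      -- A placed item rules out its own position if it shares the cell of `v`, and at most m
      -- further positions if it is adjacent to `v`.
      w : Fin k → Fin k → ℕ
      w u v = 𝟙 (same? u v) + 𝟙 (A? u v) * m

      bound : ∀ u v x → S u ⊎ Q u → Q v → u ≢ v → K u x → # (λ y → K? v y ×-dec ¬? (C? u v x y)) ≤ w u v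
      bound u v x p q _ kx = ≤-trans (#-cover _ equal? far? cases) (+-mono-≤ equal-few far-few)
        where
        equal? : Decidable (λ y → K v y × x ≡ y)
        equal? y = K? v y ×-dec (x F.≟ y)
        far? : Decidable (λ y → A u v × (K v y × Miss (κ u v) x y))
        far? y = A? u v ×-dec (K? v y ×-dec miss? (κ u v) x y)
        cases : ∀ y → K v y × ¬ C u v x y → K v y × x ≡ y ⊎ A u v × (K v y × Miss (κ u v) x y)
        cases y (ky , ¬c) with x F.≟ y | A? u v
        ... | yes eq | _ = inj₁ (ky , eq)
        ... | no ne | no ¬a = contradiction (ne , λ a → contradiction a ¬a) ¬c
        ... | no ne | yes a = inj₂ (a , ky , ne , λ eq → ¬c (ne , λ _ → eq))
        equal-few : # equal? ≤ 𝟙 (same? u v)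
        equal-few with same? u v
        ... | yes _ = #-unique equal? λ { y z (_ , refl) (_ , eq) → eq }
        ... | no ¬s = ≤-reflexive (#-empty equal? λ { y (ky , refl) → disjoint-cells u v x ¬s kx ky })
        far-few : # far? ≤ 𝟙 (A? u v) * m
        far-few = go (A? u v)
          where
          go : ∀ d → # far? ≤ 𝟙 d * m
          go (yes a) = ≤-trans (#-mono far? (λ y → K? v y ×-dec miss? (κ u v) x y) λ _ → proj₂)
                        (≤-trans (few-missed u v x p q a kx) (≤-reflexive (sym (*-identityˡ m))))
          go (no ¬a) = ≤-reflexive (#-empty far? λ y p → ¬a (proj₁ p))

      room′ : ∀ v → Q v → sum (λ u → 𝟙 (Gr.before? (rank v) u) * w u v) < # (K? v)
      room′ v q = ≤-trans (s≤s (≤-trans (≤-reflexive split) (+-mono-≤ near far))) (room-step (room v q))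
        where
        before? = Gr.before? (rank v)
        sameb? : Decidable (λ u → Gr.Before (rank v) u × Same u v)
        sameb? u = before? u ×-dec same? u v
        farb? : Decidable (λ u → Gr.Before (rank v) u × A u v)
        farb? u = before? u ×-dec A? u v
        split : sum (λ u → 𝟙 (before? u) * w u v) ≡ # sameb? + m * # farb?
        split = trans (sum-cong λ u → trans (*-distribˡ-+ (𝟙 (before? u)) (𝟙 (same? u v)) _)
            (cong₂ _+_ (sym (𝟙-× (before? u) (same? u v)))
              (trans (sym (*-assoc (𝟙 (before? u)) (𝟙 (A? u v)) m))
                (trans (*-comm _ m) (cong (m *_) (sym (𝟙-× (before? u) (A? u v))))))))
          (trans (sum-+ (𝟙 ∘ sameb?) _) (cong₂ _+_ (sum-𝟙 sameb?) (trans (sum-*ˡ m (𝟙 ∘ farb?)) (cong (m *_) (sum-𝟙 farb?)))))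
        cell? : Decidable (λ u → (S u ⊎ Q u) × Same u v)
        cell? u = (S? u ⊎-dec Q? u) ×-dec same? u v
        -- `v` belongs to its own cell but is not placed before itself; this one item yields the
        -- strict inequality that the greedy choice requires.
        near : # sameb? ≤ ℕ.pred (# cell?)
        near with # cell? | #-remove cell? sameb? {v} (inj₂ q , same-refl v) forget
          where
          forget : ∀ u → Gr.Before (rank v) u × Same u v → ((S u ⊎ Q u) × Same u v) × u ≢ v
          forget u (inj₁ s , same) = (inj₁ s , same) , λ { refl → S∩Q u s q }
          forget u (inj₂ (q , lt) , same) = (inj₂ q , same) , λ { refl → <-irrefl refl lt }
        ... | suc _ | s≤s le = le
        far : m * # farb? ≤ b * m
        far = ≤-trans (*-monoʳ-≤ m (back v q)) (≤-reflexive (*-comm m b))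
        positive : 1 ≤ # cell?
        positive = #-positive cell? {v} (inj₂ q , same-refl v)
        room-step : # cell? + b * m ≤ # (K? v) → suc (ℕ.pred (# cell?) + b * m) ≤ # (K? v)
        room-step with # cell? | positive
        ... | suc _ | _ = id

    opaque

      embed : ∃ λ f → (∀ u → S u → f u ≡ f₀ u) × (∀ u → S u ⊎ Q u → K u (f u)) × Placed (λ u → S u ⊎ Q u) f
      embed = Gr.greedy w f₀ f₀∈K placed₀ bound room′

#-two : ∀ {n} {P : Fin n → Set} (P? : Decidable P) {i j} → P i → P j → i ≢ j → 2 ≤ # P?
#-two P? {i} {j} p q i≢j = ≤-trans (+-mono-≤ (#-positive (λ k → k F.≟ i) refl) (#-positive (λ k → k F.≟ j) refl))
  (#-disjoint P? (λ k → k F.≟ i) (λ k → k F.≟ j) (λ { k refl → p }) (λ { k refl → q }) λ { k refl eq → i≢j eq })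

estimate-5 = linear 3 (λ x1 k h → (con 1 ⊕ x1 ⊑ k ⊛ 2) ∷ (h ⊛ 2 ⊑ x1) ∷ [] ⊢ con 1 ⊕ h ⊑ k) 1 (1 ∷ 1 ∷ [])

-- Double counting. With h = ⌊|L|/2⌋ each y occurs in at least h + 1 related pairs, and |L| ≤ 2(h +
-- 1), so the factor h + 1 cancels.
few-often-missed : ∀ {a b} {L : Fin a → Set} {P : Fin b → Set} {R : Fin a → Fin b → Set}
  (L? : Decidable L) (P? : Decidable P) (R? : ∀ l y → Dec (R l y)) {m : ℕ} →
  (∀ l → L l → # (R? l) ≤ m) → (∀ y → P y → # L? < # (λ l → L? l ×-dec R? l y) * 2) → # P? ≤ m * 2
few-often-missed {L = L} L? P? R? {m} few often = *-cancelʳ-≤ (# P?) (m * 2) (suc h) (begin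
  # P? * suc h          ≤⟨ double-count L? R? P? few (λ y p → enough (often y p)) ⟩
  # L? * m              ≤⟨ *-monoˡ-≤ m L≤ ⟩
  suc h * 2 * m         ≡⟨ trans (*-assoc (suc h) 2 m) (trans (*-comm (suc h) (2 * m)) (cong (_* suc h) (*-comm 2 m))) ⟩
  m * 2 * suc h         ∎)
  where
  open ≤-Reasoning
  h = # L? / 2
  L≤ : # L? ≤ suc h * 2
  L≤ = ≤-trans (≤-reflexive (m≡m%n+[m/n]*n (# L?) 2)) (+-mono-≤ (<⇒≤ (m%n<n (# L?) 2)) ≤-refl)
  enough : ∀ {k} → # L? < k * 2 → suc h ≤ k
  enough {k} lt = estimate-5 (# L?) k h lt (m/n*n≤m (# L?) 2)

opp : Colour → Colour
opp red = blue
opp blue = red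

≢⇒opp : ∀ {c d} → c ≢ d → c ≡ opp d
≢⇒opp {red} {red} ne = contradiction refl ne
≢⇒opp {red} {blue} ne = refl
≢⇒opp {blue} {red} ne = refl
≢⇒opp {blue} {blue} ne = contradiction refl ne

module Trees {n} (T : Graph n)
  (cls : Fin n → Bool) (bipartite : ∀ u v → Adj T u v → cls v ≡ not (cls u))
  (nb : Fin n → Fin n) (Adj-nb : ∀ v → Adj T v (nb v)) where

  degree′ : Fin n → ℕ
  degree′ v = # (adj? T v)

  class? : ∀ κ → Decidable (λ v → cls v ≡ κ)
  class? κ v = cls v B.≟ κ

  Leaf : Bool → Fin n → Set
  Leaf κ v = cls v ≡ κ × degree′ v ≤ 1

  leaf? : ∀ κ → Decidable (Leaf κ)
  leaf? κ v = class? κ v ×-dec (degree′ v ≤? 1)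

  -- `nb` chooses neighbours arbitrarily; at a leaf the choice is forced, so `nb l` is the vertex to
  -- which the leaf `l` is attached.
  leaf-neighbour : ∀ {κ v u} → Leaf κ v → Adj T v u → u ≡ nb v
  leaf-neighbour {κ} {v} {u} (_ , one) e with u F.≟ nb v
  ... | yes eq = eq
  ... | no ne = contradiction (#-two (adj? T v) e (Adj-nb v) ne) (<⇒≱ (s≤s one))

  not-self : ∀ {κ} → not κ ≢ κ
  not-self {true} ()
  not-self {false} ()

  leaf-parent-class : ∀ {κ v} → cls v ≡ κ → cls (nb v) ≡ not κ
  leaf-parent-class {κ} {v} eq = trans (bipartite v (nb v) (Adj-nb v)) (cong not eq)

-- Attaching the leaves of one class

estimate-6 = linear 7 (λ x1 x2 κ′ x4 x5 m x7 → (x1 ⊑ x2 ⊕ κ′) ∷ (x2 ⊑ x4 ⊕ x5) ∷ (x5 ⊑ m ⊛ 2) ∷ (x4 ⊑ x7) ∷ [] ⊢ x1 ⊑ x7 ⊕ (m ⊛ 2 ⊕ κ′)) 0 (1 ∷ 1 ∷ 1 ∷ 1 ∷ [])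

estimate-7 = linear 3 (λ m κ′ x3 → (con 1 ⊕ (m ⊛ 3 ⊕ κ′) ⊛ 2 ⊑ x3) ∷ [] ⊢ con 1 ⊕ (m ⊕ (m ⊛ 2 ⊕ κ′)) ⊛ 2 ⊑ x3) 0 (1 ∷ [])

module LeafAttachment {n} (T : Graph n)
  (cls : Fin n → Bool) (bipartite : ∀ u v → Adj T u v → cls v ≡ not (cls u))
  (nb : Fin n → Fin n) (Adj-nb : ∀ v → Adj T v (nb v)) {N} (G : ColouredKN N) where
  open Trees T cls bipartite nb Adj-nb
  open Host G

  assemble : ∀ c κ {L : Fin n → Set} (L? : Decidable L) → (∀ l → L l → Leaf κ l) →
    (f g : Fin n → Fin N) →
    (∀ u v → ¬ L u → ¬ L v → u ≢ v → f u ≢ f v × (Adj T u v → col G (f u) (f v) ≡ c)) →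
    (∀ l → L l → Edge c (f (nb l)) (g l)) → (∀ l v → L l → ¬ L v → f v ≢ g l) → InjectiveOn L g → MonoCopy G T
  assemble c κ {L} L? leaf f g placed attached fresh g-inj = c , h , (λ {u} {v} → injective u v) , edges
    where
    h : Fin n → Fin N
    h v with L? v
    ... | yes _ = g v
    ... | no _ = f v
    injective : ∀ u v → h u ≡ h v → u ≡ v
    injective u v eq with L? u | L? v
    ... | yes p | yes q = g-inj u v p q eq
    ... | yes p | no q = contradiction (sym eq) (fresh u v p q)
    ... | no p | yes q = contradiction eq (fresh v u q p)
    ... | no p | no q with u F.≟ v
    ...   | yes u≡v = u≡v
    ...   | no u≢v = contradiction eq (proj₁ (placed u v p q u≢v))
    edges : ∀ u v → Adj T u v → col G (h u) (h v) ≡ c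
    edges u v e with L? u | L? v
    ... | yes p | yes q = contradiction (trans (sym (bipartite u v e)) (trans (proj₁ (leaf v q)) (sym (proj₁ (leaf u p))))) not-self
    ... | yes p | no q = trans (symm G _ _) (trans (cong (λ w → col G (f w) (g u)) (leaf-neighbour (leaf u p) e)) (proj₂ (attached u p)))
    ... | no p | yes q = trans (cong (λ w → col G (f w) (g v)) (leaf-neighbour (leaf v q) (Adj-sym T e))) (proj₂ (attached v q))
    ... | no p | no q = proj₂ (placed u v p q λ { refl → Adj-irrefl T e }) e

  -- `C` is the controlled part of the free vertices `V`; any other vertex of `V` is usable if it is
  -- joined to half of the leaf neighbours, counted with multiplicity. Double counting shows that at
  -- most 2m vertices of `C` fail even this test, so at least |L| - (2m + κ′) good ones lie in `C`
  -- and the matching by majority applies.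
  attach-leaves : ∀ c κ {L : Fin n → Set} (L? : Decidable L) → (∀ l → L l → Leaf κ l) →
    (f : Fin n → Fin N) →
    (∀ u v → ¬ L u → ¬ L v → u ≢ v → f u ≢ f v × (Adj T u v → col G (f u) (f v) ≡ c)) →
    {V C : Fin N → Set} (V? : Decidable V) (C? : Decidable C) →
    (∀ v y → ¬ L v → V y → f v ≢ y) → (∀ y → C y → V y) →
    {m κ′ : ℕ} → (∀ l → L l → # (λ y → C? y ×-dec miss? c (f (nb l)) y) ≤ m) →
    # L? ≤ # C? + κ′ →
    # L? ≤ # (λ y → V? y ×-dec (# (λ l → L? l ×-dec ¬? (edge? c (f (nb l)) y)) * 2 ≤? # L?)) →
    (m * 3 + κ′) * 2 < # L? → MonoCopy G T
  attach-leaves c κ {L} L? leaf f placed {V} {C} V? C? outside C⊆V {m} {κ′} few-missed C-many good-many enough =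
    assemble c κ L? leaf f g placed (λ l p → proj₂ (proj₁ (proj₂ result) l p))
      (λ l v p q → outside v (g l) q (proj₁ (proj₁ (proj₁ (proj₂ result) l p)))) (proj₂ (proj₂ result))
    where
    missing : Fin N → ℕ
    missing y = # (λ l → L? l ×-dec ¬? (edge? c (f (nb l)) y))
    good? : Decidable (λ y → V y × missing y * 2 ≤ # L?)
    good? y = V? y ×-dec (missing y * 2 ≤? # L?)
    ¬L-nb : ∀ l → L l → ¬ L (nb l)
    ¬L-nb l p q = not-self (trans (sym (leaf-parent-class (proj₁ (leaf l p)))) (proj₁ (leaf (nb l) q)))
    R? : ∀ l y → Dec (C y × ¬ Edge c (f (nb l)) y)
    R? l y = C? y ×-dec ¬? (edge? c (f (nb l)) y)
    few : ∀ l → L l → # (R? l) ≤ m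
    few l p = ≤-trans (#-mono (R? l) (λ y → C? y ×-dec miss? c (f (nb l)) y) to-miss) (few-missed l p)
      where
      to-miss : ∀ y → C y × ¬ Edge c (f (nb l)) y → C y × Miss c (f (nb l)) y
      to-miss y (cy , ¬e) = cy , ne , λ eq → ¬e (ne , eq)
        where ne = outside (nb l) y (¬L-nb l p) (C⊆V y cy)
    bad? : Decidable (λ y → C y × ¬ (V y × missing y * 2 ≤ # L?))
    bad? y = C? y ×-dec ¬? (good? y)
    bad-few : # bad? ≤ m * 2
    bad-few = few-often-missed L? bad? R? few λ y → often y
      where
      often : ∀ y → C y × ¬ (V y × missing y * 2 ≤ # L?) → # L? < # (λ l → L? l ×-dec R? l y) * 2
      often y (cy , ¬good) = ≤-trans (≰⇒> λ le → ¬good (C⊆V y cy , le))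
        (*-monoˡ-≤ 2 (#-mono (λ l → L? l ×-dec ¬? (edge? c (f (nb l)) y)) _ λ { l (p , ne) → p , cy , ne }))
    core : # L? ≤ # (λ y → good? y ×-dec C? y) + (m * 2 + κ′)
    core = estimate-6 (# L?) (# C?) κ′ (# (λ y → C? y ×-dec good? y)) (# bad?) m (# (λ y → good? y ×-dec C? y)) C-many (≤-reflexive (#-split C? good?)) bad-few (#-mono (λ y → C? y ×-dec good? y) (λ y → good? y ×-dec C? y) (λ { _ (p , q) → q , p }))
    result = complete-by-majority L? good? C? (λ l y → edge? c (f (nb l)) y) {m} {m * 2 + κ′} good-many (λ y → proj₂) few core
      ((estimate-7 m κ′ (# L?) enough))
    g = proj₁ result

-- Many leaves in the second class

odd≢even : ∀ a b → suc (a * 2) ≢ b * 2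
odd≢even zero zero ()
odd≢even zero (suc b) ()
odd≢even (suc a) zero ()
odd≢even (suc a) (suc b) eq = odd≢even a b (cong (ℕ.pred ∘ ℕ.pred) eq)

estimate-8 = linear 2 (λ a b → (a ⊛ 2 ⊑ b ⊛ 2) ∷ [] ⊢ a ⊑ b) 1 (1 ∷ [])
estimate-9 = linear 2 (λ b a → (b ⊛ 2 ⊑ a ⊛ 2) ∷ [] ⊢ b ⊑ a) 1 (1 ∷ [])

*2-injective : ∀ a b → a * 2 ≡ b * 2 → a ≡ b
*2-injective a b eq = (≤-antisym (estimate-8 a b (≤-reflexive eq)) (estimate-9 b a (≤-reflexive (sym eq))))

estimate-10 = linear 2 (λ x1 x2 → (con 1 ⊕ x1 ⊛ 2 ⊑ x2 ⊛ 2) ∷ [] ⊢ x1 ⊑ x2) 1 (1 ∷ [])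

estimate-11 = linear 2 (λ x1 x2 → (con 1 ⊕ x1 ⊛ 2 ⊑ con 1 ⊕ x2 ⊛ 2) ∷ [] ⊢ x1 ⊑ x2) 1 (1 ∷ [])

estimate-12 = linear 2 (λ x1 x2 → (con 1 ⊕ (con 1 ⊕ x1 ⊛ 2) ⊑ x2 ⊛ 2) ∷ [] ⊢ x1 ⊑ x2) 1 (1 ∷ [])

estimate-13 = linear 2 (λ x1 x2 → (con 1 ⊕ (con 1 ⊕ x1 ⊛ 2) ⊑ con 1 ⊕ x2 ⊛ 2) ∷ [] ⊢ x1 ⊑ x2) 1 (1 ∷ [])

module Doubled (n : ℕ) where

  Item : Set
  Item = Fin n ⊎ Fin n

  item : Fin (n + n) → Item
  item = F.splitAt n

  item-injective : ∀ {i j} → item i ≡ item j → i ≡ j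
  item-injective {i} {j} eq = trans (sym (Finₚ.join-splitAt n n i)) (trans (cong (F.join n n) eq) (Finₚ.join-splitAt n n j))

  vertex : Item → Fin n
  vertex (inj₁ v) = v
  vertex (inj₂ v) = v

  tag : Item → Bool
  tag (inj₁ _) = false
  tag (inj₂ _) = true

  tagged-injective : ∀ {i j} → tag i ≡ tag j → vertex i ≡ vertex j → i ≡ j
  tagged-injective {inj₁ _} {inj₁ _} _ refl = refl
  tagged-injective {inj₂ _} {inj₂ _} _ refl = refl
  tagged-injective {inj₁ _} {inj₂ _} ()
  tagged-injective {inj₂ _} {inj₁ _} ()

  -- Interleaving puts both copies of a parent before both copies of its child, so an item has at
  -- most two earlier neighbours.
  double-rank : (Fin n → ℕ) → Item → ℕ
  double-rank rank (inj₁ v) = rank v * 2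
  double-rank rank (inj₂ v) = suc (rank v * 2)

  double-rank-injective : ∀ {rank} → (∀ {u v} → rank u ≡ rank v → u ≡ v) → ∀ i j → double-rank rank i ≡ double-rank rank j → i ≡ j
  double-rank-injective {rank} inj (inj₁ u) (inj₁ v) eq = cong inj₁ (inj (*2-injective (rank u) (rank v) eq))
  double-rank-injective {rank} inj (inj₁ u) (inj₂ v) eq = contradiction (sym eq) (odd≢even (rank v) (rank u))
  double-rank-injective {rank} inj (inj₂ u) (inj₁ v) eq = contradiction eq (odd≢even (rank u) (rank v))
  double-rank-injective {rank} inj (inj₂ u) (inj₂ v) eq = cong inj₂ (inj (*2-injective (rank u) (rank v) (cong ℕ.pred eq)))

  double-rank-< : ∀ rank i j → double-rank rank i < double-rank rank j → rank (vertex i) ≤ rank (vertex j)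
  double-rank-< rank (inj₁ u) (inj₁ v) h = estimate-10 (rank u) (rank v) h
  double-rank-< rank (inj₁ u) (inj₂ v) h = estimate-11 (rank u) (rank v) h
  double-rank-< rank (inj₂ u) (inj₁ v) h = estimate-12 (rank u) (rank v) h
  double-rank-< rank (inj₂ u) (inj₂ v) h = estimate-13 (rank u) (rank v) h

estimate-14 = linear 6 (λ x1 x2 x3 n x5 m → (x1 ⊑ x2) ∷ (x2 ⊕ x3 ⊑ n) ∷ (n ⊑ x5 ⊕ m) ∷ (con 1 ⊕ m ⊛ 8 ⊑ x3) ∷ [] ⊢ x1 ⊕ (m ⊕ (m ⊕ con 0)) ⊑ x5) 0 (1 ∷ 1 ∷ 1 ∷ 1 ∷ [])

estimate-15 = linear 6 (λ x1 x2 x3 x4 x5 m → (x1 ⊑ x2) ∷ (x2 ⊕ x3 ⊑ x4) ∷ (x4 ⊑ x5 ⊕ m) ∷ (con 1 ⊕ m ⊛ 8 ⊑ x3) ∷ [] ⊢ x1 ⊕ (m ⊕ (m ⊕ con 0)) ⊑ x5) 0 (1 ∷ 1 ∷ 1 ∷ 1 ∷ [])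

estimate-16 = linear 3 (λ x1 x2 x3 → (con 1 ⊕ x1 ⊑ x2 ⊛ 2) ∷ (x2 ⊕ x3 ⊑ x1) ∷ [] ⊢ x3 ⊛ 2 ⊑ x1) 0 (1 ∷ 2 ∷ [])

estimate-17 = linear 10 (λ N x2 x3 x4 x5 x6 x7 x8 n x10 → (N ⊑ x2 ⊕ x3) ∷ (x3 ⊑ x4 ⊕ x5) ∷ (x4 ⊑ x6) ∷ (x5 ⊑ x7) ∷ (x6 ⊕ x8 ⊑ n) ∷ (x7 ⊕ x8 ⊑ x10) ∷ (n ⊕ x10 ⊑ N ⊕ con 1) ∷ [] ⊢ x8 ⊛ 2 ⊑ x2 ⊕ con 1) 0 (1 ∷ 1 ∷ 1 ∷ 1 ∷ 1 ∷ 1 ∷ 1 ∷ [])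

estimate-18 = linear 7 (λ x1 x2 x3 x4 x5 n m → (x1 ⊑ x2 ⊕ x3) ∷ (x3 ⊑ x4) ∷ (x4 ⊕ x5 ⊑ n) ∷ (n ⊑ x1 ⊕ m) ∷ [] ⊢ x5 ⊑ x2 ⊕ m) 0 (1 ∷ 1 ∷ 1 ∷ 1 ∷ [])

estimate-19 = linear 7 (λ x1 x2 x3 x4 x5 x6 m → (x1 ⊑ x2 ⊕ x3) ∷ (x3 ⊑ x4) ∷ (x4 ⊕ x5 ⊑ x6) ∷ (x6 ⊑ x1 ⊕ m) ∷ [] ⊢ x5 ⊑ x2 ⊕ m) 0 (1 ∷ 1 ∷ 1 ∷ 1 ∷ [])

estimate-20 = linear 2 (λ m x2 → (con 1 ⊕ m ⊛ 8 ⊑ x2) ∷ [] ⊢ con 1 ⊕ (m ⊛ 3 ⊕ m) ⊛ 2 ⊑ x2) 0 (1 ∷ [])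

estimate-21 = linear 4 (λ x1 x2 x3 x4 → (x1 ⊛ 2 ⊑ x2 ⊕ con 1) ∷ (x2 ⊑ x3 ⊕ x4) ∷ (con 1 ⊕ x3 ⊑ x1) ∷ [] ⊢ x1 ⊑ x4) 0 (1 ∷ 1 ∷ 1 ∷ [])

module LeafTrick {n} (T : Graph n) (ordering : ∀ root → Ordering T root)
  (cls : Fin n → Bool) (bipartite : ∀ u v → Adj T u v → cls v ≡ not (cls u))
  (nb : Fin n → Fin n) (Adj-nb : ∀ v → Adj T v (nb v)) {N} (G : ColouredKN N) where
  open Trees T cls bipartite nb Adj-nb
  open Host G
  open Doubled n

  leaf-trick : ∀ (root : Fin n) (d : Fin N) b {U₁ U₂ : Fin N → Set} (U₁? : Decidable U₁) (U₂? : Decidable U₂) →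
    (∀ x → U₁ x → U₂ x → ⊥) → ∀ m → n ≤ # U₁? + m → # (class? false) ≤ # U₂? + m →
    (∀ x → U₁ x → # (λ y → U₁? y ×-dec miss? b x y) ≤ m) →
    (∀ x → U₁ x → # (λ y → U₂? y ×-dec miss? (opp b) x y) ≤ m) →
    (∀ x → U₂ x → # (λ y → U₁? y ×-dec miss? (opp b) x y) ≤ m) →
    n + # (class? false) ≤ N + 1 → m * 8 < # (leaf? false) → MonoCopy G T
  leaf-trick root d b {U₁} {U₂} U₁? U₂? U₁∩U₂ m size₁ size₂ missᵇ missʳ missʳ′ sizeᴺ many = outcome
    where
    open Ordering (ordering root)
    module R = Rooted T (ordering root)
    L = Leaf false
    -- First copies carry T without `L` in colour `b`. Second copies carry only the second class and
    -- are joined to first copies in the other colour, so both embeddings share the images of the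
    -- first class.
    L? = leaf? false
    QI : Item → Set
    QI (inj₁ v) = ¬ L v
    QI (inj₂ v) = cls v ≡ false × ¬ L v
    QI? : Decidable QI
    QI? (inj₁ v) = ¬? (L? v)
    QI? (inj₂ v) = class? false v ×-dec ¬? (L? v)
    AI : Item → Item → Set
    AI (inj₁ u) (inj₁ v) = Adj T u v
    AI (inj₁ u) (inj₂ v) = Adj T u v
    AI (inj₂ u) (inj₁ v) = Adj T u v
    AI (inj₂ _) (inj₂ _) = ⊥
    AI? : ∀ i j → Dec (AI i j)
    AI? (inj₁ u) (inj₁ v) = adj? T u v
    AI? (inj₁ u) (inj₂ v) = adj? T u v
    AI? (inj₂ u) (inj₁ v) = adj? T u v
    AI? (inj₂ _) (inj₂ _) = no id
    AI-sym : ∀ i j → AI i j → AI j i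
    AI-sym (inj₁ u) (inj₁ v) = Adj-sym T
    AI-sym (inj₁ u) (inj₂ v) = Adj-sym T
    AI-sym (inj₂ u) (inj₁ v) = Adj-sym T
    AI-sym (inj₂ _) (inj₂ _) = id
    AI-adj : ∀ i j → AI i j → Adj T (vertex i) (vertex j)
    AI-adj (inj₁ u) (inj₁ v) = id
    AI-adj (inj₁ u) (inj₂ v) = id
    AI-adj (inj₂ u) (inj₁ v) = id
    AI-adj (inj₂ _) (inj₂ _) = ⊥-elim
    κI : Item → Item → Colour
    κI (inj₁ u) (inj₁ v) = b
    κI (inj₁ u) (inj₂ v) = opp b
    κI (inj₂ u) _ = opp b
    κI-sym : ∀ i j → κI i j ≡ κI j i
    κI-sym (inj₁ u) (inj₁ v) = refl
    κI-sym (inj₁ u) (inj₂ v) = refl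
    κI-sym (inj₂ u) (inj₁ v) = refl
    κI-sym (inj₂ u) (inj₂ v) = refl
    KI : Item → Fin N → Set
    KI (inj₁ _) = U₁
    KI (inj₂ _) = U₂
    KI? : ∀ i y → Dec (KI i y)
    KI? (inj₁ _) = U₁?
    KI? (inj₂ _) = U₂?
    rank₂ : Item → ℕ
    rank₂ = double-rank rank
    Q? : Decidable (λ i → QI (item i))
    Q? i = QI? (item i)
    A? : ∀ i j → Dec (AI (item i) (item j))
    A? i j = AI? (item i) (item j)
    same? : ∀ i j → Dec (tag (item i) ≡ tag (item j))
    same? i j = tag (item i) B.≟ tag (item j)
    before? : ∀ j → Decidable (λ i → (⊥ ⊎ QI (item i) × rank₂ (item i) < rank₂ (item j)) × AI (item i) (item j))
    before? j i = (no id ⊎-dec (Q? i ×-dec (rank₂ (item i) <? rank₂ (item j)))) ×-dec A? i j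

    few-missed : ∀ i j x → AI i j → KI i x → # (λ y → KI? j y ×-dec miss? (κI i j) x y) ≤ m
    few-missed (inj₁ u) (inj₁ v) x _ = missᵇ x
    few-missed (inj₁ u) (inj₂ v) x _ = missʳ x
    few-missed (inj₂ u) (inj₁ v) x _ = missʳ′ x
    few-missed (inj₂ u) (inj₂ v) x ()

    back : ∀ j → # (before? j) ≤ 2
    back j = ≤-trans (#-cover (before? j) (parent? false) (parent? true) cases) (+-mono-≤ (one false) (one true))
      where
      parent? : ∀ t → Decidable (λ i → tag (item i) ≡ t × R.Child (vertex (item j)) (vertex (item i)))
      parent? t i = (tag (item i) B.≟ t) ×-dec R.child? (vertex (item j)) (vertex (item i))
      one : ∀ t → # (parent? t) ≤ 1
      one t = #-unique (parent? t) λ i k p q → item-injective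
        (tagged-injective (trans (proj₁ p) (sym (proj₁ q))) (R.parent-unique (proj₂ p) (proj₂ q)))
      child : ∀ i → rank₂ (item i) < rank₂ (item j) → AI (item i) (item j) → R.Child (vertex (item j)) (vertex (item i))
      child i lt a with m≤n⇒m<n∨m≡n (double-rank-< rank (item i) (item j) lt)
      ... | inj₁ lt′ = Adj-sym T (AI-adj (item i) (item j) a) , lt′
      ... | inj₂ eq = contradiction (AI-adj (item i) (item j) a)
              λ e → Adj-irrefl T (subst (Adj T (vertex (item i))) (sym (rank-injective eq)) e)
      cases : ∀ i → (⊥ ⊎ QI (item i) × rank₂ (item i) < rank₂ (item j)) × AI (item i) (item j) →
        tag (item i) ≡ false × R.Child (vertex (item j)) (vertex (item i)) ⊎ tag (item i) ≡ true × R.Child (vertex (item j)) (vertex (item i))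
      cases i (inj₂ (_ , lt) , a) with tag (item i)
      ... | false = inj₁ (refl , child i lt a)
      ... | true = inj₂ (refl , child i lt a)

    rest₂? : Decidable (λ v → cls v ≡ false × ¬ L v)
    rest₂? v = class? false v ×-dec ¬? (L? v)
    rest₁-size : # (¬? ∘ L?) + # L? ≡ n
    rest₁-size = trans (+-comm _ (# L?)) (#-complement L?)
    rest₂-size : # rest₂? + # L? ≤ # (class? false)
    rest₂-size = #-disjoint (class? false) rest₂? L? (λ _ → proj₁) (λ _ → proj₁) λ _ p → proj₂ p

    cell? : ∀ j → Decidable (λ i → (⊥ ⊎ QI (item i)) × tag (item i) ≡ tag (item j))
    cell? j i = (no id ⊎-dec Q? i) ×-dec same? i j

    cell-size : ∀ t {P : Fin n → Set} (P? : Decidable P) → (∀ i → tag i ≡ t → QI i → P (vertex i)) →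
      ∀ j → tag (item j) ≡ t → # (cell? j) ≤ # P?
    cell-size t P? sound j eq = #-injection (cell? j) P? (λ i v → vertex (item i) F.≟ v)
      (λ { i (inj₂ q , s) → vertex (item i) , sound (item i) (trans s eq) q , refl })
      λ { i k v (_ , s) (_ , s′) refl e → item-injective (tagged-injective (trans s (sym s′)) (sym e)) }

    room : ∀ j → # (cell? j) + 2 * m ≤ # (KI? (item j))
    room j = at-item (item j) refl
      where
      at-item : ∀ x → item j ≡ x → # (cell? j) + 2 * m ≤ # (KI? x)
      at-item (inj₁ v) eq = estimate-14 (# (cell? j)) (# (¬? ∘ L?)) (# L?) n (# U₁?) m (cell-size false (¬? ∘ L?) (λ { (inj₁ _) _ q → q ; (inj₂ _) () }) j (cong tag eq)) (≤-reflexive rest₁-size) size₁ many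
      at-item (inj₂ v) eq = estimate-15 (# (cell? j)) (# rest₂?) (# L?) (# (class? false)) (# U₂?) m (cell-size true rest₂? (λ { (inj₁ _) () ; (inj₂ _) _ q → q }) j (cong tag eq)) rest₂-size size₂ many

    module E = Embed G {A = λ i j → AI (item i) (item j)} A? (λ {i} {j} → AI-sym (item i) (item j))
                 (λ i j → κI (item i) (item j)) (λ i j → κI-sym (item i) (item j))

    opaque
      embedding : ∃ λ f → (∀ i → ⊥ → f i ≡ d) × (∀ i → ⊥ ⊎ QI (item i) → KI (item i) (f i)) × E.Placed (λ i → ⊥ ⊎ QI (item i)) f
      embedding = E.embed {K = λ i → KI (item i)} (λ i → KI? (item i)) {S = λ _ → ⊥} {Q = λ i → QI (item i)} (λ _ → no id) Q? (λ _ ())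
        (rank₂ ∘ item) (λ {i} {j} eq → item-injective (double-rank-injective rank-injective (item i) (item j) eq))
        same? (λ _ → refl) disjoint 2 m (λ _ → d) (λ _ ()) (λ _ _ ())
        (λ i j x _ _ a k → few-missed (item i) (item j) x a k) (λ j _ → back j) (λ j _ → room j)
        where
        disjoint : ∀ i j x → tag (item i) ≢ tag (item j) → KI (item i) x → KI (item j) x → ⊥
        disjoint i j x ne p q with item i | item j
        ... | inj₁ _ | inj₁ _ = ne refl
        ... | inj₁ _ | inj₂ _ = U₁∩U₂ x p q
        ... | inj₂ _ | inj₁ _ = U₁∩U₂ x q p
        ... | inj₂ _ | inj₂ _ = ne refl

    at : Item → Fin N
    at i = proj₁ embedding (F.join n n i)
    item-join : ∀ i → item (F.join n n i) ≡ i
    item-join = Finₚ.splitAt-join n n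
    at∈K : ∀ i → QI i → KI i (at i)
    at∈K i q = subst (λ j → KI j (at i)) (item-join i)
      (proj₁ (proj₂ (proj₂ embedding)) (F.join n n i) (inj₂ (subst QI (sym (item-join i)) q)))
    at-placed : ∀ i j → QI i → QI j → i ≢ j → at i ≢ at j × (AI i j → col G (at i) (at j) ≡ κI i j)
    at-placed i j p q i≢j = proj₁ h , λ a → trans (proj₂ h (subst₂ AI (sym (item-join i)) (sym (item-join j)) a))
                                                  (cong₂ κI (item-join i) (item-join j))
      where
      h = proj₂ (proj₂ (proj₂ embedding)) (F.join n n i) (F.join n n j)
            (inj₂ (subst QI (sym (item-join i)) p)) (inj₂ (subst QI (sym (item-join j)) q))
            λ eq → i≢j (trans (sym (item-join i)) (trans (cong item eq) (item-join j)))

    φ χ : Fin n → Fin N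
    φ v = at (inj₁ v)
    χ v = at (inj₂ v)
    used₁? : Decidable (Image (¬? ∘ L?) φ)
    used₁? = image? (¬? ∘ L?) φ
    used₂? : Decidable (Image rest₂? χ)
    used₂? = image? rest₂? χ
    Free : Fin N → Set
    Free y = ¬ Image (¬? ∘ L?) φ y × ¬ Image rest₂? χ y
    free? : Decidable Free
    free? y = ¬? (used₁? y) ×-dec ¬? (used₂? y)
    nb-kept : ∀ l → L l → ¬ L (nb l)
    nb-kept l p q = not-self (trans (sym (leaf-parent-class (proj₁ p))) (proj₁ q))

    missing : Colour → Fin N → ℕ
    missing c y = # (λ l → L? l ×-dec ¬? (edge? c (φ (nb l)) y))
    good? : ∀ c → Decidable (λ y → Free y × missing c y * 2 ≤ # L?)
    good? c y = free? y ×-dec (missing c y * 2 ≤? # L?)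

    -- A free y differs from every image `φ (nb l)`, so each leaf is missed in at most one of the
    -- two colours.
    majority : ∀ y → Free y → (Free y × missing b y * 2 ≤ # L?) ⊎ (Free y × missing (opp b) y * 2 ≤ # L?)
    majority y free with missing b y * 2 ≤? # L?
    ... | yes le = inj₁ (free , le)
    ... | no ≰ = inj₂ (free , (estimate-16 (# L?) (missing b y) (missing (opp b) y) (≰⇒> ≰) both))
      where
      both : missing b y + missing (opp b) y ≤ # L?
      both = #-disjoint L? _ _ (λ _ → proj₁) (λ _ → proj₁) λ l p q → proj₂ q
        ((λ eq → proj₁ free (nb l , nb-kept l (proj₁ p) , eq)) ,
         ≢⇒opp λ eq → proj₂ p ((λ eq′ → proj₁ free (nb l , nb-kept l (proj₁ p) , eq′)) , eq))

    -- The first copies use at most n - |L| vertices, the second copies at most t₂ - |L|, and N ≥ n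
    -- + t₂ - 1.
    enough-free : # L? * 2 ≤ # free? + 1
    enough-free = estimate-17 N (# free?) (# (¬? ∘ free?)) (# used₁?) (# used₂?) (# (¬? ∘ L?)) (# rest₂?) (# L?) n (# (class? false)) (≤-reflexive (sym (#-complement free?))) used (#-image (¬? ∘ L?) φ) (#-image rest₂? χ) (≤-reflexive rest₁-size) rest₂-size sizeᴺ
      where
      used : # (¬? ∘ free?) ≤ # used₁? + # used₂?
      used = #-cover (¬? ∘ free?) used₁? used₂? cases
        where
        cases : ∀ y → ¬ Free y → Image (¬? ∘ L?) φ y ⊎ Image rest₂? χ y
        cases y nf with used₁? y | used₂? y
        ... | yes p | _ = inj₁ p
        ... | no _ | yes q = inj₂ q
        ... | no p | no q = contradiction (p , q) nf

    split : # free? ≤ # (good? b) + # (good? (opp b))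
    split = #-cover free? (good? b) (good? (opp b)) majority

    core₁? : Decidable (λ y → U₁ y × Free y)
    core₁? y = U₁? y ×-dec free? y
    core₂? : Decidable (λ y → U₂ y × Free y)
    core₂? y = U₂? y ×-dec free? y

    core₁-size : # L? ≤ # core₁? + m
    core₁-size = estimate-18 (# U₁?) (# core₁?) (# used₁?) (# (¬? ∘ L?)) (# L?) n m (#-cover U₁? core₁? used₁? cases) (#-image (¬? ∘ L?) φ) (≤-reflexive rest₁-size) size₁
      where
      cases : ∀ y → U₁ y → U₁ y × Free y ⊎ Image (¬? ∘ L?) φ y
      cases y u with used₁? y
      ... | yes p = inj₂ p
      ... | no p = inj₁ (u , p , λ { (v , q , refl) → U₁∩U₂ _ u (at∈K (inj₂ v) q) })

    core₂-size : # L? ≤ # core₂? + m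
    core₂-size = estimate-19 (# U₂?) (# core₂?) (# used₂?) (# rest₂?) (# L?) (# (class? false)) m (#-cover U₂? core₂? used₂? cases) (#-image rest₂? χ) rest₂-size size₂
      where
      cases : ∀ y → U₂ y → U₂ y × Free y ⊎ Image rest₂? χ y
      cases y u with used₂? y
      ... | yes p = inj₂ p
      ... | no p = inj₁ (u , (λ { (v , q , refl) → U₁∩U₂ _ (at∈K (inj₁ v) q) u }) , p)

    room′ : (m * 3 + m) * 2 < # L?
    room′ = estimate-20 m (# L?) many

    mono-b : # L? ≤ # (good? b) → MonoCopy G T
    mono-b good = LeafAttachment.attach-leaves T cls bipartite nb Adj-nb G b false L? (λ _ → id) φ
      (λ u v p q ne → at-placed (inj₁ u) (inj₁ v) p q λ { refl → ne refl })
      free? core₁? (λ v y p free eq → proj₁ free (v , p , eq)) (λ _ → proj₂)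
      (λ l p → ≤-trans (#-mono (λ y → core₁? y ×-dec miss? b (φ (nb l)) y) (λ y → U₁? y ×-dec miss? b (φ (nb l)) y) λ { y ((u , _) , ms) → u , ms })
                       (missᵇ (φ (nb l)) (at∈K (inj₁ (nb l)) (nb-kept l p))))
      core₁-size good room′

    both-copies : ∀ v → Bool → Item
    both-copies v true = inj₁ v
    both-copies v false = inj₂ v

    mono-r : # L? ≤ # (good? (opp b)) → MonoCopy G T
    mono-r good = LeafAttachment.attach-leaves T cls bipartite nb Adj-nb G (opp b) false L? (λ _ → id) ψ placed
      free? core₂? outside (λ _ → proj₂)
      (λ l p → subst (λ x → # (λ y → core₂? y ×-dec miss? (opp b) x y) ≤ m) (sym (ψ-nb l p))
        (≤-trans (#-mono (λ y → core₂? y ×-dec miss? (opp b) (φ (nb l)) y) (λ y → U₂? y ×-dec miss? (opp b) (φ (nb l)) y) λ { y ((u , _) , ms) → u , ms })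
                 (missʳ (φ (nb l)) (at∈K (inj₁ (nb l)) (nb-kept l p)))))
      core₂-size
      (≤-trans good (#-mono (good? (opp b)) _ λ { y (free , le) → free , ≤-trans (*-monoˡ-≤ 2 (#-mono _ _
        λ { l (p , ne) → p , λ e → ne (subst (λ x → Edge (opp b) x y) (sym (ψ-nb l p)) e) })) le }))
      room′
      where
      image : Fin n → Item
      image v = both-copies v (cls v)
      -- First-class vertices come from the first copies and second-class ones from the second
      -- copies. At the neighbours of leaves `ψ` agrees with `φ`, so a single majority count serves
      -- both colours.
      ψ : Fin n → Fin N
      ψ v = at (image v)
      image-ok : ∀ v → ¬ L v → QI (image v)
      image-ok v p = go (cls v) refl
        where
        go : ∀ κ → cls v ≡ κ → QI (both-copies v κ)
        go true _ = p
        go false eq = eq , p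
      image-injective : ∀ u v → image u ≡ image v → u ≡ v
      image-injective u v eq with cls u | cls v
      image-injective u v refl | true | true = refl
      image-injective u v refl | false | false = refl
      image-injective u v () | true | false
      image-injective u v () | false | true
      linked : ∀ u v → Adj T u v → AI (image u) (image v) × κI (image u) (image v) ≡ opp b
      linked u v e with cls u | cls v | bipartite u v e
      ... | true | false | _ = e , refl
      ... | false | true | _ = e , refl
      ψ-nb : ∀ l → L l → ψ (nb l) ≡ φ (nb l)
      ψ-nb l p = cong (at ∘ both-copies (nb l)) (leaf-parent-class (proj₁ p))
      placed : ∀ u v → ¬ L u → ¬ L v → u ≢ v → ψ u ≢ ψ v × (Adj T u v → col G (ψ u) (ψ v) ≡ opp b)
      placed u v p q ne = proj₁ h , λ e → trans (proj₂ h (proj₁ (linked u v e))) (proj₂ (linked u v e))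
        where h = at-placed (image u) (image v) (image-ok u p) (image-ok v q) λ eq → ne (image-injective u v eq)
      outside : ∀ v y → ¬ L v → Free y → ψ v ≢ y
      outside v y p free = go (cls v) refl
        where
        go : ∀ κ → cls v ≡ κ → at (both-copies v κ) ≢ y
        go true _ eq = proj₁ free (v , p , eq)
        go false eq′ eq = proj₂ free (v , (eq′ , p) , eq)

    outcome : MonoCopy G T
    outcome with # L? ≤? # (good? b)
    ... | yes le = mono-b le
    ... | no ≰ = mono-r (estimate-21 (# L?) (# free?) (# (good? b)) (# (good? (opp b))) enough-free split (≰⇒> ≰))

-- Cores with disjoint neighbourhoods

estimate-22 = linear 5 (λ x1 x2 x3 x4 x5 → (x1 ⊛ 2 ⊕ x2 ⊑ x3 ⊛ 2) ∷ (x4 ⊛ 2 ⊑ x2) ∷ (x3 ⊑ x5 ⊕ x4) ∷ [] ⊢ x1 ⊑ x5) 1 (1 ∷ 1 ∷ 2 ∷ [])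

estimate-23 = linear 1 (λ x1 → [] ⊢ x1 ⊕ x1 ⊛ 2 ⊑ x1 ⊛ 3) 0 ([])
estimate-24 = linear 1 (λ x1 → [] ⊢ x1 ⊛ 3 ⊑ x1 ⊕ x1 ⊛ 2) 0 ([])

module Completion {n} (T : Graph n) (cls : Fin n → Bool) (bipartite : ∀ u v → Adj T u v → cls v ≡ not (cls u))
  {N} (G : ColouredKN N) where
  open Host G

  not-self′ : ∀ {x} → not x ≢ x
  not-self′ {true} ()
  not-self′ {false} ()

  class₁? : Decidable (λ v → cls v ≡ true)
  class₁? v = cls v B.≟ true

  class₂? : Decidable (λ v → cls v ≡ false)
  class₂? v = cls v B.≟ false

  -- The second class goes to W in an arbitrary way; the images of the first class are then
  -- found by a matching, because both sides of the bipartite graph miss few edges.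
  bipartite-copy : ∀ b {U W : Fin N → Set} (U? : Decidable U) (W? : Decidable W) → (∀ x → U x → W x → ⊥) →
    ∀ {D Δ : ℕ} → (∀ v → # (adj? T v) ≤ Δ) → (∀ w → W w → # (λ u → U? u ×-dec edge? b w u) ≤ D) → 1 ≤ D →
    # class₂? ≤ # W? → # class₁? * 2 + # class₂? ≤ # U? * 2 → D * Δ * 3 < # class₁? → Fin N → MonoCopy G T
  bipartite-copy b {U} {W} U? W? U∩W {D} {Δ} degree≤Δ sparse 1≤D W-many U-many large d = opp b , h , (λ {u} {v} → injective u v) , edges
    where
    opaque
      into-W : ∃ λ γ → (∀ x → cls x ≡ false → W (γ x)) × InjectiveOn (λ x → cls x ≡ false) γ
      into-W = inject class₂? W? d W-many
    γ : Fin n → Fin N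
    γ = proj₁ into-W
    load? : ∀ u → Decidable (λ x → cls x ≡ false × Edge b (γ x) u)
    load? u x = class₂? x ×-dec edge? b (γ x) u
    light? : Decidable (λ u → U u × # (load? u) ≤ D * 2)
    light? u = U? u ×-dec (# (load? u) ≤? D * 2)
    heavy? : Decidable (λ u → U u × D * 2 < # (load? u))
    heavy? u = U? u ×-dec (D * 2 <? # (load? u))
    -- Each image in `W` sends at most D edges of colour `b` into `U`, so at most t₂/2 vertices of
    -- `U` receive more than 2D. This is the surplus of t₂/2 over t₁ that `U-many` provides.
    heavy-few : # heavy? * 2 ≤ # class₂?
    heavy-few = *-cancelʳ-≤ (# heavy? * 2) (# class₂?) D {{>-nonZero 1≤D}} (begin
      # heavy? * 2 * D       ≡⟨ trans (*-assoc (# heavy?) 2 D) (cong (# heavy? *_) (*-comm 2 D)) ⟩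
      # heavy? * (D * 2)     ≤⟨ *-monoʳ-≤ (# heavy?) (<⇒≤ (n<1+n (D * 2))) ⟩
      # heavy? * suc (D * 2) ≤⟨ double-count class₂? (λ x u → U? u ×-dec edge? b (γ x) u) heavy?
                                  (λ x p → sparse (γ x) (proj₁ (proj₂ into-W) x p))
                                  (λ { u (p , lt) → ≤-trans lt (#-mono (load? u) _ λ { x (q , e) → q , p , e }) }) ⟩
      # class₂? * D          ∎)
      where open ≤-Reasoning
    light-many : # class₁? ≤ # light?
    light-many = estimate-22 (# class₁?) (# class₂?) (# U?) (# heavy?) (# light?) U-many heavy-few (#-cover U? light? heavy? cases)
      where
      cases : ∀ u → U u → (U u × # (load? u) ≤ D * 2) ⊎ (U u × D * 2 < # (load? u))
      cases u p with # (load? u) ≤? D * 2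
      ... | yes le = inj₁ (p , le)
      ... | no ≰ = inj₂ (p , ≰⇒> ≰)
    Fits : Fin n → Fin N → Set
    Fits y u = ∀ x → Adj T y x → col G (γ x) u ≡ opp b
    fits? : ∀ y u → Dec (Fits y u)
    fits? y u = all? λ x → adj? T y x →-dec (col G (γ x) u ≟ᶜ opp b)
    other-class : ∀ {y x} → cls y ≡ true → Adj T y x → cls x ≡ false
    other-class {y} {x} p e = trans (bipartite y x e) (cong not p)
    obstacle : ∀ y u → cls y ≡ true → U u → ¬ Fits y u → ∃ λ x → Adj T y x × Edge b (γ x) u
    obstacle y u p q nf with any? (λ x → adj? T y x ×-dec edge? b (γ x) u)
    ... | yes w = w
    ... | no none = contradiction (λ x e → ≢⇒opp λ eq → none (x , e , (λ { refl → U∩W _ q (proj₁ (proj₂ into-W) x (other-class p e)) }) , eq)) nf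
    opaque
      matched : ∃ λ f → (∀ y → cls y ≡ true → (U (f y) × # (load? (f y)) ≤ D * 2) × Fits y (f y)) × InjectiveOn (λ y → cls y ≡ true) f
      -- A vertex of T has at most Δ neighbours, and the image of each spoils at most D vertices of
      -- `U`. A light vertex is joined in `b` to at most 2D images, each of a vertex with at most Δ
      -- neighbours.
      matched = matching class₁? light? fits? {Δ * D} {D * 2 * Δ}
        (λ y p → ≤-trans (union-bound (adj? T y) (λ x u → (class₂? x ×-dec U? u) ×-dec edge? b (γ x) u) _ (λ x e → ≤-trans
                            (#-mono _ (λ u → U? u ×-dec edge? b (γ x) u) λ { u ((_ , q) , ed) → q , ed })
                            (sparse (γ x) (proj₁ (proj₂ into-W) x (other-class p e))))
                          λ { u ((q , _) , nf) → let x , e , ed = obstacle y u p q nf in x , e , (other-class p e , q) , ed })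
                 (*-monoˡ-≤ D (degree≤Δ y)))
        (λ u q → ≤-trans (union-bound (load? u) (λ x y → adj? T x y) _ (λ x _ → degree≤Δ x)
                          λ { y (p , nf) → let x , e , ed = obstacle y u p (proj₁ q) nf in x , (other-class p e , ed) , Adj-sym T e })
                 (*-monoˡ-≤ Δ (proj₂ q)))
        (≤-trans (s≤s (≤-reflexive total)) large) light-many
        where
        total : Δ * D + D * 2 * Δ ≡ D * Δ * 3
        total = trans (cong₂ _+_ (*-comm Δ D) (trans (cong (_* Δ) (*-comm D 2)) (trans (*-assoc 2 D Δ) (*-comm 2 (D * Δ))))) ((≤-antisym (estimate-23 (D * Δ)) (estimate-24 (D * Δ))))
    σ : Fin n → Fin N
    σ = proj₁ matched
    h : Fin n → Fin N
    h v = if cls v then σ v else γ v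
    σ∈U : ∀ v → cls v ≡ true → U (σ v)
    σ∈U v p = proj₁ (proj₁ (proj₁ (proj₂ matched) v p))
    γ∈W : ∀ v → cls v ≡ false → W (γ v)
    γ∈W = proj₁ (proj₂ into-W)
    injective : ∀ u v → h u ≡ h v → u ≡ v
    injective u v eq with cls u in p | cls v in q
    ... | true | true = proj₂ (proj₂ matched) u v p q eq
    ... | true | false = ⊥-elim (U∩W (σ u) (σ∈U u p) (subst W (sym eq) (γ∈W v q)))
    ... | false | true = ⊥-elim (U∩W (σ v) (σ∈U v q) (subst W eq (γ∈W u p)))
    ... | false | false = proj₂ (proj₂ into-W) u v p q eq
    edges : ∀ u v → Adj T u v → col G (h u) (h v) ≡ opp b
    edges u v e with cls u in p | cls v in q
    ... | true | true = contradiction (trans (sym (bipartite u v e)) (trans q (sym p))) not-self′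
    ... | true | false = trans (symm G (σ u) (γ v)) (proj₂ (proj₁ (proj₂ matched) u p) v e)
    ... | false | true = proj₂ (proj₁ (proj₂ matched) v q) u (Adj-sym T e)
    ... | false | false = contradiction (trans (sym (bipartite u v e)) (trans q (sym p))) not-self′

  -- If u does not fit l, then the image of some neighbour of l misses u. Disjoint neighbourhoods
  -- make these images distinct for different l, so u is unfit for at most m members of `L`.
  module Finish {c : Colour} {L : Fin n → Set} (L? : Decidable L) (f : Fin n → Fin N)
    (placed : ∀ u v → ¬ L u → ¬ L v → u ≢ v → f u ≢ f v × (Adj T u v → col G (f u) (f v) ≡ c))
    (L-independent : ∀ u v → L u → L v → ¬ Adj T u v)
    (L-apart : ∀ u v y → L u → L v → Adj T u y → Adj T v y → u ≡ v)
    {R : Fin N → Set} (R? : Decidable R) (fresh : ∀ v y → ¬ L v → R y → f v ≢ y)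
    {U : Fin N → Set} (U? : Decidable U) (R⊆U : ∀ y → R y → U y)
    (inside : ∀ l y → L l → Adj T l y → U (f y))
    {D m : ℕ} (few-missed : ∀ x → U x → # (λ y → U? y ×-dec miss? c x y) ≤ m) (degree≤D : ∀ l → L l → # (adj? T l) ≤ D)
    (room : D * m + m < # L?) (R-many : # L? ≤ # R?) where

    finish : MonoCopy G T
    finish = c , h , (λ {u} {v} → injective u v) , edges
      where
      Fits : Fin n → Fin N → Set
      Fits l u = ∀ y → Adj T l y → col G (f y) u ≡ c
      fits? : ∀ l u → Dec (Fits l u)
      fits? l u = all? λ y → adj? T l y →-dec (col G (f y) u ≟ᶜ c)
      kept : ∀ l y → L l → Adj T l y → ¬ L y
      kept l y p e q = L-independent l y p q e
      obstacle : ∀ l u → L l → R u → ¬ Fits l u → ∃ λ y → Adj T l y × Miss c (f y) u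
      obstacle l u p q nf with any? (λ y → adj? T l y ×-dec miss? c (f y) u)
      ... | yes w = w
      ... | no none = contradiction coloured nf
        where
        coloured : Fits l u
        coloured y e with col G (f y) u ≟ᶜ c
        ... | yes eq = eq
        ... | no ne = contradiction (y , e , fresh y u (kept l y p e) q , ne) none
      missˡ : ∀ l → L l → # (λ u → R? u ×-dec ¬? (fits? l u)) ≤ D * m
      missˡ l p = ≤-trans (union-bound (adj? T l) (λ y u → U? u ×-dec miss? c (f y) u) _
          (λ y e → few-missed (f y) (inside l y p e))
          λ { u (q , nf) → let y , e , ms = obstacle l u p q nf in y , e , R⊆U u q , ms })
        (*-monoˡ-≤ m (degree≤D l p))
      missʳ : ∀ u → R u → # (λ l → L? l ×-dec ¬? (fits? l u)) ≤ m
      missʳ u q = ≤-trans (#-injection (λ l → L? l ×-dec ¬? (fits? l u)) (λ x → U? x ×-dec miss? c u x)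
          (λ l x → L? l ×-dec any? (λ y → adj? T l y ×-dec (f y F.≟ x)))
          (λ { l (p , nf) → let y , e , ne , ms = obstacle l u p q nf in f y , (inside l y p e , (λ eq → ne (sym eq)) , λ eq → ms (trans (symm G _ _) eq)) , p , y , e , refl })
          (λ { l l′ x _ _ (p , y , e , refl) (p′ , y′ , e′ , eq) → L-apart l l′ y p p′ e (subst (Adj T l′) (same y′ y (kept l′ y′ p′ e′) (kept l y p e) eq) e′) }))
        (few-missed u (R⊆U u q))
        where
        same : ∀ y′ y → ¬ L y′ → ¬ L y → f y′ ≡ f y → y′ ≡ y
        same y′ y k′ k eq with y′ F.≟ y
        ... | yes y′≡y = y′≡y
        ... | no ne = contradiction eq (proj₁ (placed y′ y k′ k ne))
      opaque
        matched : ∃ λ g → (∀ l → L l → R (g l) × Fits l (g l)) × InjectiveOn L g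
        matched = matching L? R? fits? missˡ missʳ room R-many
      g : Fin n → Fin N
      g = proj₁ matched
      h : Fin n → Fin N
      h v with L? v
      ... | yes _ = g v
      ... | no _ = f v
      injective : ∀ u v → h u ≡ h v → u ≡ v
      injective u v eq with L? u | L? v
      ... | yes p | yes q = proj₂ (proj₂ matched) u v p q eq
      ... | yes p | no q = contradiction (sym eq) (fresh v (g u) q (proj₁ (proj₁ (proj₂ matched) u p)))
      ... | no p | yes q = contradiction eq (fresh u (g v) p (proj₁ (proj₁ (proj₂ matched) v q)))
      ... | no p | no q with u F.≟ v
      ...   | yes u≡v = u≡v
      ...   | no u≢v = contradiction eq (proj₁ (placed u v p q u≢v))
      edges : ∀ u v → Adj T u v → col G (h u) (h v) ≡ c
      edges u v e with L? u | L? v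
      ... | yes p | yes q = contradiction e (L-independent u v p q)
      ... | yes p | no q = trans (symm G _ _) (proj₂ (proj₁ (proj₂ matched) u p) v e)
      ... | no p | yes q = proj₂ (proj₁ (proj₂ matched) v q) u (Adj-sym T e)
      ... | no p | no q = proj₂ (placed u v p q λ { refl → Adj-irrefl T e }) e

module Cores {n} (T : Graph n) {root} (O : Ordering T root) (D : ℕ) where
  open Rooted T O

  Sharing : Fin n → Fin n → Set
  Sharing c c′ = ∃ λ y → Adj T c y × Adj T y c′

  sharing? : ∀ c c′ → Dec (Sharing c c′)
  sharing? c c′ = any? λ y → adj? T c y ×-dec adj? T y c′

  calm-degree : ∀ {v} → Calm D v → deg′ v ≤ D
  calm-degree (¬hub , _) = ≮⇒≥ ¬hub

  calm-neighbour-degree : ∀ {v y} → Calm D v → Adj T v y → deg′ y ≤ D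
  calm-neighbour-degree (_ , ¬near) e = ≮⇒≥ λ hub → ¬near (_ , hub , e)

module CoreSelection {n} (T : Graph n) {root} (O : Ordering T root) (D : ℕ) where
  open Rooted T O
  open Cores T O D

  module _ {Z : Fin n → Set} (Z? : Decidable Z) (calm : ∀ v → Z v → Calm D v) where

    Selection : ℕ → Set
    Selection j = ∃ λ q → (∀ c → q c ≡ true → Z c) × (∀ c c′ → q c ≡ true → q c′ ≡ true → Sharing c c′ → c ≡ c′) × # (∈? q) ≡ j

    -- A chosen core excludes itself and the ends of at most D² walks of length two, so 1 + D²
    -- candidates per core suffice.
    select : ∀ j → j * (1 + D * D) ≤ # Z? → Selection j
    select zero _ = (λ _ → false) , (λ _ ()) , (λ _ _ ()) , #-empty (∈? (λ _ → false)) λ _ ()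
    select (suc j) room with select j (≤-trans (m≤n+m _ _) room)
    ... | q , sound , apart , size = q′ , sound′ , apart′ , size′
      where
      conflict? : ∀ c c′ → Dec (c ≡ c′ ⊎ Sharing c c′)
      conflict? c c′ = (c F.≟ c′) ⊎-dec sharing? c c′
      blocked? : Decidable (λ c′ → ∃ λ c → q c ≡ true × (c ≡ c′ ⊎ Sharing c c′))
      blocked? c′ = any? λ c → ∈? q c ×-dec conflict? c c′
      few-conflicts : ∀ c → q c ≡ true → # (conflict? c) ≤ 1 + D * D
      few-conflicts c t = ≤-trans (#-cover (conflict? c) (λ c′ → c F.≟ c′) (sharing? c) λ _ → id)
        (+-mono-≤ (#-unique (λ c′ → c F.≟ c′) λ _ _ p r → trans (sym p) r)
          (≤-trans (union-bound (adj? T c) (λ y c′ → adj? T y c′) (sharing? c) (λ y e → calm-neighbour-degree (calm c (sound c t)) e) λ _ → id)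
                   (*-monoˡ-≤ D (calm-degree (calm c (sound c t))))))
      few-blocked : # blocked? < # Z?
      few-blocked = ≤-trans (s≤s (union-bound (∈? q) conflict? blocked? few-conflicts λ _ → id))
        (≤-trans (+-monoˡ-≤ _ (s≤s (z≤n {D * D}))) (≤-trans (≤-reflexive (cong (λ i → 1 + D * D + i * (1 + D * D)) size)) room))
      opaque
        found : ∃ λ c → Z c × ¬ (∃ λ c′ → q c′ ≡ true × (c′ ≡ c ⊎ Sharing c′ c))
        found = pick Z? blocked? few-blocked
      c₀ : Fin n
      c₀ = proj₁ found
      q′ : Fin n → Bool
      q′ = update q c₀ true
      c₀-new : q c₀ ≢ true
      c₀-new t = proj₂ (proj₂ found) (c₀ , t , inj₁ refl)
      old : ∀ c → q′ c ≡ true → c ≡ c₀ ⊎ q c ≡ true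
      old c t with c F.≟ c₀
      ... | yes eq = inj₁ eq
      ... | no _ = inj₂ t
      keep : ∀ c → q c ≡ true → q′ c ≡ true
      keep c t = trans (update-other q c₀ true λ { refl → c₀-new t }) t
      sound′ : ∀ c → q′ c ≡ true → Z c
      sound′ c t with old c t
      ... | inj₁ refl = proj₁ (proj₂ found)
      ... | inj₂ t′ = sound c t′
      apart′ : ∀ c c′ → q′ c ≡ true → q′ c′ ≡ true → Sharing c c′ → c ≡ c′
      apart′ c c′ t t′ sh with old c t | old c′ t′
      ... | inj₁ refl | inj₁ refl = refl
      ... | inj₂ s | inj₂ s′ = apart c c′ s s′ sh
      ... | inj₂ s | inj₁ refl = contradiction (c , s , inj₂ sh) (proj₂ (proj₂ found))
      ... | inj₁ refl | inj₂ s′ = contradiction (c′ , s′ , inj₂ (flip-sharing sh)) (proj₂ (proj₂ found))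
        where
        flip-sharing : Sharing c c′ → Sharing c′ c
        flip-sharing (y , e , e′) = y , Adj-sym T e′ , Adj-sym T e
      size′ : # (∈? q′) ≡ suc j
      size′ = ≤-antisym
        (≤-trans (#-cover (∈? q′) (λ c → c F.≟ c₀) (∈? q) old) (+-mono-≤ (#-unique (λ c → c F.≟ c₀) λ _ _ p r → trans p (sym r)) (≤-reflexive size)))
        (≤-trans (≤-reflexive (cong suc (sym size))) (#-remove (∈? q′) (∈? q) (update-at q c₀ true) λ { c t → keep c t , λ { refl → c₀-new t } }))

-- Attaching outside vertices at cores

estimate-25 = linear 10 (λ j q n x4 N x6 x7 x8 x9 x10 → (con 1 ⊕ j ⊑ q) ∷ (n ⊕ x4 ⊑ N ⊕ con 1) ∷ (q ⊕ x6 ⊑ n) ∷ (N ⊑ x6 ⊕ x7) ∷ (x7 ⊑ x8 ⊕ x9) ∷ (x9 ⊑ x10) ∷ (x10 ⊑ j) ∷ [] ⊢ x4 ⊑ x8) 0 (1 ∷ 1 ∷ 1 ∷ 1 ∷ 1 ∷ 1 ∷ 1 ∷ [])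

estimate-26 = linear 10 (λ x1 x2 B x4 x5 x6 x7 x8 x9 x10 → (x1 ⊑ x2 ⊕ B) ∷ (x2 ⊑ x4 ⊕ x5) ∷ (x5 ⊑ x6 ⊕ x7) ∷ (x6 ⊑ x8) ∷ (x7 ⊑ x9) ∷ (x9 ⊑ x10) ∷ [] ⊢ x1 ⊑ x4 ⊕ x8 ⊕ x10 ⊕ B) 0 (1 ∷ 1 ∷ 1 ∷ 1 ∷ 1 ∷ 1 ∷ [])

estimate-27 = linear 8 (λ x1 x2 x3 x4 B x6 x7 x8 → (x1 ⊑ x2 ⊕ x3 ⊕ x4 ⊕ B) ∷ (x4 ⊑ x6) ∷ ((x7 ⊕ x3 ⊕ x6 ⊕ B) ⊛ 2 ⊕ x8 ⊑ x1 ⊛ 2) ∷ [] ⊢ x7 ⊛ 2 ⊕ x8 ⊑ x2 ⊛ 2) 0 (2 ∷ 2 ∷ 1 ∷ [])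

estimate-28 = linear 9 (λ x1 x2 x3 x4 x5 n q x8 m → (x1 ⊑ x2) ∷ (x3 ⊑ x4) ∷ (x5 ⊕ x2 ⊑ n) ∷ (n ⊑ x3 ⊕ q) ∷ (con 1 ⊕ (x8 ⊕ m ⊕ q) ⊑ x5) ∷ [] ⊢ x1 ⊕ x8 ⊑ x4) 0 (1 ∷ 1 ∷ 1 ∷ 1 ∷ 1 ∷ [])

estimate-29 = linear 8 (λ x1 x2 x3 x4 x5 n q x8 → (x1 ⊑ x2 ⊕ x3) ∷ (x3 ⊑ x4) ∷ (x5 ⊕ x4 ⊑ n) ∷ (n ⊑ x1 ⊕ q) ∷ (x8 ⊕ q ⊑ x5) ∷ [] ⊢ x8 ⊑ x2) 0 (1 ∷ 1 ∷ 1 ∷ 1 ∷ 1 ∷ [])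

estimate-30 = linear 5 (λ x1 m q x4 x5 → (con 1 ⊕ (x1 ⊕ m ⊕ q) ⊑ x4) ∷ (x4 ⊑ x5 ⊕ q) ∷ [] ⊢ con 1 ⊕ (x1 ⊕ m) ⊑ x5) 0 (1 ∷ 1 ∷ [])

module Spread {n} (T : Graph n) {root} (O : Ordering T root)
  (cls : Fin n → Bool) (bipartite : ∀ u v → Adj T u v → cls v ≡ not (cls u))
  (D : ℕ) (κ : Bool) (core : Fin n → Bool)
  (core-calm : ∀ c → core c ≡ true → Rooted.Calm T O D c) (core-class : ∀ c → core c ≡ true → cls c ≡ κ)
  (core-apart : ∀ c c′ → core c ≡ true → core c′ ≡ true → Cores.Sharing T O D c c′ → c ≡ c′)
  {N} (G : ColouredKN N) (b : Colour) {U : Fin N → Set} (U? : Decidable U) (m : ℕ)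
  (few-missed : ∀ x → U x → # (λ y → U? y ×-dec Host.miss? G b x y) ≤ m) where
  open Rooted T O
  open Cores T O D
  open Host G
  open Completion T cls bipartite G
  open Embed G (adj? T) (Adj-sym T) (λ _ _ → b) (λ _ _ → refl)

  H? : Decidable (Hub D)
  H? = hub? D

  class-clash : ∀ {u v} → cls u ≡ cls v → ¬ Adj T u v
  class-clash {u} {v} eq e = self (trans (sym (bipartite u v e)) (sym eq))
    where
    self : ∀ {x} → not x ≢ x
    self {true} ()
    self {false} ()

  core-neighbour-class : ∀ {c y} → core c ≡ true → Adj T c y → cls y ≡ not κ
  core-neighbour-class {c} {y} t e = trans (bipartite c y e) (cong not (core-class c t))

  -- Hubs go first. Every remaining vertex has at most D neighbours, so its constraints stay bounded
  -- in whatever order it is placed.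
  hubs-embed : Fin N → # H? + 1 * m ≤ # U? → ∃ λ f → (∀ v → Hub D v → U (f v)) × Placed (Hub D) f
  hubs-embed d room = f , (λ v h → f∈U v (inj₂ h)) , λ u v p q → placed u v (inj₂ p) (inj₂ q)
    where
    result = embed {K = λ _ → U} (λ _ → U?) {S = λ _ → ⊥} {Q = Hub D} (λ _ → no id) H? (λ _ ()) rank rank-injective
      {Same = λ _ _ → ⊤} (λ _ _ → yes tt) (λ _ → tt) (λ _ _ _ ne _ _ → ne tt) 1 m (λ _ → d) (λ _ ()) (λ _ _ ())
      (λ u v x _ _ _ k → few-missed x k)
      (λ v _ → #-unique _ λ { i j (inj₂ (_ , lt) , e) (inj₂ (_ , lt′) , e′) → earlier-unique v (Adj-sym T e) (Adj-sym T e′) lt lt′ })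
      (λ v _ → ≤-trans (+-monoˡ-≤ (1 * m) (#-mono _ H? λ { u (inj₂ h , _) → h })) room)
    f = proj₁ result
    f∈U = proj₁ (proj₂ (proj₂ result))
    placed = proj₂ (proj₂ (proj₂ result))

  module _ (f₀ : Fin n → Fin N) (f₀∈U : ∀ v → Hub D v → U (f₀ v)) (placed₀ : Placed (Hub D) f₀) (k : ℕ) where

    -- Neighbours of a calm core are not hubs but may be adjacent to hubs, whose images are fixed.
    -- All neighbours of `c` are tested at once, so they may later be distributed arbitrarily among
    -- friendly vertices.
    Unfriendly : Fin n → Fin N → Set
    Unfriendly c u = ∃ λ y → Adj T c y × ∃ λ h → (Adj T y h × Hub D h) × Miss b (f₀ h) u

    unfriendly? : ∀ c u → Dec (Unfriendly c u)
    unfriendly? c u = any? λ y → adj? T c y ×-dec any? λ h → (adj? T y h ×-dec H? h) ×-dec miss? b (f₀ h) u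

    hostility : Fin N → ℕ
    hostility u = # (λ c → ∈? core c ×-dec unfriendly? c u)

    Useful : Fin N → Set
    Useful u = U u × hostility u ≤ k

    useful? : Decidable Useful
    useful? u = U? u ×-dec (hostility u ≤? k)

    -- At most D² walks of length two lead from a core to hubs, and the image of each hub misses at
    -- most m vertices of `U`. More than `B` useless vertices would need (B + 1)(k + 1) unfriendly
    -- pairs.
    useful-many : ∀ {B} → # (∈? core) * (D * (D * m)) < suc B * suc k → # U? ≤ # useful? + B
    useful-many {B} h = ≤-trans (#-cover U? useful? useless? cases) (+-monoʳ-≤ (# useful?) few)
      where
      useless? : Decidable (λ u → U u × k < hostility u)
      useless? u = U? u ×-dec (k <? hostility u)
      cases : ∀ u → U u → Useful u ⊎ U u × k < hostility u
      cases u p with hostility u ≤? k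
      ... | yes le = inj₁ (p , le)
      ... | no ≰ = inj₂ (p , ≰⇒> ≰)
      R? : ∀ c u → Dec (U u × Unfriendly c u)
      R? c u = U? u ×-dec unfriendly? c u
      per-core : ∀ c → core c ≡ true → # (R? c) ≤ D * (D * m)
      per-core c t = ≤-trans (union-bound (adj? T c) via? (R? c) per-neighbour λ { u (p , y , e , w) → y , e , p , w })
                             (*-monoˡ-≤ (D * m) (calm-degree (core-calm c t)))
        where
        via? : ∀ y u → Dec (U u × ∃ λ h → (Adj T y h × Hub D h) × Miss b (f₀ h) u)
        via? y u = U? u ×-dec any? λ h → (adj? T y h ×-dec H? h) ×-dec miss? b (f₀ h) u
        per-neighbour : ∀ y → Adj T c y → # (via? y) ≤ D * m
        per-neighbour y e = ≤-trans (union-bound (λ h → adj? T y h ×-dec H? h) (λ h u → U? u ×-dec miss? b (f₀ h) u) (via? y)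
            (λ { h (_ , hub) → few-missed (f₀ h) (f₀∈U h hub) }) λ { u (p , h , q , ms) → h , q , p , ms })
          (*-monoˡ-≤ m (≤-trans (#-mono _ (adj? T y) λ _ → proj₁) (calm-neighbour-degree (core-calm c t) e)))
      few : # useless? ≤ B
      few with # useless? ≤? B
      ... | yes le = le
      ... | no ≰ = contradiction (≤-trans (*-monoˡ-≤ (suc k) (≰⇒> ≰))
          (double-count (∈? core) R? useless? per-core λ { u (p , lt) → ≤-trans lt (#-mono _ _ λ { c (t , w) → t , p , w }) })) (<⇒≱ h)

    Dom : (Fin n → Bool) → Fin n → Set
    Dom filled v = Hub D v ⊎ (filled v ≡ true ⊎ ∃ λ c → filled c ≡ true × Adj T c v)

    dom? : ∀ filled → Decidable (Dom filled)
    dom? filled v = H? v ⊎-dec (∈? filled v ⊎-dec any? λ c → ∈? filled c ×-dec adj? T c v)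

    -- Filled cores lie outside U and their neighbours inside. Once no further vertex outside U
    -- can be attached, almost all edges between U and the unused vertices outside have the other
    -- colour.
    record Filling (j : ℕ) : Set where
      field
        f             : Fin n → Fin N
        filled        : Fin n → Bool
        filled-core   : ∀ c → filled c ≡ true → core c ≡ true
        size          : # (∈? filled) ≡ j
        placed        : Placed (Dom filled) f
        on-hubs       : ∀ h → Hub D h → f h ≡ f₀ h
        outside       : ∀ c → filled c ≡ true → ¬ U (f c)
        inside        : ∀ c y → filled c ≡ true → Adj T c y → U (f y)

      Used : Fin N → Set
      Used = Image (dom? filled) f

      used? : Decidable Used
      used? = image? (dom? filled) f

      -- A core has at most D neighbours, so D free useful vertices joined to `r` in colour `b` can
      -- receive all of them.
      Attachable : Fin N → Set
      Attachable r = (¬ U r × ¬ Used r) × D ≤ # (λ u → (useful? u ×-dec ¬? (used? u)) ×-dec edge? b r u)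

      attachable? : Decidable Attachable
      attachable? r = (¬? (U? r) ×-dec ¬? (used? r)) ×-dec (D ≤? # (λ u → (useful? u ×-dec ¬? (used? u)) ×-dec edge? b r u))

    unfilled : Filling 0
    unfilled = record
      { f = f₀ ; filled = λ _ → false ; filled-core = λ _ () ; size = #-empty (∈? (λ _ → false)) λ _ ()
      ; placed = λ u v p q → placed₀ u v (only-hub p) (only-hub q) ; on-hubs = λ _ _ → refl ; outside = λ _ () ; inside = λ _ _ () }
      where
      only-hub : ∀ {v} → Dom (λ _ → false) v → Hub D v
      only-hub (inj₁ h) = h
      only-hub (inj₂ (inj₁ ()))
      only-hub (inj₂ (inj₂ (_ , () , _)))

    module Attach {j} (F : Filling j) (r : Fin N) (at : Filling.Attachable F r) where
      open Filling F

      private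
        J = choose _ D (proj₂ at)
        J? : Decidable (λ u → proj₁ J u ≡ true)
        J? = ∈? (proj₁ J)
        J-useful : ∀ u → proj₁ J u ≡ true → Useful u
        J-useful u t = proj₁ (proj₁ (proj₁ (proj₂ J) u t))
        J-free : ∀ u → proj₁ J u ≡ true → ¬ Used u
        J-free u t = proj₂ (proj₁ (proj₁ (proj₂ J) u t))
        J-edge : ∀ u → proj₁ J u ≡ true → Edge b r u
        J-edge u t = proj₂ (proj₁ (proj₂ J) u t)
        spoiled? : Decidable (λ c → ∃ λ u → proj₁ J u ≡ true × (core c ≡ true × Unfriendly c u))
        spoiled? c = any? λ u → J? u ×-dec (∈? core c ×-dec unfriendly? c u)

      opaque
        -- Excluded are the `j` filled cores and at most `k` cores for each of the D useful vertices
        -- in `J`.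
        available-core : j + D * k < # (∈? core) →
          ∃ λ c → core c ≡ true × filled c ≢ true × (∀ u → proj₁ J u ≡ true → ¬ Unfriendly c u)
        available-core room = c , proj₁ (proj₂ found) , (λ t → proj₂ (proj₂ found) (inj₁ t)) ,
            λ u t w → proj₂ (proj₂ found) (inj₂ (u , t , proj₁ (proj₂ found) , w))
          where
          bad-choice? : Decidable (λ c → filled c ≡ true ⊎ (∃ λ u → proj₁ J u ≡ true × (core c ≡ true × Unfriendly c u)))
          bad-choice? c = ∈? filled c ⊎-dec spoiled? c
          few : # bad-choice? < # (∈? core)
          few = ≤-trans (s≤s (≤-trans (#-cover bad-choice? (∈? filled) spoiled? λ _ → id)
              (+-mono-≤ (≤-reflexive size)
                (≤-trans (union-bound J? (λ u c → ∈? core c ×-dec unfriendly? c u) spoiled? (λ u t → proj₂ (J-useful u t)) λ _ → id)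
                         (≤-reflexive (cong (_* k) (proj₂ (proj₂ J)))))))) room
          found : ∃ λ c → core c ≡ true × ¬ (filled c ≡ true ⊎ (∃ λ u → proj₁ J u ≡ true × (core c ≡ true × Unfriendly c u)))
          found = pick (∈? core) bad-choice? few
          c : Fin n
          c = proj₁ found

        neighbours-into-J : ∀ c → core c ≡ true → ∃ λ h → (∀ y → Adj T c y → proj₁ J (h y) ≡ true) × InjectiveOn (Adj T c) h
        neighbours-into-J c t = inject (adj? T c) J? r (≤-trans (calm-degree (core-calm c t)) (≤-reflexive (sym (proj₂ (proj₂ J)))))

      attach : j + D * k < # (∈? core) → Filling (suc j)
      attach room = record
        { f = f′ ; filled = filled′ ; filled-core = filled-core′ ; size = size′ ; placed = placed′ ; on-hubs = on-hubs′
        ; outside = outside′ ; inside = inside′ }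
        where
        chosen = available-core room
        c = proj₁ chosen
        c-core = proj₁ (proj₂ chosen)
        c-new = proj₁ (proj₂ (proj₂ chosen))
        friendly = proj₂ (proj₂ (proj₂ chosen))
        into-J = neighbours-into-J c c-core
        h = proj₁ into-J
        h∈J = proj₁ (proj₂ into-J)
        h-inj = proj₂ (proj₂ into-J)
        filled′ : Fin n → Bool
        filled′ = update filled c true
        f₁ : Fin n → Fin N
        f₁ v with adj? T c v
        ... | yes _ = h v
        ... | no _ = f v
        f′ : Fin n → Fin N
        f′ = update f₁ c r
        data View (v : Fin n) : Set where
          is-core : v ≡ c → f′ v ≡ r → View v
          is-nb   : Adj T c v → f′ v ≡ h v → View v
          is-old  : v ≢ c → ¬ Adj T c v → f′ v ≡ f v → View v
        view : ∀ v → View v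
        view v with v F.≟ c
        ... | yes refl = is-core refl (update-at f₁ c r)
        ... | no v≢c with adj? T c v in eq
        ...   | yes e = is-nb e (trans (update-other f₁ c r v≢c) (nb-value eq))
          where
          nb-value : adj? T c v ≡ yes e → f₁ v ≡ h v
          nb-value eq rewrite eq = refl
        ...   | no ¬e = is-old v≢c ¬e (trans (update-other f₁ c r v≢c) (old-value eq))
          where
          old-value : adj? T c v ≡ no ¬e → f₁ v ≡ f v
          old-value eq rewrite eq = refl
        old-filled : ∀ v → filled′ v ≡ true → v ≡ c ⊎ filled v ≡ true
        old-filled v t with v F.≟ c
        ... | yes eq = inj₁ eq
        ... | no _ = inj₂ t
        keep-filled : ∀ v → filled v ≡ true → filled′ v ≡ true
        keep-filled v t = trans (update-other filled c true λ { refl → c-new t }) t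
        filled-core′ : ∀ v → filled′ v ≡ true → core v ≡ true
        filled-core′ v t with old-filled v t
        ... | inj₁ refl = c-core
        ... | inj₂ t′ = filled-core v t′
        size′ : # (∈? filled′) ≡ suc j
        size′ = ≤-antisym
          (≤-trans (#-cover (∈? filled′) (λ v → v F.≟ c) (∈? filled) old-filled)
                   (+-mono-≤ (#-unique (λ v → v F.≟ c) λ _ _ p q → trans p (sym q)) (≤-reflexive size)))
          (≤-trans (≤-reflexive (cong suc (sym size)))
                   (#-remove (∈? filled′) (∈? filled) (update-at filled c true) λ v t → keep-filled v t , λ { refl → c-new t }))
        -- Neighbours of the new core are still unplaced: not hubs since the core is calm, not cores
        -- since all cores lie in one class, and not neighbours of another filled core since
        -- neighbourhoods are disjoint.
        not-dom-nb : ∀ {v} → Adj T c v → ¬ Dom filled v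
        not-dom-nb e (inj₁ hub) = proj₂ (core-calm c c-core) (_ , hub , e)
        not-dom-nb e (inj₂ (inj₁ t)) = class-clash (trans (core-class c c-core) (sym (core-class _ (filled-core _ t)))) e
        not-dom-nb e (inj₂ (inj₂ (c′ , t , e′))) =
          c-new (subst (λ x → filled x ≡ true) (core-apart c′ c (filled-core c′ t) c-core (_ , e′ , Adj-sym T e)) t)
        not-dom-core : ¬ Dom filled c
        not-dom-core (inj₁ hub) = proj₁ (core-calm c c-core) hub
        not-dom-core (inj₂ (inj₁ t)) = c-new t
        not-dom-core (inj₂ (inj₂ (c′ , t , e))) = class-clash (trans (core-class c′ (filled-core c′ t)) (sym (core-class c c-core))) e
        data Region (v : Fin n) : Set where
          core-region : v ≡ c → f′ v ≡ r → Region v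
          nb-region   : Adj T c v → f′ v ≡ h v → Region v
          old-region  : Dom filled v → f′ v ≡ f v → Region v
        old-dom : ∀ v → Dom filled v → f′ v ≡ f v
        old-dom v d with view v
        ... | is-core refl _ = contradiction d not-dom-core
        ... | is-nb e _ = contradiction d (not-dom-nb e)
        ... | is-old _ _ eq = eq
        nb-value : ∀ v → Adj T c v → f′ v ≡ h v
        nb-value v e with view v
        ... | is-core refl _ = contradiction e (Adj-irrefl T)
        ... | is-nb _ eq = eq
        ... | is-old _ ¬e _ = contradiction e ¬e
        region : ∀ v → Dom filled′ v → Region v
        region v (inj₁ hub) = old-region (inj₁ hub) (old-dom v (inj₁ hub))
        region v (inj₂ (inj₁ t)) with old-filled v t
        ... | inj₁ refl = core-region refl (update-at f₁ c r)
        ... | inj₂ t′ = old-region (inj₂ (inj₁ t′)) (old-dom v (inj₂ (inj₁ t′)))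
        region v (inj₂ (inj₂ (c′ , t , e))) with old-filled c′ t
        ... | inj₁ refl = nb-region e (nb-value v e)
        ... | inj₂ t′ = old-region (inj₂ (inj₂ (c′ , t′ , e))) (old-dom v (inj₂ (inj₂ (c′ , t′ , e))))
        Good : Fin n → Fin n → Fin N → Fin N → Set
        Good u v x y = x ≢ y × (Adj T u v → col G x y ≡ b)
        good-sym : ∀ {u v x y} → Good u v x y → Good v u y x
        good-sym {x = x} {y} (ne , p) = (λ eq → ne (sym eq)) , λ e → trans (symm G y x) (p (Adj-sym T e))
        core-nb : ∀ v → Adj T c v → Good c v r (h v)
        core-nb v e = proj₁ (J-edge (h v) (h∈J v e)) , λ _ → proj₂ (J-edge (h v) (h∈J v e))
        core-old : ∀ v → Dom filled v → Good c v r (f v)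
        core-old v d = (λ eq → proj₂ (proj₁ at) (v , d , sym eq)) , λ e → contradiction d (not-dom-nb e)
        nb-nb : ∀ u v → u ≢ v → Adj T c u → Adj T c v → Good u v (h u) (h v)
        nb-nb u v u≢v e e′ = (λ eq → u≢v (h-inj u v e e′ eq)) ,
          λ e″ → contradiction e″ (class-clash (trans (core-neighbour-class c-core e) (sym (core-neighbour-class c-core e′))))
        nb-old : ∀ u v → Adj T c u → Dom filled v → Good u v (h u) (f v)
        nb-old u v e d = ne , coloured d
          where
          ne : h u ≢ f v
          ne eq = J-free (h u) (h∈J u e) (v , d , sym eq)
          -- Among the vertices placed before, a neighbour of the new core can be adjacent only to
          -- hubs; this is where friendliness enters.
          coloured : Dom filled v → Adj T u v → col G (h u) (f v) ≡ b
          coloured (inj₁ hub) e′ with col G (h u) (f v) ≟ᶜ b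
          ... | yes eq = eq
          ... | no neq = contradiction (u , e , v , (e′ , hub) , (λ eq → ne (sym (trans (on-hubs v hub) eq))) ,
                  λ eq → neq (trans (symm G (h u) (f v)) (trans (cong (λ x → col G x (h u)) (on-hubs v hub)) eq)))
                  (friendly (h u) (h∈J u e))
          coloured (inj₂ (inj₁ t)) e′ = contradiction (inj₂ (inj₂ (v , t , Adj-sym T e′))) (not-dom-nb e)
          coloured (inj₂ (inj₂ (c′ , t , e″))) e′ =
            contradiction e′ (class-clash (trans (core-neighbour-class c-core e) (sym (core-neighbour-class (filled-core c′ t) e″))))
        placed′ : Placed (Dom filled′) f′
        placed′ u v p q u≢v with region u p | region v q
        ... | core-region refl _ | core-region refl _ = contradiction refl u≢v
        ... | core-region refl x | nb-region e y = subst₂ (Good c v) (sym x) (sym y) (core-nb v e)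
        ... | core-region refl x | old-region d y = subst₂ (Good c v) (sym x) (sym y) (core-old v d)
        ... | nb-region e x | core-region refl y = subst₂ (Good u c) (sym x) (sym y) (good-sym {c} {u} (core-nb u e))
        ... | nb-region e x | nb-region e′ y = subst₂ (Good u v) (sym x) (sym y) (nb-nb u v u≢v e e′)
        ... | nb-region e x | old-region d y = subst₂ (Good u v) (sym x) (sym y) (nb-old u v e d)
        ... | old-region d x | core-region refl y = subst₂ (Good u c) (sym x) (sym y) (good-sym {c} {u} (core-old u d))
        ... | old-region d x | nb-region e y = subst₂ (Good u v) (sym x) (sym y) (good-sym {v} {u} (nb-old v u e d))
        ... | old-region d x | old-region d′ y = subst₂ (Good u v) (sym x) (sym y) (placed u v d d′ u≢v)
        on-hubs′ : ∀ v → Hub D v → f′ v ≡ f₀ v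
        on-hubs′ v hub = trans (old-dom v (inj₁ hub)) (on-hubs v hub)
        outside′ : ∀ v → filled′ v ≡ true → ¬ U (f′ v)
        outside′ v t with old-filled v t
        ... | inj₁ refl = subst (λ x → ¬ U x) (sym (update-at f₁ c r)) (proj₁ (proj₁ at))
        ... | inj₂ t′ = subst (λ x → ¬ U x) (sym (old-dom v (inj₂ (inj₁ t′)))) (outside v t′)
        inside′ : ∀ v y → filled′ v ≡ true → Adj T v y → U (f′ y)
        inside′ v y t e with old-filled v t
        ... | inj₁ refl = subst U (sym (nb-value y e)) (proj₁ (J-useful (h y) (h∈J y e)))
        ... | inj₂ t′ = subst U (sym (old-dom y (inj₂ (inj₂ (v , t′ , e))))) (inside v y t′ e)

    opaque
      fill : ∀ q → q + D * k ≤ # (∈? core) →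
        Filling q ⊎ ∃ λ j → j < q × Σ (Filling j) λ F → ∀ r → ¬ Filling.Attachable F r
      fill q room = go q ≤-refl unfilled-at
        where
        unfilled-at : Filling (q ∸ q)
        unfilled-at = subst Filling (sym (n∸n≡0 q)) unfilled
        go : ∀ i → i ≤ q → Filling (q ∸ i) → Filling q ⊎ ∃ λ j → j < q × Σ (Filling j) λ F → ∀ r → ¬ Filling.Attachable F r
        go zero _ F = inj₁ F
        go (suc i) i<q F with any? (Filling.attachable? F)
        ... | no none = inj₂ (q ∸ suc i , lt , F , λ r at → none (r , at))
          where
          lt : q ∸ suc i < q
          lt = ≤-trans (≤-reflexive (sym (+-∸-assoc 1 i<q))) (m∸n≤m q i)
        ... | yes (r , at) = go i (<⇒≤ i<q) (subst Filling (sym (+-∸-assoc 1 i<q)) (Attach.attach F r at lt))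
          where
          lt : q ∸ suc i + D * k < # (∈? core)
          lt = ≤-trans (≤-reflexive (cong (_+ D * k) (sym (+-∸-assoc 1 i<q)))) (≤-trans (+-monoˡ-≤ (D * k) (m∸n≤m q i)) room)

  core? : Decidable (λ c → core c ≡ true)
  core? = ∈? core

  -- `q` is the deficit n - |U|, cut off at zero. A stuck filling has j < q, so it occurs only for a
  -- genuine deficit.
  module _ (d : Fin N) (q k B Δ : ℕ) (degree≤Δ : ∀ v → # (adj? T v) ≤ Δ) (1≤D : 1 ≤ D)
    (q-sound : q + # U? ≤ n ⊎ q ≡ 0) (q-enough : n ≤ # U? + q)
    (room₁ : # (hub? D) + 1 * m ≤ # U?) (room₂ : # core? * (D * (D * m)) < suc B * suc k)
    (room₃ : q + D * k ≤ # core?) (room₄ : (# class₁? + # (hub? D) + q * D + B) * 2 + # class₂? ≤ # U? * 2)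
    (room₅ : D * Δ * 3 < # class₁?) (room₆ : n + # class₂? ≤ N + 1) (room₇ : D * m + m + q < # core?)
    (f₀ : Fin n → Fin N) (f₀∈U : ∀ v → Hub D v → U (f₀ v)) (placed₀ : Placed (Hub D) f₀) where

    module Stuck {j} (j<q : j < q) (F : Filling f₀ f₀∈U placed₀ k j)
      (stuck : ∀ r → ¬ Filling.Attachable F r) where
      open Filling F

      W? : Decidable (λ y → ¬ U y × ¬ Used y)
      W? y = ¬? (U? y) ×-dec ¬? (used? y)

      U′? : Decidable (λ u → Useful f₀ f₀∈U placed₀ k u × ¬ Used u)
      U′? u = useful? f₀ f₀∈U placed₀ k u ×-dec ¬? (used? u)

      beside? : Decidable (λ v → ∃ λ c → filled c ≡ true × Adj T c v)
      beside? v = any? λ c → ∈? filled c ×-dec adj? T c v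

      beside-few : # beside? ≤ j * D
      beside-few = ≤-trans (union-bound (∈? filled) (adj? T) beside?
          (λ c t → calm-degree (core-calm c (filled-core c t))) λ _ → id) (≤-reflexive (cong (_* D) size))

      -- An exact count: at least t₂ - 1 + q vertices lie outside `U`, and only the j ≤ q - 1 filled
      -- cores are placed there.
      W-many : # class₂? ≤ # W?
      W-many = estimate-25 j q n (# class₂?) N (# U?) (# rest?) (# W?) (# (image? (∈? filled) f)) (# (∈? filled)) j<q room₆ sound cover (#-cover rest? W? (image? (∈? filled) f) rest-cases) (#-image (∈? filled) f) (≤-reflexive size)
        where
        sound : q + # U? ≤ n
        sound = positive q-sound
          where
          positive : q + # U? ≤ n ⊎ q ≡ 0 → q + # U? ≤ n
          positive (inj₁ le) = le
          positive (inj₂ eq) = contradiction (subst (j <_) eq j<q) λ ()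
        rest? : Decidable (λ y → ¬ U y)
        rest? y = ¬? (U? y)
        cover : N ≤ # U? + # rest?
        cover = ≤-reflexive (sym (#-complement U?))
        rest-cases : ∀ y → ¬ U y → (¬ U y × ¬ Used y) ⊎ Image (∈? filled) f y
        rest-cases y ¬u with used? y
        ... | no ¬used = inj₁ (¬u , ¬used)
        ... | yes (v , inj₁ hub , refl) = contradiction (subst U (sym (on-hubs v hub)) (f₀∈U v hub)) ¬u
        ... | yes (v , inj₂ (inj₁ t) , refl) = inj₂ (v , t , refl)
        ... | yes (v , inj₂ (inj₂ (c , t , e)) , refl) = contradiction (inside c v t e) ¬u

      U-many : # U? ≤ # U′? + # (hub? D) + j * D + B
      U-many = estimate-26 (# U?) (# (useful? f₀ f₀∈U placed₀ k)) B (# U′?) (# taken?) (# (image? (hub? D) f)) (# (image? beside? f)) (# (hub? D)) (# beside?) (j * D) (useful-many f₀ f₀∈U placed₀ k room₂) (#-cover (useful? f₀ f₀∈U placed₀ k) U′? taken? cases) (#-cover taken? (image? (hub? D) f) (image? beside? f) (λ _ → id)) (#-image (hub? D) f) (#-image beside? f) beside-few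
        where
        taken? : Decidable (λ u → Image (hub? D) f u ⊎ Image beside? f u)
        taken? u = image? (hub? D) f u ⊎-dec image? beside? f u
        cases : ∀ u → Useful f₀ f₀∈U placed₀ k u → (Useful f₀ f₀∈U placed₀ k u × ¬ Used u) ⊎ (Image (hub? D) f u ⊎ Image beside? f u)
        cases u useful with used? u
        ... | no ¬used = inj₁ (useful , ¬used)
        ... | yes (v , inj₁ hub , eq) = inj₂ (inj₁ (v , hub , eq))
        ... | yes (v , inj₂ (inj₁ t) , refl) = contradiction (proj₁ useful) (outside v t)
        ... | yes (v , inj₂ (inj₂ w) , eq) = inj₂ (inj₂ (v , w , eq))

      copy : MonoCopy G T
      copy = bipartite-copy b U′? W? (λ { x ((u , _) , _) (¬u , _) → ¬u u }) degree≤Δ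
        (λ w p → <⇒≤ (≰⇒> λ le → stuck w (p , le))) 1≤D W-many
        (estimate-27 (# U?) (# U′?) (# (hub? D)) (j * D) B (q * D) (# class₁?) (# class₂?) U-many (*-monoˡ-≤ D (<⇒≤ j<q)) room₄)
        room₅ d

    module Full (F : Filling f₀ f₀∈U placed₀ k q) where
      open Filling F

      -- The unfilled cores are held back. The filled ones occupy q places outside `U`, and |U| ≥ n
      -- - q, so the rest of T fits into `U`, possibly without a spare vertex once the matching has
      -- returned the reservoir.
      L : Fin n → Set
      L v = core v ≡ true × filled v ≢ true

      L? : Decidable L
      L? v = core? v ×-dec ¬? (∈? filled v)

      S : Fin n → Set
      S = Dom f₀ f₀∈U placed₀ k filled

      S? : Decidable S
      S? = dom? f₀ f₀∈U placed₀ k filled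

      Q? : Decidable (λ v → ¬ S v × core v ≢ true)
      Q? v = ¬? (S? v) ×-dec ¬? (core? v)

      K : Fin n → Fin N → Set
      K v y = (filled v ≡ true × ¬ U y) ⊎ (filled v ≢ true × U y)

      K? : ∀ v y → Dec (K v y)
      K? v y = (∈? filled v ×-dec ¬? (U? y)) ⊎-dec (¬? (∈? filled v) ×-dec U? y)

      S⇒K : ∀ u → S u → K u (f u)
      S⇒K u (inj₂ (inj₁ t)) = inj₁ (t , outside u t)
      S⇒K u (inj₁ hub) = inj₂ ((λ t → proj₁ (core-calm u (filled-core u t)) hub) , subst U (sym (on-hubs u hub)) (f₀∈U u hub))
      S⇒K u (inj₂ (inj₂ (c , t , e))) =
        inj₂ ((λ t′ → class-clash (trans (core-class c (filled-core c t)) (sym (core-class u (filled-core u t′)))) e) , inside c u t e)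

      unfilled-Q : ∀ v → ¬ S v × core v ≢ true → filled v ≢ true
      unfilled-Q v (_ , ¬core) t = ¬core (filled-core v t)

      cell? : ∀ v → Decidable (λ u → (S u ⊎ (¬ S u × core u ≢ true)) × filled u ≡ filled v)
      cell? v u = (S? u ⊎-dec Q? u) ×-dec (filled u B.≟ filled v)

      noncore-size : # core? + # (¬? ∘ core?) ≡ n
      noncore-size = #-complement core?

      ¬L⇒ : ∀ u → ¬ L u → S u ⊎ (¬ S u × core u ≢ true)
      ¬L⇒ u ¬l with S? u
      ... | yes s = inj₁ s
      ... | no ¬s = inj₂ (¬s , λ t → ¬l (t , λ t′ → ¬s (inj₂ (inj₁ t′))))

      unfilled-noncore : ∀ u → S u ⊎ (¬ S u × core u ≢ true) → filled u ≢ true → core u ≢ true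
      unfilled-noncore u (inj₁ (inj₁ hub)) _ t = proj₁ (core-calm u t) hub
      unfilled-noncore u (inj₁ (inj₂ (inj₁ t))) ¬t _ = ¬t t
      unfilled-noncore u (inj₁ (inj₂ (inj₂ (c , t , e)))) _ t′ = class-clash (trans (core-class c (filled-core c t)) (sym (core-class u t′))) e
      unfilled-noncore u (inj₂ (_ , ¬core)) _ = ¬core

      opaque
        embedding : ∃ λ g → (∀ u → S u → g u ≡ f u) × (∀ u → S u ⊎ (¬ S u × core u ≢ true) → K u (g u)) × Placed (λ u → S u ⊎ (¬ S u × core u ≢ true)) g
        embedding = embed {K = K} K? {S = S} {Q = λ v → ¬ S v × core v ≢ true} S? Q? (λ v s q → proj₁ q s) toℕ toℕ-injective
          {Same = λ u v → filled u ≡ filled v} (λ u v → filled u B.≟ filled v) (λ _ → refl) cells D m f S⇒K placed few back room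
          where
          cells : ∀ u v x → filled u ≢ filled v → K u x → K v x → ⊥
          cells u v x ne (inj₁ (t , _)) (inj₁ (t′ , _)) = ne (trans t (sym t′))
          cells u v x ne (inj₁ (_ , ¬p)) (inj₂ (_ , p)) = ¬p p
          cells u v x ne (inj₂ (_ , p)) (inj₁ (_ , ¬p)) = ¬p p
          cells u v x ne (inj₂ (t , _)) (inj₂ (t′ , _)) with filled u | filled v
          ... | true | _ = t refl
          ... | false | true = t′ refl
          ... | false | false = ne refl
          few : ∀ u v x → S u ⊎ (¬ S u × core u ≢ true) → (¬ S v × core v ≢ true) → Adj T u v → K u x → # (λ y → K? v y ×-dec miss? b x y) ≤ m
          few u v x _ q e (inj₁ (t , _)) = contradiction (inj₂ (inj₂ (u , t , e))) (proj₁ q)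
          few u v x _ q e (inj₂ (_ , p)) = ≤-trans (#-mono _ (λ y → U? y ×-dec miss? b x y)
            λ { y (inj₁ (t , _) , _) → contradiction t (unfilled-Q v q) ; y (inj₂ (_ , p′) , ms) → p′ , ms }) (few-missed x p)
          back : ∀ v → ¬ S v × core v ≢ true → # (λ u → (S? u ⊎-dec (Q? u ×-dec (toℕ u <? toℕ v))) ×-dec adj? T u v) ≤ D
          back v (¬s , _) = ≤-trans (#-mono _ (adj? T v) λ { u (_ , e) → Adj-sym T e }) (≮⇒≥ λ hub → ¬s (inj₁ hub))
          room : ∀ v → ¬ S v × core v ≢ true → # (cell? v) + D * m ≤ # (K? v)
          room v qv = estimate-28 (# (cell? v)) (# (¬? ∘ core?)) (# U?) (# (K? v)) (# core?) n q (D * m) m (#-mono (cell? v) (¬? ∘ core?) (λ { u (p , eq) → unfilled-noncore u p λ t → unfilled-Q v qv (trans (sym eq) t) })) (#-mono U? (K? v) (λ y p → inj₂ (unfilled-Q v qv , p))) (≤-reflexive noncore-size) q-enough room₇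

      g : Fin n → Fin N
      g = proj₁ embedding

      g-inside : ∀ v → filled v ≢ true → S v ⊎ (¬ S v × core v ≢ true) → U (g v)
      g-inside v ¬t p with proj₁ (proj₂ (proj₂ embedding)) v p
      ... | inj₁ (t , _) = contradiction t ¬t
      ... | inj₂ (_ , u) = u

      kept? : Decidable (λ v → ¬ L v)
      kept? v = ¬? (L? v)

      free? : Decidable (λ y → U y × ¬ Image kept? g y)
      free? y = U? y ×-dec ¬? (image? kept? g y)

      L-size : # L? + q ≡ # core?
      L-size = trans (+-comm (# L?) q) (trans (cong (_+ # L?) (trans (sym size) (#-cong (∈? filled) (λ v → core? v ×-dec ∈? filled v) (λ v t → filled-core v t , t) λ _ → proj₂)))
        (sym (#-split core? (∈? filled))))

      free-many : # L? ≤ # free?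
      free-many = estimate-29 (# U?) (# free?) (# taken?) (# (¬? ∘ core?)) (# core?) n q (# L?) (#-cover U? free? taken? cases) (#-image (¬? ∘ core?) g) (≤-reflexive noncore-size) q-enough (≤-reflexive L-size)
        where
        taken? : Decidable (Image (¬? ∘ core?) g)
        taken? = image? (¬? ∘ core?) g
        cases : ∀ y → U y → (U y × ¬ Image kept? g y) ⊎ Image (¬? ∘ core?) g y
        cases y u with image? kept? g y
        ... | no ¬i = inj₁ (u , ¬i)
        ... | yes (v , ¬l , refl) = inj₂ (v , unfilled-noncore v (¬L⇒ v ¬l) ¬filled , refl)
          where
          ¬filled : filled v ≢ true
          ¬filled t = outside v t (subst U (proj₁ (proj₂ embedding) v (inj₂ (inj₁ t))) u)

      copy : MonoCopy G T
      copy = Finish.finish L? g (λ u v p r → proj₂ (proj₂ (proj₂ embedding)) u v (¬L⇒ u p) (¬L⇒ v r))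
        (λ u v p r → class-clash (trans (core-class u (proj₁ p)) (sym (core-class v (proj₁ r)))))
        (λ u v y p r e e′ → core-apart u v (proj₁ p) (proj₁ r) (y , e , Adj-sym T e′))
        free? (λ v y p r eq → proj₂ r (v , p , eq)) U? (λ _ → proj₁) neighbour-inside
        few-missed (λ l p → calm-degree (core-calm l (proj₁ p)))
        (estimate-30 (D * m) m q (# core?) (# L?) room₇ (≤-reflexive (sym L-size))) free-many
        where
        neighbour-inside : ∀ l y → L l → Adj T l y → U (g y)
        neighbour-inside l y p e = g-inside y (λ t → class-clash (trans (core-class l (proj₁ p)) (sym (core-class y (filled-core y t)))) e)
          (¬L⇒ y λ r → class-clash (trans (core-class l (proj₁ p)) (sym (core-class y (proj₁ r)))) e)

    spread-copy : MonoCopy G T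
    spread-copy with fill f₀ f₀∈U placed₀ k q room₃
    ... | inj₁ F = Full.copy F
    ... | inj₂ (j , j<q , F , stuck) = Stuck.copy j<q F stuck

-- A large second class

opaque
  hub-threshold : ℕ
  hub-threshold = 100000000

  hub-threshold-value : hub-threshold ≡ 100000000
  hub-threshold-value = refl

quotient : ∀ n k .{{_ : ℕ.NonZero k}} → ∃ λ q → q * k ≤ n × n < q * k + k
quotient n k = n / k , m/n*n≤m n k ,
  ≤-trans (s≤s (≤-reflexive (m≡m%n+[m/n]*n n k))) (≤-trans (+-monoˡ-≤ _ (m%n<n n k)) (≤-reflexive (+-comm k _)))

-- The constants are abstracted in order to keep large numerals from being unfolded.
scaled-product : ∀ g k m a b c → a * b ≡ c → g < k * a + a → g * (m * b) < suc (m * c) * suc k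
scaled-product g k m a b c refl g< = ≤-trans (s≤s bound) (≤-trans (≤-reflexive refl) (+-monoˡ-≤ (m * (a * b) * suc k) (s≤s z≤n)))
  where
  open ≤-Reasoning
  bound : g * (m * b) ≤ m * (a * b) * suc k
  bound = begin
    g * (m * b)            ≤⟨ *-monoˡ-≤ (m * b) (<⇒≤ g<) ⟩
    (k * a + a) * (m * b)  ≡⟨ cong (_* (m * b)) (+-comm (k * a) a) ⟩
    suc k * a * (m * b)    ≡⟨ *-assoc (suc k) a (m * b) ⟩
    suc k * (a * (m * b))  ≡⟨ cong (suc k *_) (trans (sym (*-assoc a m b)) (trans (cong (_* b) (*-comm a m)) (*-assoc m a b))) ⟩
    suc k * (m * (a * b))  ≡⟨ *-comm (suc k) _ ⟩
    m * (a * b) * suc k    ∎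

estimate-31 = linear 1 (λ D → (con 100000000 ⊑ D) ∷ [] ⊢ con 1 ⊑ D) 0 (1 ∷ [])

estimate-32 = linear 4 (λ x1 n x3 m → (x1 ⊛ 100000000 ⊑ n) ∷ (n ⊑ x3 ⊕ m) ∷ (m ⊛ 10000000000000000000000000000000000 ⊑ n) ∷ [] ⊢ x1 ⊕ (m ⊕ con 0) ⊑ x3) 999999999999999999999999999999999899999999 (9999999999999999999999999999999999 ∷ 10000000000000000000000000100000000 ∷ 100000001 ∷ [])

estimate-33 = linear 7 (λ x1 k g x4 q m n → (x1 ⊑ k ⊛ 100000000) ∷ (g ⊑ x4) ∷ (k ⊛ 1000000000 ⊑ g) ∷ (q ⊑ m) ∷ (con 1 ⊑ m) ∷ (m ⊛ 10000000000000000000000000000000000 ⊑ n) ∷ (con 1 ⊕ n ⊑ g ⊛ 100000000000000000000000 ⊕ con 100000000000000000000000) ∷ [] ⊢ q ⊕ x1 ⊑ x4) 999999999999999999999999 (1000000000000000000000000 ∷ 1000000000000000000000000 ∷ 100000000000000000000000 ∷ 1000000000000000000000000 ∷ 89999999999000000000000000000000000 ∷ 9 ∷ 9 ∷ [])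

estimate-34 = linear 8 (λ x1 q m x4 n x6 x7 x8 → (x1 ⊑ q ⊛ 100000000) ∷ (q ⊑ m) ∷ (x4 ⊛ 100000000 ⊑ n) ∷ (n ⊑ x6 ⊕ m) ∷ (x7 ⊕ x8 ⊑ n) ∷ (n ⊑ x8 ⊛ 1000000) ∷ (m ⊛ 10000000000000000000000000000000000 ⊑ n) ∷ [] ⊢ (x7 ⊕ x4 ⊕ x1 ⊕ m ⊛ 10000000000000000000000000) ⊛ 2 ⊕ x8 ⊑ x6 ⊛ 2) 499999999999999999999999999999999949999999 (999999999999999999999999999999999900000000 ∷ 99999999999999999999999999999999990000000000000000 ∷ 9999999999999999999999999999999999 ∷ 999999511000000000000000010000000000000000 ∷ 999999999999999999999999999999999900000000 ∷ 499999999999999999999999999999999950 ∷ 1000000000000000010000000099999951 ∷ [])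

estimate-35 = linear 6 (λ x1 Δ n x4 x5 m → (x1 ⊑ Δ ⊛ 100000000) ∷ (Δ ⊛ 10000000000 ⊑ n) ∷ (x4 ⊑ x5) ∷ (n ⊑ x5 ⊕ x4) ∷ (con 1 ⊑ m) ∷ (m ⊛ 10000000000000000000000000000000000 ⊑ n) ∷ [] ⊢ con 1 ⊕ x1 ⊛ 3 ⊑ x5) 99 (300 ∷ 3 ∷ 50 ∷ 50 ∷ 470000000000000000000000000000000000 ∷ 47 ∷ [])

estimate-36 = linear 6 (λ x1 m g x4 q n → (x1 ⊑ m ⊛ 100000000) ∷ (g ⊑ x4) ∷ (q ⊑ m) ∷ (con 1 ⊑ m) ∷ (m ⊛ 10000000000000000000000000000000000 ⊑ n) ∷ (con 1 ⊕ n ⊑ g ⊛ 100000000000000000000000 ⊕ con 100000000000000000000000) ∷ [] ⊢ con 1 ⊕ (x1 ⊕ m ⊕ q) ⊑ x4) 99999999999999999999999 (100000000000000000000000 ∷ 100000000000000000000000 ∷ 100000000000000000000000 ∷ 9989999999800000000000000000000000 ∷ 1 ∷ 1 ∷ [])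

estimate-37 = linear 7 (λ x1 m n x4 x5 x6 x7 → (x1 ⊑ m ⊛ 8) ∷ (n ⊑ x4 ⊛ 1000000) ∷ (x5 ⊛ 100000000 ⊑ n) ∷ (m ⊛ 10000000000000000000000000000000000 ⊑ n) ∷ (x6 ⊑ x5 ⊛ 3 ⊕ x7 ⊛ 2) ∷ (x4 ⊑ x1 ⊕ x6) ∷ [] ⊢ n ⊑ x7 ⊛ 3000000) 1212499999999999999999999998 (1250000000000000000000000000000000 ∷ 1250000000000000000000000000 ∷ 37500000000000000000000000 ∷ 1 ∷ 1250000000000000000000000000000000 ∷ 1250000000000000000000000000000000 ∷ [])

estimate-38 = linear 3 (λ g n x3 → (g ⊛ 100000000000000000000000 ⊑ n) ∷ (n ⊑ x3 ⊛ 6000000) ∷ [] ⊢ g ⊛ 10000000000000001 ⊑ x3) 99999999999999999999999 (10000000000000001 ∷ 10000000000000001 ∷ [])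

estimate-39 = linear 4 (λ x1 n x3 x4 → (con 1 ⊕ x1 ⊛ 6000000 ⊑ n) ∷ (n ⊑ x3 ⊛ 3000000) ∷ (x3 ⊑ x1 ⊕ x4) ∷ [] ⊢ n ⊑ x4 ⊛ 6000000) 0 (1 ∷ 2 ∷ 6000000 ∷ [])

module CaseOne {n} (T : Graph n) (ordering : ∀ root → Ordering T root)
  (cls : Fin n → Bool) (bipartite : ∀ u v → Adj T u v → cls v ≡ not (cls u))
  (nb : Fin n → Fin n) (Adj-nb : ∀ v → Adj T v (nb v)) {N} (G : ColouredKN N) where
  open Trees T cls bipartite nb Adj-nb
  open Host G

  module _ (root : Fin n) (d : Fin N) (b : Colour) {U₁ U₂ : Fin N → Set} (U₁? : Decidable U₁) (U₂? : Decidable U₂)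
    (U₁∩U₂ : ∀ x → U₁ x → U₂ x → ⊥) (m Δ : ℕ) (degree≤Δ : ∀ v → # (adj? T v) ≤ Δ)
    (size₁ : n ≤ # U₁? + m) (size₂ : # (class? false) ≤ # U₂? + m)
    (missᵇ : ∀ x → U₁ x → # (λ y → U₁? y ×-dec miss? b x y) ≤ m)
    (missʳ : ∀ x → U₁ x → # (λ y → U₂? y ×-dec miss? (opp b) x y) ≤ m)
    (missʳ′ : ∀ x → U₂ x → # (λ y → U₁? y ×-dec miss? (opp b) x y) ≤ m)
    (sizeᴺ : n + # (class? false) ≤ N + 1) (classes : # (class? true) + # (class? false) ≡ n)
    (m-small : m * 10000000000000000000000000000000000 ≤ n) (Δ-small : Δ * 10000000000 ≤ n)
    (1≤m : 1 ≤ m) (larger : # (class? false) ≤ # (class? true)) (wide : n ≤ # (class? false) * 1000000) where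

    private
      O = ordering root
      module R = Rooted T O
      D = hub-threshold
      H? = R.hub? D
      calm? = R.calm? D

      hubs-bound : # H? * 100000000 ≤ n
      hubs-bound = ≤-trans (≤-reflexive (cong (# H? *_) (sym hub-threshold-value))) (Hubs.hubs-few T O D)

      D*≡ : ∀ x → D * x ≡ x * 100000000
      D*≡ x = trans (*-comm D x) (cong (x *_) hub-threshold-value)

      1≤D : 1 ≤ D
      1≤D = estimate-31 D (≤-reflexive (sym hub-threshold-value))

      q = n ∸ # U₁?

      q≤m : q ≤ m
      q≤m = ≤-trans (∸-monoˡ-≤ (# U₁?) size₁) (≤-reflexive (m+n∸m≡n (# U₁?) m))

      q-sound : q + # U₁? ≤ n ⊎ q ≡ 0
      q-sound with ≤-total n (# U₁?)
      ... | inj₁ le = inj₂ (m≤n⇒m∸n≡0 le)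
      ... | inj₂ ge = inj₁ (≤-reflexive (m∸n+n≡m ge))

      module WithCores (κ : Bool) (g k : ℕ) (k≤ : k * 1000000000 ≤ g) (k> : g < k * 1000000000 + 1000000000)
        (g> : n < g * 100000000000000000000000 + 100000000000000000000000) (core : Fin n → Bool)
        (core-calm : ∀ c → core c ≡ true → R.Calm D c × cls c ≡ κ)
        (core-apart : ∀ c c′ → core c ≡ true → core c′ ≡ true → Cores.Sharing T O D c c′ → c ≡ c′) (size : # (∈? core) ≡ g) where

        -- With D = 10⁸ and k about g/10⁹, the at most g D² m unfriendly pairs allow at most m ·
        -- 10²⁵ useless vertices.
        Bad = m * 10000000000000000000000000

        room₁ : # H? + 1 * m ≤ # U₁?
        room₁ = estimate-32 (# H?) n (# U₁?) m hubs-bound size₁ m-small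

        room₂ : # (∈? core) * (D * (D * m)) < suc Bad * suc k
        room₂ = ≤-<-trans (≤-reflexive (cong₂ _*_ size (trans (D*≡ (D * m)) (trans (cong (_* 100000000) (D*≡ m)) (*-assoc m 100000000 100000000)))))
          (scaled-product g k m 1000000000 10000000000000000 10000000000000000000000000 refl k>)

        room₃ : q + D * k ≤ # (∈? core)
        room₃ = estimate-33 (D * k) k g (# (∈? core)) q m n (≤-reflexive (D*≡ k)) (≤-reflexive (sym size)) k≤ q≤m 1≤m m-small g>

        -- The surplus t₂/2, at least n/(2 · 10⁶), absorbs the hubs, the neighbours of filled cores
        -- and the useless vertices.
        room₄ : (# (class? true) + # H? + q * D + Bad) * 2 + # (class? false) ≤ # U₁? * 2
        room₄ = estimate-34 (q * D) q m (# H?) n (# U₁?) (# (class? true)) (# (class? false)) (≤-reflexive (cong (q *_) hub-threshold-value)) q≤m hubs-bound size₁ (≤-reflexive classes) wide m-small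

        room₅ : D * Δ * 3 < # (class? true)
        room₅ = estimate-35 (D * Δ) Δ n (# (class? false)) (# (class? true)) m (≤-reflexive (D*≡ Δ)) Δ-small larger (≤-reflexive (sym classes)) 1≤m m-small

        room₇ : D * m + m + q < # (∈? core)
        room₇ = estimate-36 (D * m) m g (# (∈? core)) q n (≤-reflexive (D*≡ m)) (≤-reflexive (sym size)) q≤m 1≤m m-small g>

        copy : MonoCopy G T
        copy = with-hubs (Spread.hubs-embed T O cls bipartite D κ core (λ c → proj₁ ∘ core-calm c) (λ c → proj₂ ∘ core-calm c) core-apart G b U₁? m missᵇ d room₁)
          where
          with-hubs : (∃ λ f → (∀ v → R.Hub D v → U₁ (f v)) × Embed.Placed G (adj? T) (Adj-sym T) (λ _ _ → b) (λ _ _ → refl) (R.Hub D) f) → MonoCopy G T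
          with-hubs (f , f∈U , placed) = Spread.spread-copy T O cls bipartite D κ core (λ c → proj₁ ∘ core-calm c) (λ c → proj₂ ∘ core-calm c) core-apart G b U₁? m missᵇ
              d q k Bad Δ degree≤Δ 1≤D q-sound (m≤n+m∸n n (# U₁?))
            room₁ room₂ room₃ room₄ room₅ sizeᴺ room₇ f f∈U placed

      module _ (few-leaves : # (leaf? false) ≤ m * 8) where

        -- Most of the at least n/10⁶ vertices of the second class are nonleaves, and at most n/10⁸
        -- hubs can account for only a small part of them.
        calm-many : n ≤ # calm? * 3000000
        calm-many = estimate-37 (# (leaf? false)) m n (# (class? false)) (# H?) (# nonleaf?) (# calm?) few-leaves wide hubs-bound m-small (Hubs.nonleaves-few T O D) (#-cover (class? false) (leaf? false) nonleaf? cases)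
          where
          nonleaf? : Decidable (λ v → 2 ≤ R.deg′ v)
          nonleaf? v = 2 ≤? R.deg′ v
          cases : ∀ v → cls v ≡ false → Leaf false v ⊎ 2 ≤ R.deg′ v
          cases v p with degree′ v ≤? 1
          ... | yes le = inj₁ (p , le)
          ... | no ≰ = inj₂ (≰⇒> ≰)

        calmᶜ? : ∀ κ → Decidable (λ v → R.Calm D v × cls v ≡ κ)
        calmᶜ? κ v = calm? v ×-dec class? κ v

        -- Taking all cores from one class makes them pairwise nonadjacent. About n/10²³ cores need
        -- some n/10⁷ calm vertices of that class, which is below the available n/(6 · 10⁶).
        from-class : ∀ κ → n ≤ # (calmᶜ? κ) * 6000000 → MonoCopy G T
        from-class κ many = with-sizes (quotient n 100000000000000000000000)
          where
          with-cores : ∀ g → g * 100000000000000000000000 ≤ n → n < g * 100000000000000000000000 + 100000000000000000000000 →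
            (∃ λ k → k * 1000000000 ≤ g × g < k * 1000000000 + 1000000000) → CoreSelection.Selection T O D (calmᶜ? κ) (λ _ → proj₁) g → MonoCopy G T
          with-cores g g≤ g> (k , k≤ , k>) (core , sound , apart , size) = WithCores.copy κ g k k≤ k> g> core sound apart size
          with-sizes : (∃ λ g → g * 100000000000000000000000 ≤ n × n < g * 100000000000000000000000 + 100000000000000000000000) → MonoCopy G T
          with-sizes (g , g≤ , g>) = with-cores g g≤ g> (quotient g 1000000000) (CoreSelection.select T O D (calmᶜ? κ) (λ _ → proj₁) g room)
            where
            room : g * (1 + D * D) ≤ # (calmᶜ? κ)
            room = ≤-trans (≤-reflexive (cong (g *_) (cong (1 +_) (trans (D*≡ D) (cong (_* 100000000) hub-threshold-value)))))
              (estimate-38 g n (# (calmᶜ? κ)) g≤ many)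

        spread-out : MonoCopy G T
        spread-out with n ≤? # (calmᶜ? true) * 6000000
        ... | yes le = from-class true le
        ... | no ≰ = from-class false (estimate-39 (# (calmᶜ? true)) n (# calm?) (# (calmᶜ? false)) (≰⇒> ≰) calm-many (#-cover calm? (calmᶜ? true) (calmᶜ? false) cases))
          where
          cases : ∀ v → R.Calm D v → (R.Calm D v × cls v ≡ true) ⊎ (R.Calm D v × cls v ≡ false)
          cases v z with cls v
          ... | true = inj₁ (z , refl)
          ... | false = inj₂ (z , refl)

    case-one : MonoCopy G T
    case-one with m * 8 <? # (leaf? false)
    ... | yes many = LeafTrick.leaf-trick T ordering cls bipartite nb Adj-nb G root d b U₁? U₂? U₁∩U₂ m size₁ size₂ missᵇ missʳ missʳ′ sizeᴺ many
    ... | no few = spread-out (≮⇒≥ few)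

-- A small second class

estimate-40 = linear 6 (λ x1 x2 d x4 x5 x6 → (x1 ⊑ x2) ∷ (x2 ⊕ d ⊕ con 1 ⊑ x4) ∷ (x4 ⊑ x5 ⊕ x6) ∷ (x6 ⊑ con 1) ∷ [] ⊢ x1 ⊕ (d ⊕ con 0) ⊑ x5) 0 (1 ∷ 1 ∷ 1 ∷ 1 ∷ [])

module Bridge {n} (T : Graph n) (ordering : ∀ root → Ordering T root)
  (cls : Fin n → Bool) (bipartite : ∀ u v → Adj T u v → cls v ≡ not (cls u))
  {N} (G : ColouredKN N) where
  open Host G

  -- The vertex v₀ is placed at w. Its neighbours in P go to prescribed neighbours of w, and the
  -- others to neighbours of w in the cell s₁; the rest of the tree is then embedded greedily.
  bridge : ∀ v₀ c (side : Fin n → Bool) {A : Bool → Fin N → Set} (A? : ∀ s y → Dec (A s y)) → (∀ x → A true x → A false x → ⊥) →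
    ∀ w s₁ {P : Fin n → Set} (P? : Decidable P) (h : Fin n → Fin N) →
    (∀ v → P v → A (not s₁) (h v) × Edge c w (h v)) → InjectiveOn P h → (∀ v → P v → side v ≡ not s₁) →
    (∀ v → Adj T v₀ v → ¬ P v → side v ≡ s₁) → ∀ {Δ} → (∀ v → # (adj? T v) ≤ Δ) →
    Δ ≤ # (λ y → A? s₁ y ×-dec edge? c w y) → ∀ d →
    (∀ u v x → Adj T u v → u ≢ v₀ → v ≢ v₀ → A (side u) x → # (λ y → A? (side v) y ×-dec miss? c x y) ≤ d) →
    (∀ s → # (λ v → side v B.≟ s) + d + 1 ≤ # (A? s)) → MonoCopy G T
  bridge v₀ c side {A} A? cells-disjoint w s₁ {P} P? h h∈ h-inj side-P side-other {Δ} degree≤Δ many d few room = finish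
    where
    open Ordering (ordering v₀)
    Other : Fin n → Set
    Other v = Adj T v₀ v × ¬ P v
    other? : Decidable Other
    other? v = adj? T v₀ v ×-dec ¬? (P? v)
    near? : Decidable (λ y → A s₁ y × Edge c w y)
    near? y = A? s₁ y ×-dec edge? c w y
    opaque
      others-placed : ∃ λ g → (∀ v → Other v → A s₁ (g v) × Edge c w (g v)) × InjectiveOn Other g
      others-placed = inject other? near? w (≤-trans (≤-trans (#-mono other? (adj? T v₀) λ _ → proj₁) (degree≤Δ v₀)) many)
    g : Fin n → Fin N
    g = proj₁ others-placed
    S : Fin n → Set
    S v = v ≡ v₀ ⊎ Adj T v₀ v
    S? : Decidable S
    S? v = (v F.≟ v₀) ⊎-dec adj? T v₀ v
    f₀ : Fin n → Fin N
    f₀ v with v F.≟ v₀ | P? v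
    ... | yes _ | _ = w
    ... | no _ | yes _ = h v
    ... | no _ | no _ = g v
    -- `w` may lie inside a cell. It is reserved for `v₀`, and the vertex that the cell thereby
    -- loses is the summand 1 in `room`.
    K : Fin n → Fin N → Set
    K v y = (v ≡ v₀ × y ≡ w) ⊎ (v ≢ v₀ × (A (side v) y × y ≢ w))
    K? : ∀ v y → Dec (K v y)
    K? v y = ((v F.≟ v₀) ×-dec (y F.≟ w)) ⊎-dec (¬? (v F.≟ v₀) ×-dec (A? (side v) y ×-dec ¬? (y F.≟ w)))
    data Start (v : Fin n) : Set where
      centre : v ≡ v₀ → f₀ v ≡ w → Start v
      listed : v ≢ v₀ → P v → Adj T v₀ v → f₀ v ≡ h v → Start v
      free   : v ≢ v₀ → Other v → f₀ v ≡ g v → Start v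
    start : ∀ v → S v → Start v
    start v s with v F.≟ v₀ | P? v in eq
    start v s | yes refl | _ = centre refl (value refl)
      where
      value : ∀ {v} → v ≡ v₀ → f₀ v ≡ w
      value {v} eq with v F.≟ v₀ | P? v
      ... | yes _ | _ = refl
      ... | no ne | _ = contradiction eq ne
    start v (inj₁ eq) | no ne | _ = contradiction eq ne
    start v (inj₂ e) | no ne | yes p = listed ne p e value
      where
      value : f₀ v ≡ h v
      value with v F.≟ v₀ | P? v
      ... | yes eq | _ = contradiction eq ne
      ... | no _ | yes _ = refl
      ... | no _ | no ¬p = contradiction p ¬p
    start v (inj₂ e) | no ne | no ¬p = free ne (e , ¬p) value
      where
      value : f₀ v ≡ g v
      value with v F.≟ v₀ | P? v
      ... | yes eq | _ = contradiction eq ne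
      ... | no _ | yes p = contradiction p ¬p
      ... | no _ | no _ = refl
    open Embed G (adj? T) (Adj-sym T) (λ _ _ → c) (λ _ _ → refl)
    f₀∈K : ∀ v → S v → K v (f₀ v)
    f₀∈K v s with start v s
    ... | centre eq eq′ = inj₁ (eq , eq′)
    ... | listed ne p e eq = inj₂ (ne , subst (λ y → A (side v) y × y ≢ w) (sym eq)
            (subst (λ s → A s (h v)) (sym (side-P v p)) (proj₁ (h∈ v p)) , λ eq′ → proj₁ (proj₂ (h∈ v p)) (sym eq′)))
    ... | free ne o eq = inj₂ (ne , subst (λ y → A (side v) y × y ≢ w) (sym eq)
            (subst (λ s → A s (g v)) (sym (side-other v (proj₁ o) (proj₂ o))) (proj₁ g∈) , λ eq′ → proj₁ (proj₂ g∈) (sym eq′)))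
      where g∈ = proj₁ (proj₂ others-placed) v o
    Good : Fin n → Fin n → Fin N → Fin N → Set
    Good u v x y = x ≢ y × (Adj T u v → col G x y ≡ c)
    good-sym : ∀ {u v x y} → Good u v x y → Good v u y x
    good-sym {x = x} {y} (ne , p) = (λ eq → ne (sym eq)) , λ e → trans (symm G y x) (p (Adj-sym T e))
    edge-good : ∀ {u v x y} → Edge c x y → Good u v x y
    edge-good (ne , eq) = ne , λ _ → eq
    siblings : ∀ {u v} → Adj T v₀ u → Adj T v₀ v → ¬ Adj T u v
    siblings {u} {v} e e′ e″ = self (trans (sym (bipartite u v e″)) (trans (bipartite v₀ v e′) (sym (bipartite v₀ u e))))
      where
      self : ∀ {x} → not x ≢ x
      self {true} ()
      self {false} ()
    apart : ∀ s x y → A (not s) x → A s y → x ≢ y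
    apart true x y p q refl = cells-disjoint x q p
    apart false x y p q refl = cells-disjoint x p q
    listed-free : ∀ u v → P u → Adj T v₀ u → Other v → Good u v (h u) (g v)
    listed-free u v p e o = apart s₁ (h u) (g v) (proj₁ (h∈ u p)) (proj₁ (proj₁ (proj₂ others-placed) v o)) , λ e′ → contradiction e′ (siblings e (proj₁ o))
    placed₀ : Placed S f₀
    placed₀ u v p q u≢v with start u p | start v q
    ... | centre refl _ | centre refl _ = contradiction refl u≢v
    ... | centre refl x | listed _ pv _ y = subst₂ (Good u v) (sym x) (sym y) (edge-good (proj₂ (h∈ v pv)))
    ... | centre refl x | free _ o y = subst₂ (Good u v) (sym x) (sym y) (edge-good (proj₂ (proj₁ (proj₂ others-placed) v o)))
    ... | listed _ pu _ x | centre refl y = subst₂ (Good u v) (sym x) (sym y) (good-sym {v} {u} (edge-good (proj₂ (h∈ u pu))))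
    ... | listed _ pu e x | listed _ pv e′ y = subst₂ (Good u v) (sym x) (sym y) ((λ eq → u≢v (h-inj u v pu pv eq)) , λ e″ → contradiction e″ (siblings e e′))
    ... | listed _ pu e x | free _ o y = subst₂ (Good u v) (sym x) (sym y) (listed-free u v pu e o)
    ... | free _ o x | centre refl y = subst₂ (Good u v) (sym x) (sym y) (good-sym {v} {u} (edge-good (proj₂ (proj₁ (proj₂ others-placed) u o))))
    ... | free _ o x | listed _ pv e y = subst₂ (Good u v) (sym x) (sym y) (good-sym {v} {u} (listed-free v u pv e o))
    ... | free _ o x | free _ o′ y = subst₂ (Good u v) (sym x) (sym y) ((λ eq → u≢v (proj₂ (proj₂ others-placed) u v o o′ eq)) , λ e″ → contradiction e″ (siblings (proj₁ o) (proj₁ o′)))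
    Same : Fin n → Fin n → Set
    Same u v = (u ≡ v₀ × v ≡ v₀) ⊎ ((u ≢ v₀ × v ≢ v₀) × side u ≡ side v)
    same? : ∀ u v → Dec (Same u v)
    same? u v = ((u F.≟ v₀) ×-dec (v F.≟ v₀)) ⊎-dec ((¬? (u F.≟ v₀) ×-dec ¬? (v F.≟ v₀)) ×-dec (side u B.≟ side v))
    same-refl : ∀ v → Same v v
    same-refl v with v F.≟ v₀
    ... | yes eq = inj₁ (eq , eq)
    ... | no ne = inj₂ ((ne , ne) , refl)
    same-cell : ∀ s t {x} → A s x → A t x → s ≡ t
    same-cell true true _ _ = refl
    same-cell true false a a′ = ⊥-elim (cells-disjoint _ a a′)
    same-cell false true a a′ = ⊥-elim (cells-disjoint _ a′ a)
    same-cell false false _ _ = refl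
    cells : ∀ u v x → ¬ Same u v → K u x → K v x → ⊥
    cells u v x ¬s (inj₁ (p , _)) (inj₁ (q , _)) = ¬s (inj₁ (p , q))
    cells u v x ¬s (inj₁ (_ , eq)) (inj₂ (_ , _ , ne)) = ne eq
    cells u v x ¬s (inj₂ (_ , _ , ne)) (inj₁ (_ , eq)) = ne eq
    cells u v x ¬s (inj₂ (p , a , _)) (inj₂ (q , a′ , _)) = ¬s (inj₂ ((p , q) , same-cell (side u) (side v) a a′))
    few′ : ∀ u v x → S u ⊎ ¬ S u → ¬ S v → Adj T u v → K u x → # (λ y → K? v y ×-dec miss? c x y) ≤ d
    few′ u v x _ ¬s e (inj₁ (refl , _)) = contradiction (inj₂ e) ¬s
    few′ u v x _ ¬s e (inj₂ (ne , a , _)) = ≤-trans (#-mono _ (λ y → A? (side v) y ×-dec miss? c x y)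
      λ { y (inj₁ (eq , _) , _) → contradiction (inj₁ eq) ¬s ; y (inj₂ (_ , a′ , _) , ms) → a′ , ms })
      (few u v x e ne (λ eq → ¬s (inj₁ eq)) a)
    -- The order is rooted at `v₀`, the parent of all its neighbours, so any other edge at such a
    -- neighbour goes upward in rank. Placing these neighbours in advance therefore creates no
    -- second back neighbour.
    earlier-than : ∀ u v → ¬ S v → S u ⊎ (¬ S u × rank u < rank v) → Adj T u v → rank u < rank v
    earlier-than u v ¬s (inj₂ (_ , lt)) e = lt
    earlier-than u v ¬s (inj₁ (inj₁ refl)) e = contradiction (inj₂ e) ¬s
    earlier-than u v ¬s (inj₁ (inj₂ e′)) e with <-cmp (rank u) (rank v)
    ... | tri< lt _ _ = lt
    ... | tri≈ _ eq _ = contradiction e (subst (λ x → ¬ Adj T u x) (rank-injective eq) (Adj-irrefl T))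
    ... | tri> _ _ gt = contradiction (inj₁ (earlier-unique u e (Adj-sym T e′) gt below)) ¬s
      where
      below : rank v₀ < rank u
      below = ≤-trans (s≤s (≤-trans (≤-reflexive rank-root) z≤n)) gt
    back : ∀ v → ¬ S v → # (λ u → (S? u ⊎-dec (¬? (S? u) ×-dec (rank u <? rank v))) ×-dec adj? T u v) ≤ 1
    back v ¬s = #-unique _ λ { i j (p , e) (q , e′) →
      earlier-unique v (Adj-sym T e) (Adj-sym T e′) (earlier-than i v ¬s p e) (earlier-than j v ¬s q e′) }
    room′ : ∀ v → ¬ S v → # (λ u → (S? u ⊎-dec ¬? (S? u)) ×-dec same? u v) + 1 * d ≤ # (K? v)
    room′ v ¬s = estimate-40 (# cell?) (# (λ u → side u B.≟ side v)) d (# (A? (side v))) (# (K? v)) (# (λ y → y F.≟ w)) (#-mono cell? (λ u → side u B.≟ side v) (λ { u (_ , inj₁ (_ , eq)) → contradiction (inj₁ eq) ¬s ; u (_ , inj₂ (_ , eq)) → eq })) (room (side v)) (#-cover (A? (side v)) (K? v) (λ y → y F.≟ w) cases) (#-unique (λ y → y F.≟ w) (λ _ _ p q → trans p (sym q)))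
      where
      cell? : Decidable (λ u → (S u ⊎ ¬ S u) × Same u v)
      cell? u = (S? u ⊎-dec ¬? (S? u)) ×-dec same? u v
      cases : ∀ y → A (side v) y → K v y ⊎ y ≡ w
      cases y a with y F.≟ w
      ... | yes eq = inj₂ eq
      ... | no ne = inj₁ (inj₂ ((λ eq → ¬s (inj₁ eq)) , a , ne))
    opaque
      embedding : ∃ λ f → (∀ u → S u → f u ≡ f₀ u) × (∀ u → S u ⊎ ¬ S u → K u (f u)) × Placed (λ u → S u ⊎ ¬ S u) f
      embedding = embed {K = K} K? {S = S} {Q = λ v → ¬ S v} S? (¬? ∘ S?) (λ v s ¬s → ¬s s) rank rank-injective
        {Same = Same} same? same-refl cells 1 d f₀ f₀∈K placed₀ few′ back room′
    decided : ∀ u → S u ⊎ ¬ S u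
    decided u with S? u
    ... | yes s = inj₁ s
    ... | no ¬s = inj₂ ¬s
    finish : MonoCopy G T
    finish = c , proj₁ embedding , (λ {u} {v} → injective u v) , λ u v e → proj₂ (placed u v λ { refl → Adj-irrefl T e }) e
      where
      placed : ∀ u v → u ≢ v → proj₁ embedding u ≢ proj₁ embedding v × (Adj T u v → col G (proj₁ embedding u) (proj₁ embedding v) ≡ c)
      placed u v = proj₂ (proj₂ (proj₂ embedding)) u v (decided u) (decided v)
      injective : ∀ u v → proj₁ embedding u ≡ proj₁ embedding v → u ≡ v
      injective u v eq with u F.≟ v
      ... | yes u≡v = u≡v
      ... | no u≢v = contradiction eq (proj₁ (placed u v u≢v))

-- Along an edge the first two terms are kept and the class changes.
side-flip : ∀ s β μ x x₀ → s xor (β xor (μ ∧ not (not x xor x₀))) ≡ (s xor (β xor (μ ∧ not (x xor x₀)))) xor μ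
side-flip true true true true true = refl
side-flip true true true true false = refl
side-flip true true true false true = refl
side-flip true true true false false = refl
side-flip true true false x x₀ = refl
side-flip true false true true true = refl
side-flip true false true true false = refl
side-flip true false true false true = refl
side-flip true false true false false = refl
side-flip true false false x x₀ = refl
side-flip false true true true true = refl
side-flip false true true true false = refl
side-flip false true true false true = refl
side-flip false true true false false = refl
side-flip false true false x x₀ = refl
side-flip false false true true true = refl
side-flip false false true true false = refl
side-flip false false true false true = refl
side-flip false false true false false = refl
side-flip false false false x x₀ = refl

side-opposite : ∀ s β μ x₀ → s xor (β xor (μ ∧ not (not x₀ xor x₀))) ≡ s xor β
side-opposite s true true true = refl
side-opposite s true true false = refl
side-opposite s true false x₀ = refl
side-opposite s false true true = refl
side-opposite s false true false = refl
side-opposite s false false x₀ = refl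

xor-cancel : ∀ s β φ t → s xor (β xor φ) ≡ t → β ≡ (s xor t) xor φ
xor-cancel true true true .true refl = refl
xor-cancel true true false .false refl = refl
xor-cancel true false true .false refl = refl
xor-cancel true false false .true refl = refl
xor-cancel false true true .false refl = refl
xor-cancel false true false .true refl = refl
xor-cancel false false φ .φ refl = self φ
  where
  self : ∀ φ → false ≡ φ xor φ
  self true = refl
  self false = refl

estimate-41 = linear 7 (λ x1 x2 x3 a n d x7 → (x1 ⊑ x2 ⊕ x3) ∷ (x2 ⊛ 3 ⊑ a ⊛ 3 ⊕ n) ∷ (a ⊛ 3 ⊕ n ⊕ x3 ⊛ 3 ⊕ d ⊛ 3 ⊕ con 3 ⊑ x7 ⊛ 3) ∷ [] ⊢ x1 ⊕ d ⊕ con 1 ⊑ x7) 2 (3 ∷ 1 ∷ 1 ∷ [])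

estimate-42 = linear 8 (λ x1 x2 x3 a x5 n d x8 → (x1 ⊑ x2 ⊕ x3) ∷ (a ⊑ x5) ∷ (x5 ⊕ x2 ⊑ n) ∷ (n ⊕ x3 ⊕ d ⊕ con 1 ⊑ x8 ⊕ a) ∷ [] ⊢ x1 ⊕ d ⊕ con 1 ⊑ x8) 0 (1 ∷ 1 ∷ 1 ∷ 1 ∷ [])

module BranchBridge {n} (T : Graph n) (ordering : ∀ root → Ordering T root)
  (cls : Fin n → Bool) (bipartite : ∀ u v → Adj T u v → cls v ≡ not (cls u))
  {root} (O : Ordering T root) {N} (G : ColouredKN N) where
  open Host G
  open Rooted T O
  open Branching T O

  class₂? : Decidable (λ v → cls v ≡ false)
  class₂? v = cls v B.≟ false

  -- Some branches below v₀ are moved to the other cell; with μ = true the copy alternates between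
  -- the cells, otherwise it changes the cell only at v₀.
  branch-bridge : ∀ v₀ → (∀ x → Child x v₀ → # (desc? x) * 3 < n) → ∀ c {A : Bool → Fin N → Set} (A? : ∀ s y → Dec (A s y)) →
    (∀ x → A true x → A false x → ⊥) → ∀ μ d → (∀ s x → A s x → # (λ y → A? (s xor μ) y ×-dec miss? c x y) ≤ d) →
    ∀ w s₁ {S : Fin n → Set} (S? : Decidable S) (h : Fin n → Fin N) → (∀ v → S v → Child v v₀) →
    (∀ v → S v → A (not s₁) (h v) × Edge c w (h v)) → InjectiveOn S h →
    ∀ {Δ} → (∀ v → # (adj? T v) ≤ Δ) → Δ ≤ # (λ y → A? s₁ y ×-dec edge? c w y) →
    ∀ a → a ≤ # (below? S?) → (∀ s → n + # class₂? + d + 1 ≤ # (A? s) + a) →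
    (∀ s → a * 3 + n + # class₂? * 3 + d * 3 + 3 ≤ # (A? s) * 3) → MonoCopy G T
  branch-bridge v₀ small c {A} A? cells-disjoint μ d few w s₁ {S} S? h S⇒child h∈ h-inj {Δ} degree≤Δ many a big room₁ room₂ =
    with-trimmed (trim S? (λ x s → small x (S⇒child x s)) a big)
    where
    with-trimmed : (∃ λ t → let S′? = λ x → S? x ×-dec (toℕ x <? t) in a ≤ # (below? S′?) × # (below? S′?) * 3 ≤ a * 3 + n) → MonoCopy G T
    with-trimmed (t , enough , few-moved) = Bridge.bridge T ordering cls bipartite G v₀ c side A? cells-disjoint w s₁ S′? h (λ v s → h∈ v (proj₁ s))
        (λ u v p q → h-inj u v (proj₁ p) (proj₁ q)) side-S side-other degree≤Δ many d few′ room
      where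
      S′? : Decidable (λ x → S x × toℕ x < t)
      S′? x = S? x ×-dec (toℕ x <? t)
      moved? : Decidable (Below S′?)
      moved? = below? S′?
      moved : Fin n → Bool
      moved v = ⌊ moved? v ⌋
      moved-true : ∀ v → Below S′? v → moved v ≡ true
      moved-true v b with moved? v
      ... | yes _ = refl
      ... | no ¬b = contradiction b ¬b
      moved-false : ∀ v → ¬ Below S′? v → moved v ≡ false
      moved-false v ¬b with moved? v
      ... | yes b = contradiction b ¬b
      ... | no _ = refl
      moved-sound : ∀ v → moved v ≡ true → Below S′? v
      moved-sound v eq with moved? v
      ... | yes b = b
      moved-unsound : ∀ v → moved v ≡ false → ¬ Below S′? v
      moved-unsound v eq with moved? v
      ... | no ¬b = ¬b
      -- The last term vanishes on the class opposite to `v₀`, so neighbours of `v₀` lie in cell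
      -- `s₁` unless moved. For true `μ` it flips the cell on the class of `v₀`, which makes the
      -- copy alternate along edges that avoid `v₀`.
      side : Fin n → Bool
      side v = s₁ xor (moved v xor (μ ∧ not (cls v xor cls v₀)))
      side-neighbour : ∀ v → Adj T v₀ v → side v ≡ s₁ xor moved v
      side-neighbour v e = trans (cong (λ x → s₁ xor (moved v xor (μ ∧ not (x xor cls v₀)))) (bipartite v₀ v e)) (side-opposite s₁ (moved v) μ (cls v₀))
      side-S : ∀ v → S v × toℕ v < t → side v ≡ not s₁
      side-S v s = trans (side-neighbour v (Adj-sym T (proj₁ (S⇒child v (proj₁ s)))))
        (trans (cong (s₁ xor_) (moved-true v (v , s , here))) (xor-true s₁))
        where
        xor-true : ∀ s → s xor true ≡ not s
        xor-true true = refl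
        xor-true false = refl
      side-other : ∀ v → Adj T v₀ v → ¬ (S v × toℕ v < t) → side v ≡ s₁
      side-other v e ¬s = trans (side-neighbour v e) (trans (cong (s₁ xor_) (moved-false v unmoved)) (xor-false s₁))
        where
        xor-false : ∀ s → s xor false ≡ s
        xor-false true = refl
        xor-false false = refl
        unmoved : ¬ Below S′? v
        unmoved (x , s , dx) with neighbour e
        ... | inj₂ child = ¬s (subst (λ y → S y × toℕ y < t) (branch-unique (S⇒child x (proj₁ s)) child dx here) s)
        ... | inj₁ (_ , lt) = <-irrefl refl (<-trans (proj₂ (S⇒child x (proj₁ s))) (≤-<-trans (desc-rank dx) lt))
      moved-down : ∀ u v → Child u v → u ≢ v₀ → v ≢ v₀ → moved u ≡ moved v
      moved-down u v uv u≢ v≢ with moved? u | moved? v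
      ... | yes _ | yes _ = refl
      ... | no _ | no _ = refl
      ... | no ¬b | yes (x , s , dx) = contradiction (x , s , there uv dx) ¬b
      ... | yes (x , s , here) | no ¬b = contradiction (parent-unique uv (S⇒child x (proj₁ s))) v≢
      ... | yes (x , s , there uv′ dx) | no ¬b = contradiction (x , s , subst (Desc x) (parent-unique uv′ uv) dx) ¬b
      moved-edge : ∀ u v → Adj T u v → u ≢ v₀ → v ≢ v₀ → moved u ≡ moved v
      moved-edge u v e u≢ v≢ with neighbour e
      ... | inj₁ uv = moved-down u v uv u≢ v≢
      ... | inj₂ vu = sym (moved-down v u vu v≢ u≢)
      side-edge : ∀ u v → Adj T u v → u ≢ v₀ → v ≢ v₀ → side v ≡ side u xor μ
      side-edge u v e u≢ v≢ = trans (cong₂ (λ m x → s₁ xor (m xor (μ ∧ not (x xor cls v₀)))) (sym (moved-edge u v e u≢ v≢)) (bipartite u v e))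
        (side-flip s₁ (moved u) μ (cls u) (cls v₀))
      few′ : ∀ u v x → Adj T u v → u ≢ v₀ → v ≢ v₀ → A (side u) x → # (λ y → A? (side v) y ×-dec miss? c x y) ≤ d
      few′ u v x e u≢ v≢ p = subst (λ s → # (λ y → A? s y ×-dec miss? c x y) ≤ d) (sym (side-edge u v e u≢ v≢)) (few (side u) x p)
      -- For first-class vertices the side determines whether they are moved. Besides second-class
      -- vertices a cell thus receives only moved or only unmoved vertices, and trimming bounds both
      -- kinds.
      room : ∀ s → # (λ v → side v B.≟ s) + d + 1 ≤ # (A? s)
      room s = by-value ((s₁ xor s) xor (μ ∧ not (true xor cls v₀))) refl
        where
        on-side? : Decidable (λ v → side v ≡ s)
        on-side? v = side v B.≟ s
        value : ∀ v → cls v ≡ true → side v ≡ s → moved v ≡ (s₁ xor s) xor (μ ∧ not (true xor cls v₀))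
        value v eq eq′ = xor-cancel s₁ (moved v) _ s (trans (cong (λ x → s₁ xor (moved v xor (μ ∧ not (x xor cls v₀)))) (sym eq)) eq′)
        split : ∀ {P : Fin n → Set} (P? : Decidable P) → (∀ v → cls v ≡ true → side v ≡ s → P v) → # on-side? ≤ # P? + # class₂?
        split {P} P? into = #-cover on-side? P? class₂? cases
          where
          cases : ∀ v → side v ≡ s → P v ⊎ cls v ≡ false
          cases v eq with cls v B.≟ true
          ... | yes t = inj₁ (into v t eq)
          ... | no ¬t = inj₂ (¬true ¬t)
            where
            ¬true : ∀ {x} → x ≢ true → x ≡ false
            ¬true {true} ne = contradiction refl ne
            ¬true {false} _ = refl
        by-value : ∀ β → (s₁ xor s) xor (μ ∧ not (true xor cls v₀)) ≡ β → # on-side? + d + 1 ≤ # (A? s)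
        by-value true eq = estimate-41 (# on-side?) (# moved?) (# class₂?) a n d (# (A? s)) (split moved? (λ v t p → moved-sound v (trans (value v t p) eq))) few-moved (room₂ s)
        by-value false eq = estimate-42 (# on-side?) (# (¬? ∘ moved?)) (# class₂?) a (# moved?) n d (# (A? s)) (split (¬? ∘ moved?) (λ v t p → moved-unsound v (trans (value v t p) eq))) enough (≤-reflexive (#-complement moved?)) (room₁ s)

-- Two cells and the failure of both bipartite embeddings

module ClassCounting {n} (T : Graph n) (ordering : ∀ root → Ordering T root)
  (cls : Fin n → Bool) (bipartite : ∀ u v → Adj T u v → cls v ≡ not (cls u))
  (nb : Fin n → Fin n) (Adj-nb : ∀ v → Adj T v (nb v)) (root : Fin n) where
  open Trees T cls bipartite nb Adj-nb
  open Rooted T (ordering root)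

  -- Each such vertex has a child, which lies in the second class, and parents are unique. When the
  -- second class is tiny, almost all first-class vertices are therefore leaves.
  nonleaves₁ : # (λ v → class? true v ×-dec ¬? (leaf? true v)) ≤ # (class? false)
  nonleaves₁ = #-injection _ (class? false) (λ v w → child? w v)
    (λ { v (p , nl) → let w , wv = nonleaf-child v (≰⇒> λ le → nl (p , le)) in
           w , trans (bipartite v w (Adj-sym T (proj₁ wv))) (cong not p) , wv })
    λ _ _ _ _ _ → parent-unique

estimate-43 = linear 5 (λ n x2 a d x5 → (n ⊛ 98 ⊑ x2 ⊛ 100) ∷ (con 1 ⊕ n ⊑ a ⊛ 10 ⊕ con 10) ∷ (d ⊛ 1000 ⊑ n) ∷ (con 1000000 ⊑ n) ∷ (x5 ⊛ 1000000 ⊑ n) ∷ [] ⊢ n ⊕ x5 ⊕ d ⊕ con 1 ⊑ x2 ⊕ a) 999999 (10000 ∷ 100000 ∷ 1000 ∷ 78999 ∷ 1 ∷ [])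

estimate-44 = linear 5 (λ n x2 a d x5 → (n ⊛ 98 ⊑ x2 ⊛ 100) ∷ (a ⊛ 10 ⊑ n) ∷ (d ⊛ 1000 ⊑ n) ∷ (con 1000000 ⊑ n) ∷ (x5 ⊛ 1000000 ⊑ n) ∷ [] ⊢ a ⊛ 3 ⊕ n ⊕ x5 ⊛ 3 ⊕ d ⊛ 3 ⊕ con 3 ⊑ x2 ⊛ 3) 999999 (30000 ∷ 300000 ∷ 3000 ∷ 1636997 ∷ 3 ∷ [])

estimate-45 = linear 5 (λ x1 x2 x3 n a → (x1 ⊑ x2 ⊕ x3) ∷ (x2 ⊑ con 1) ∷ (n ⊑ x1 ⊛ 3) ∷ (a ⊛ 10 ⊑ n) ∷ (con 1000000 ⊑ n) ∷ [] ⊢ a ⊑ x3) 29 (30 ∷ 30 ∷ 10 ∷ 3 ∷ 7 ∷ [])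

estimate-46 = linear 11 (λ n x2 x3 x4 x5 x6 x7 x8 x9 x10 Δ → (n ⊑ x2 ⊛ 3) ∷ (x2 ⊑ x3 ⊕ x4) ∷ (x4 ⊑ x5 ⊕ x6) ∷ (x5 ⊑ x3) ∷ (x6 ⊑ x7 ⊕ x8) ∷ (x7 ⊑ con 1) ∷ (x8 ⊑ x9 ⊕ x10) ∷ (x9 ⊑ Δ) ∷ (Δ ⊛ 10000000000 ⊑ n) ∷ (x3 ⊛ 1000000 ⊑ n) ∷ (con 1000000 ⊑ n) ∷ [] ⊢ n ⊑ x10 ⊛ 4) 7499999999 (10000000000 ∷ 30000000000 ∷ 30000000000 ∷ 30000000000 ∷ 30000000000 ∷ 30000000000 ∷ 30000000000 ∷ 30000000000 ∷ 3 ∷ 60000 ∷ 2499939997 ∷ [])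

estimate-47 = linear 8 (λ x1 x2 x3 x4 n x6 x7 d → (x1 ⊑ x2) ∷ (x2 ⊕ x3 ⊑ x4) ∷ (n ⊑ x3 ⊛ 4) ∷ (x4 ⊕ x6 ⊑ n) ∷ (n ⊛ 98 ⊑ x7 ⊛ 100) ∷ (d ⊛ 1000 ⊑ n) ∷ [] ⊢ x1 ⊕ (d ⊕ con 0) ⊑ x7) 97999 (98000 ∷ 98000 ∷ 24500 ∷ 98000 ∷ 751 ∷ 98 ∷ [])

estimate-48 = linear 5 (λ x1 x2 n x4 d → (x1 ⊑ x2) ∷ (x2 ⊛ 1000000 ⊑ n) ∷ (n ⊛ 98 ⊑ x4 ⊛ 100) ∷ (d ⊛ 1000 ⊑ n) ∷ [] ⊢ x1 ⊕ (d ⊕ con 0) ⊑ x4) 13999999 (14000000 ∷ 14 ∷ 143 ∷ 14000 ∷ [])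

estimate-49 = linear 4 (λ n x2 d a → (n ⊑ x2 ⊛ 4) ∷ (d ⊛ 1000 ⊑ n) ∷ (a ⊛ 10 ⊑ n) ∷ (con 1000000 ⊑ n) ∷ [] ⊢ con 1 ⊕ (d ⊛ 3 ⊕ a) ⊛ 2 ⊑ x2) 499 (125 ∷ 3 ∷ 100 ∷ 22 ∷ [])

estimate-50 = linear 9 (λ x1 x2 x3 x4 x5 x6 x7 n a → (x1 ⊑ x2 ⊕ x3) ∷ (x3 ⊑ x4) ∷ (x4 ⊕ x5 ⊑ x6) ∷ (x6 ⊕ x7 ⊑ n) ∷ (n ⊛ 98 ⊑ x1 ⊛ 100) ∷ (con 1 ⊕ n ⊑ a ⊛ 10 ⊕ con 10) ∷ (con 1000000 ⊑ n) ∷ [] ⊢ x5 ⊑ x2 ⊕ a) 99 (100 ∷ 100 ∷ 100 ∷ 100 ∷ 1 ∷ 10 ∷ 8 ∷ [])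

estimate-51 = linear 8 (λ N x2 x3 x4 x5 x6 x7 x8 → (N ⊑ x2 ⊕ x3) ∷ (x3 ⊑ x4 ⊕ x5) ∷ (x5 ⊑ x6) ∷ (x6 ⊕ x7 ⊑ x8) ∷ (con 1 ⊕ x2 ⊑ x7) ∷ (x8 ⊛ 2 ⊑ N ⊕ con 1) ∷ [] ⊢ x8 ⊑ x4) 0 (1 ∷ 1 ∷ 1 ∷ 1 ∷ 1 ∷ 1 ∷ [])

estimate-52 = linear 5 (λ x1 x2 n a x5 → (con 1 ⊕ x1 ⊑ x2 ⊛ 2) ∷ (n ⊑ x1 ⊛ 4) ∷ (a ⊛ 10 ⊑ n) ∷ (x2 ⊑ x5) ∷ [] ⊢ a ⊑ x5) 9 (5 ∷ 1 ∷ 1 ∷ 10 ∷ [])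

estimate-53 = linear 8 (λ x1 x2 x3 x4 x5 d n Δ → (x1 ⊑ x2 ⊕ x3) ∷ (x3 ⊑ x4 ⊕ x5) ∷ (x4 ⊑ con 1) ∷ (x5 ⊑ d) ∷ (n ⊛ 98 ⊑ x1 ⊛ 100) ∷ (d ⊛ 1000 ⊑ n) ∷ (Δ ⊛ 10000000000 ⊑ n) ∷ (con 1000000 ⊑ n) ∷ [] ⊢ Δ ⊑ x2) 9999999999 (10000000000 ∷ 10000000000 ∷ 10000000000 ∷ 10000000000 ∷ 100000000 ∷ 10000000 ∷ 1 ∷ 9789999999 ∷ [])

estimate-54 = linear 7 (λ x1 x2 x3 Δ x5 x6 n → (x1 ⊑ x2 ⊕ x3) ∷ (con 1 ⊕ x2 ⊑ Δ) ∷ (x3 ⊑ x5 ⊕ x6) ∷ (x5 ⊑ con 1) ∷ (n ⊛ 98 ⊑ x1 ⊛ 100) ∷ (Δ ⊛ 10000000000 ⊑ n) ∷ [] ⊢ Δ ⊑ x6) 99 (100 ∷ 979999999900 ∷ 100 ∷ 100 ∷ 1 ∷ 98 ∷ [])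

-- The hypotheses contradict each other; a large multiple of the contradiction yields the absurd
-- goal.
estimate-55 = linear 5 (λ x1 x2 x3 N x5 → (x1 ⊑ x2) ∷ (x1 ⊑ x3) ∷ (N ⊕ con 1 ⊑ x1 ⊛ 2) ∷ (x2 ⊕ x3 ⊑ x5) ∷ (x5 ⊑ N) ∷ [] ⊢ con 1 ⊕ N ⊑ N) 0 (2000000000000000000000000000000000000000000000000000000000000000000000 ∷ 2000000000000000000000000000000000000000000000000000000000000000000000 ∷ 2000000000000000000000000000000000000000000000000000000000000000000000 ∷ 2000000000000000000000000000000000000000000000000000000000000000000000 ∷ 2000000000000000000000000000000000000000000000000000000000000000000000 ∷ [])

module TwoCells {n} (T : Graph n) (ordering : ∀ root → Ordering T root)
  (cls : Fin n → Bool) (bipartite : ∀ u v → Adj T u v → cls v ≡ not (cls u))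
  (nb : Fin n → Fin n) (Adj-nb : ∀ v → Adj T v (nb v))
  (root : Fin n) {N} (G : ColouredKN N) (d₀ : Fin N) (b : Colour)
  {A : Bool → Fin N → Set} (A? : ∀ s y → Dec (A s y)) (disjoint : ∀ x → A true x → A false x → ⊥)
  {Δ : ℕ} (degree≤Δ : ∀ v → # (adj? T v) ≤ Δ) where
  open Trees T cls bipartite nb Adj-nb
  open Host G
  module R where
    open Rooted T (ordering root) public
    open Branching T (ordering root) public


  module _ (v₀ : Fin n) (small : ∀ c → R.Child c v₀ → # (R.desc? c) * 3 < n) (a d : ℕ)
    (big : n ≤ # (R.desc? v₀) * 3) (a≤ : a * 10 ≤ n) (a> : n < a * 10 + 10) (d-small : d * 1000 ≤ n)
    (sizes : ∀ s → n * 98 ≤ # (A? s) * 100) (narrow : # (class? false) * 1000000 ≤ n) (Δ-small : Δ * 10000000000 ≤ n)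
    (n-large : 1000000 ≤ n) (red-few : ∀ s x → A s x → # (λ y → A? (s xor true) y ×-dec miss? (opp b) x y) ≤ d) where

    -- With a about n/10 the moved branches contain between n/10 and n/10 + n/3 vertices, up to
    -- rounding. Either part together with the second class stays linearly below the 98n/100
    -- vertices of a cell.
    room₁ : ∀ s → n + # (class? false) + d + 1 ≤ # (A? s) + a
    room₁ s = estimate-43 n (# (A? s)) a d (# (class? false)) (sizes s) a> d-small n-large narrow

    room₂ : ∀ s → a * 3 + n + # (class? false) * 3 + d * 3 + 3 ≤ # (A? s) * 3
    room₂ s = estimate-44 n (# (A? s)) a d (# (class? false)) (sizes s) a≤ d-small n-large narrow

    children-below : a ≤ # (R.below? (λ c → R.child? c v₀))
    children-below = estimate-45 (# (R.desc? v₀)) (# (λ v → v F.≟ v₀)) (# (R.below? (λ c → R.child? c v₀))) n a (#-cover (R.desc? v₀) (λ v → v F.≟ v₀) (R.below? (λ c → R.child? c v₀)) cases) (#-unique (λ v → v F.≟ v₀) (λ _ _ p q → trans p (sym q))) big a≤ n-large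
      where
      cases : ∀ v → R.Desc v₀ v → v ≡ v₀ ⊎ R.Below (λ c → R.child? c v₀) v
      cases v dv with v F.≟ v₀
      ... | yes eq = inj₁ eq
      ... | no ne = inj₂ (R.desc-branch dv ne)

    -- Any branch at `v₀` may be moved here, and the copy alternates between the cells because the
    -- edges between them almost all have this colour.
    red-bridge : ∀ w → (∀ s → Δ ≤ # (λ y → A? s y ×-dec edge? (opp b) w y)) → MonoCopy G T
    red-bridge w many = with-images (inject (λ c → R.child? c v₀) (λ y → A? false y ×-dec edge? (opp b) w y) w
        (≤-trans (≤-trans (#-mono (λ c → R.child? c v₀) (adj? T v₀) λ c → Adj-sym T ∘ proj₁) (degree≤Δ v₀)) (many false)))
      where
      with-images : (∃ λ h → (∀ c → R.Child c v₀ → A false (h c) × Edge (opp b) w (h c)) × InjectiveOn (λ c → R.Child c v₀) h) → MonoCopy G T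
      with-images (h , h∈ , h-inj) = BranchBridge.branch-bridge T ordering cls bipartite (ordering root) G v₀ small (opp b) A? disjoint true d red-few w true (λ c → R.child? c v₀) h (λ _ → id)
        h∈ h-inj degree≤Δ (many true) a children-below room₁ room₂

    module _ (blue-few : ∀ s x → A s x → # (λ y → A? (s xor false) y ×-dec miss? b x y) ≤ d)
      (sizeᴺ : N + 1 ≡ # (class? true) * 2) (classes : # (class? true) + # (class? false) ≡ n) where

      -- Each of these leaves lies in the same branch at `v₀` as its neighbour. An edge from some
      -- vertex to the image of such a neighbour can therefore be charged to a branch, which
      -- converts a failed matching into branches of large total size.
      L : Fin n → Set
      L v = Leaf true v × ((R.Desc v₀ v × v ≢ v₀) × nb v ≢ v₀)

      L? : Decidable L
      L? v = leaf? true v ×-dec ((R.desc? v₀ v ×-dec ¬? (v F.≟ v₀)) ×-dec ¬? (nb v F.≟ v₀))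

      L-leaf : ∀ l → L l → Leaf true l
      L-leaf l = proj₁

      nb-kept : ∀ l → L l → ¬ L (nb l)
      nb-kept l p q = not-self (trans (sym (leaf-parent-class (proj₁ (proj₁ p)))) (proj₁ (proj₁ q)))

      L-branch : ∀ l → L l → ∃ λ c → R.Child c v₀ × (R.Desc c (nb l) × R.Desc c l)
      L-branch l (leaf , (dl , l≢) , nb≢) = above dl
        where
        above : R.Desc v₀ l → ∃ λ c → R.Child c v₀ × (R.Desc c (nb l) × R.Desc c l)
        above R.here = contradiction refl l≢
        above (R.there {u} lu du) with leaf-neighbour leaf (proj₁ lu)
        ... | refl = let c , cv , dc = R.desc-branch du nb≢ in c , cv , dc , R.there lu dc

      -- Among the at least n/3 vertices below `v₀`, only second-class vertices, first-class
      -- nonleaves, `v₀` itself and at most Δ leaves attached to `v₀` are lost.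
      L-many : n ≤ # L? * 4
      L-many = estimate-46 n (# (R.desc? v₀)) (# (class? false)) (# r₁?) (# nonleaf?) (# r₂?) (# (λ v → v F.≟ v₀)) (# r₃?) (# (adj? T v₀)) (# L?) Δ big c₁ c₂ (ClassCounting.nonleaves₁ T ordering cls bipartite nb Adj-nb root) c₃ (#-unique (λ v → v F.≟ v₀) (λ _ _ p q → trans p (sym q))) c₄ (degree≤Δ v₀) Δ-small narrow n-large
        where
        nonleaf? : Decidable (λ v → cls v ≡ true × ¬ Leaf true v)
        nonleaf? v = class? true v ×-dec ¬? (leaf? true v)
        r₁? : Decidable (λ v → cls v ≡ true × R.Desc v₀ v)
        r₁? v = class? true v ×-dec R.desc? v₀ v
        r₂? : Decidable (λ v → Leaf true v × R.Desc v₀ v)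
        r₂? v = leaf? true v ×-dec R.desc? v₀ v
        r₃? : Decidable (λ v → Leaf true v × (R.Desc v₀ v × v ≢ v₀))
        r₃? v = leaf? true v ×-dec (R.desc? v₀ v ×-dec ¬? (v F.≟ v₀))
        c₁ : # (R.desc? v₀) ≤ # (class? false) + # r₁?
        c₁ = #-cover (R.desc? v₀) (class? false) r₁? cases
          where
          cases : ∀ v → R.Desc v₀ v → cls v ≡ false ⊎ cls v ≡ true × R.Desc v₀ v
          cases v dv with cls v
          ... | true = inj₂ (refl , dv)
          ... | false = inj₁ refl
        c₂ : # r₁? ≤ # nonleaf? + # r₂?
        c₂ = #-cover r₁? nonleaf? r₂? cases
          where
          cases : ∀ v → cls v ≡ true × R.Desc v₀ v → (cls v ≡ true × ¬ Leaf true v) ⊎ (Leaf true v × R.Desc v₀ v)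
          cases v (p , dv) with leaf? true v
          ... | yes l = inj₂ (l , dv)
          ... | no nl = inj₁ (p , nl)
        c₃ : # r₂? ≤ # (λ v → v F.≟ v₀) + # r₃?
        c₃ = #-cover r₂? (λ v → v F.≟ v₀) r₃? cases
          where
          cases : ∀ v → Leaf true v × R.Desc v₀ v → v ≡ v₀ ⊎ (Leaf true v × (R.Desc v₀ v × v ≢ v₀))
          cases v (l , dv) with v F.≟ v₀
          ... | yes eq = inj₁ eq
          ... | no ne = inj₂ (l , dv , ne)
        c₄ : # r₃? ≤ # (adj? T v₀) + # L?
        c₄ = #-cover r₃? (adj? T v₀) L? cases
          where
          cases : ∀ v → Leaf true v × (R.Desc v₀ v × v ≢ v₀) → Adj T v₀ v ⊎ L v
          cases v (l , p) with nb v F.≟ v₀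
          ... | yes refl = inj₁ (Adj-sym T (Adj-nb v))
          ... | no ne = inj₂ (l , p , ne)

      rest₁? : Decidable (λ v → cls v ≡ true × ¬ L v)
      rest₁? v = class? true v ×-dec ¬? (L? v)

      rest₁-size : # rest₁? + # L? ≤ # (class? true)
      rest₁-size = #-disjoint (class? true) rest₁? L? (λ _ → proj₁) (λ v p → proj₁ (proj₁ p)) λ _ p q → proj₂ p q

      -- The second class goes to the cell `A σ` and the first class without `L` to the opposite
      -- cell.
      RedEmbedding : Bool → Set
      RedEmbedding σ = ∃ λ (f : Fin n → Fin N) → (∀ v → ¬ L v → A (cls v xor σ) (f v)) ×
        (∀ u v → ¬ L u → ¬ L v → u ≢ v → f u ≢ f v × (Adj T u v → col G (f u) (f v) ≡ opp b))

      opaque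
        red-embedding : ∀ σ → RedEmbedding σ
        red-embedding σ = f , (λ v p → f∈ v (inj₂ p)) , λ u v p q → placed u v (inj₂ p) (inj₂ q)
          where
          open Ordering (ordering root)
          open Embed G (adj? T) (Adj-sym T) (λ _ _ → opp b) (λ _ _ → refl)
          few : ∀ u v x → Adj T u v → A (cls u xor σ) x → # (λ y → A? (cls v xor σ) y ×-dec miss? (opp b) x y) ≤ d
          few u v x e p = subst (λ s → # (λ y → A? s y ×-dec miss? (opp b) x y) ≤ d)
            (trans (flip-side (cls u) σ) (cong (_xor σ) (sym (bipartite u v e)))) (red-few (cls u xor σ) x p)
            where
            flip-side : ∀ x σ → (x xor σ) xor true ≡ not x xor σ
            flip-side true true = refl
            flip-side true false = refl
            flip-side false true = refl
            flip-side false false = refl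
          cells : ∀ u v x → cls u ≢ cls v → A (cls u xor σ) x → A (cls v xor σ) x → ⊥
          cells u v x ne p q = ne (xor-cancelʳ (cls u) (cls v) σ (same-cell (cls u xor σ) (cls v xor σ) p q))
            where
            same-cell : ∀ s t → A s x → A t x → s ≡ t
            same-cell true true _ _ = refl
            same-cell true false p q = ⊥-elim (disjoint x p q)
            same-cell false true p q = ⊥-elim (disjoint x q p)
            same-cell false false _ _ = refl
            xor-cancelʳ : ∀ x y σ → x xor σ ≡ y xor σ → x ≡ y
            xor-cancelʳ true true σ _ = refl
            xor-cancelʳ false false σ _ = refl
            xor-cancelʳ true false true ()
            xor-cancelʳ true false false ()
            xor-cancelʳ false true true ()
            xor-cancelʳ false true false ()
          room : ∀ v → ¬ L v → # (λ u → (no id ⊎-dec ¬? (L? u)) ×-dec (cls u B.≟ cls v)) + 1 * d ≤ # (A? (cls v xor σ))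
          room v _ = by-class (cls v)
            where
            cell? : ∀ κ → Decidable (λ u → (⊥ ⊎ ¬ L u) × cls u ≡ κ)
            cell? κ u = (no id ⊎-dec ¬? (L? u)) ×-dec (cls u B.≟ κ)
            by-class : ∀ κ → # (cell? κ) + 1 * d ≤ # (A? (κ xor σ))
            by-class true = estimate-47 (# (cell? true)) (# rest₁?) (# L?) (# (class? true)) n (# (class? false)) (# (A? (true xor σ))) d (#-mono (cell? true) rest₁? (λ { u (inj₂ p , eq) → eq , p })) rest₁-size L-many (≤-reflexive classes) (sizes (true xor σ)) d-small
            by-class false = estimate-48 (# (cell? false)) (# (class? false)) n (# (A? (false xor σ))) d (#-mono (cell? false) (class? false) (λ { u (_ , eq) → eq })) narrow (sizes (false xor σ)) d-small
          result : ∃ λ f → (∀ u → ⊥ → f u ≡ d₀) × (∀ u → ⊥ ⊎ ¬ L u → A (cls u xor σ) (f u)) × Placed (λ u → ⊥ ⊎ ¬ L u) f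
          result = embed {K = λ v → A (cls v xor σ)} (λ v → A? (cls v xor σ)) {S = λ _ → ⊥} {Q = λ v → ¬ L v} (λ _ → no id) (¬? ∘ L?) (λ _ ())
            rank rank-injective {Same = λ u v → cls u ≡ cls v} (λ u v → cls u B.≟ cls v) (λ _ → refl) cells 1 d (λ _ → d₀) (λ _ ()) (λ _ _ ())
            (λ u v x _ _ → few u v x)
            (λ v _ → #-unique _ λ { i j (inj₂ (_ , lt) , e) (inj₂ (_ , lt′) , e′) → earlier-unique v (Adj-sym T e) (Adj-sym T e′) lt lt′ }) room
          f : Fin n → Fin N
          f = proj₁ result
          f∈ : ∀ u → ⊥ ⊎ ¬ L u → A (cls u xor σ) (f u)
          f∈ = proj₁ (proj₂ (proj₂ result))
          placed : Placed (λ u → ⊥ ⊎ ¬ L u) f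
          placed = proj₂ (proj₂ (proj₂ result))

      module OneWay (σ : Bool) (f : Fin n → Fin N) (f∈ : ∀ v → ¬ L v → A (cls v xor σ) (f v))
        (placed : ∀ u v → ¬ L u → ¬ L v → u ≢ v → f u ≢ f v × (Adj T u v → col G (f u) (f v) ≡ opp b)) where

        f-inj : ∀ u v → ¬ L u → ¬ L v → f u ≡ f v → u ≡ v
        f-inj u v p q eq with u F.≟ v
        ... | yes u≡v = u≡v
        ... | no u≢v = contradiction eq (proj₁ (placed u v p q u≢v))

        used? : Decidable (Image (¬? ∘ L?) f)
        used? = image? (¬? ∘ L?) f
        V? : Decidable (λ y → ¬ Image (¬? ∘ L?) f y)
        V? y = ¬? (used? y)
        core? : Decidable (λ y → A (not σ) y × ¬ Image (¬? ∘ L?) f y)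
        core? y = A? (not σ) y ×-dec V? y
        missing : Fin N → ℕ
        missing y = # (λ l → L? l ×-dec ¬? (edge? (opp b) (f (nb l)) y))
        good? : Decidable (λ y → ¬ Image (¬? ∘ L?) f y × missing y * 2 ≤ # L?)
        good? y = V? y ×-dec (missing y * 2 ≤? # L?)

        nb∈ : ∀ l → L l → A σ (f (nb l))
        nb∈ l p = subst (λ x → A (x xor σ) (f (nb l))) (leaf-parent-class (proj₁ (proj₁ p))) (f∈ (nb l) (nb-kept l p))

        second∈ : ∀ v → cls v ≡ false → A σ (f v)
        second∈ v eq = subst (λ x → A (x xor σ) (f v)) eq (f∈ v λ p → not-self {false} (trans (sym (proj₁ (proj₁ p))) eq))

        red-copy : # L? ≤ # good? → MonoCopy G T
        red-copy good = LeafAttachment.attach-leaves T cls bipartite nb Adj-nb G (opp b) true L? L-leaf f placed V? core? (λ v y p free eq → free (v , p , eq)) (λ _ → proj₂) {d} {a}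
            few core-many good
            (estimate-49 n (# L?) d a L-many d-small a≤ n-large)
          where
          other : ∀ σ → σ xor true ≡ not σ
          other true = refl
          other false = refl
          few : ∀ l → L l → # (λ y → core? y ×-dec miss? (opp b) (f (nb l)) y) ≤ d
          few l p = ≤-trans (#-mono _ (λ y → A? (not σ) y ×-dec miss? (opp b) (f (nb l)) y) λ { y ((q , _) , ms) → q , ms })
            (subst (λ s → # (λ y → A? s y ×-dec miss? (opp b) (f (nb l)) y) ≤ d) (other σ) (red-few σ (f (nb l)) (nb∈ l p)))
          core-many : # L? ≤ # core? + a
          core-many = estimate-50 (# (A? (not σ))) (# core?) (# (image? rest₁? f)) (# rest₁?) (# L?) (# (class? true)) (# (class? false)) n a (#-cover (A? (not σ)) core? (image? rest₁? f) cases) (#-image rest₁? f) rest₁-size (≤-reflexive classes) (sizes (not σ)) a> n-large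
            where
            crossed : ∀ σ y → A σ y → A (not σ) y → ⊥
            crossed true y p q = disjoint y p q
            crossed false y p q = disjoint y q p
            cases : ∀ y → A (not σ) y → (A (not σ) y × ¬ Image (¬? ∘ L?) f y) ⊎ Image rest₁? f y
            cases y p with used? y
            ... | no free = inj₁ (p , free)
            ... | yes (v , q , refl) = inj₂ (v , (first (cls v) refl , q) , refl)
              where
              first : ∀ κ → cls v ≡ κ → cls v ≡ true
              first true eq = eq
              first false eq = ⊥-elim (crossed σ (f v) (second∈ v eq) p)

        Half : Fin N → Set
        Half w = # L? < # (λ l → L? l ×-dec edge? b w (f (nb l))) * 2

        Failing : Fin N → Set
        Failing w = Half w ⊎ Image (class? false) f w

        half? : Decidable Half
        half? w = # L? <? # (λ l → L? l ×-dec edge? b w (f (nb l))) * 2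

        failing? : Decidable Failing
        failing? w = half? w ⊎-dec image? (class? false) f w

        -- Every vertex is good, failing or the image of a kept first-class vertex. With fewer than
        -- |L| good ones, at least (2t₁ - 1) - (|L| - 1) - (t₁ - |L|) = t₁ vertices fail.
        failing-many : # good? < # L? → # (class? true) ≤ # failing?
        failing-many lt = estimate-51 N (# good?) (# rest?) (# failing?) (# (image? rest₁? f)) (# rest₁?) (# L?) (# (class? true)) c₁ c₂ (#-image rest₁? f) rest₁-size lt (≤-reflexive (sym sizeᴺ))
          where
          rest? : Decidable (λ y → ¬ (¬ Image (¬? ∘ L?) f y × missing y * 2 ≤ # L?))
          rest? y = ¬? (good? y)
          c₁ : N ≤ # good? + # rest?
          c₁ = ≤-reflexive (sym (#-complement good?))
          c₂ : # rest? ≤ # failing? + # (image? rest₁? f)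
          c₂ = #-cover rest? failing? (image? rest₁? f) cases
            where
            cases : ∀ y → ¬ (¬ Image (¬? ∘ L?) f y × missing y * 2 ≤ # L?) → Failing y ⊎ Image rest₁? f y
            cases y ng with used? y
            ... | no free = inj₁ (inj₁ (≤-trans (≰⇒> λ le → ng (free , le))
                    (*-monoˡ-≤ 2 (#-mono (λ l → L? l ×-dec ¬? (edge? (opp b) (f (nb l)) y)) _ λ { l (p , ne) → p , to-edge l p ne }))))
              where
              to-edge : ∀ l → L l → ¬ Edge (opp b) (f (nb l)) y → Edge b y (f (nb l))
              to-edge l p ne = Edge-sym (apart , not-red)
                where
                apart : f (nb l) ≢ y
                apart eq = free (nb l , nb-kept l p , eq)
                not-red : col G (f (nb l)) y ≡ b
                not-red with col G (f (nb l)) y ≟ᶜ b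
                ... | yes eq = eq
                ... | no neq = contradiction (apart , ≢⇒opp neq) ne
            ... | yes (v , q , refl) = image (cls v) refl
              where
              image : ∀ κ → cls v ≡ κ → Failing (f v) ⊎ Image rest₁? f (f v)
              image true eq = inj₂ (v , (eq , q) , refl)
              image false eq = inj₁ (inj₂ (v , eq , refl))

        -- The branches at v₀ that contain the neighbour of a leaf whose image is joined to w in
        -- colour b make up at least half of the leaves.
        blue-bridge : ∀ w → Half w → Δ ≤ # (λ y → A? (not σ) y ×-dec edge? b w y) → MonoCopy G T
        blue-bridge w half many = BranchBridge.branch-bridge T ordering cls bipartite (ordering root) G v₀ small b A? disjoint false d blue-few w (not σ) S? h (λ _ → proj₁) h∈ h-inj degree≤Δ many
            a below-many room₁ room₂
          where
          Link : Fin n → Fin n → Set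
          Link c l = L l × (R.Desc c (nb l) × Edge b w (f (nb l)))
          S : Fin n → Set
          S c = R.Child c v₀ × ∃ (Link c)
          link? : ∀ c → Dec (∃ (Link c))
          link? c = any? λ l → L? l ×-dec (R.desc? c (nb l) ×-dec edge? b w (f (nb l)))
          S? : Decidable S
          S? c = R.child? c v₀ ×-dec link? c
          -- The embedding in the other colour now only supplies distinct vertices joined to `w` in
          -- `b`, one for each branch; its placement of the tree is discarded.
          h : Fin n → Fin N
          h c with link? c
          ... | yes (l , _) = f (nb l)
          ... | no _ = w
          h-link : ∀ c → ∃ (Link c) → ∃ λ l → Link c l × h c ≡ f (nb l)
          h-link c p with link? c
          ... | yes (l , k) = l , k , refl
          ... | no ne = contradiction p ne
          not-not : ∀ σ → not (not σ) ≡ σ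
          not-not true = refl
          not-not false = refl
          h∈ : ∀ c → S c → A (not (not σ)) (h c) × Edge b w (h c)
          h∈ c (_ , p) with h-link c p
          ... | l , (q , _ , e) , eq = subst₂ A (sym (not-not σ)) (sym eq) (nb∈ l q) , subst (Edge b w) (sym eq) e
          h-inj : InjectiveOn S h
          h-inj c c′ (cv , p) (cv′ , p′) eq with h-link c p | h-link c′ p′
          ... | l , (q , dc , _) , e | l′ , (q′ , dc′ , _) , e′ =
            R.branch-unique cv cv′ dc (subst (R.Desc c′) (f-inj _ _ (nb-kept l′ q′) (nb-kept l q) (trans (sym e′) (trans (sym eq) e))) dc′)
          below-many : a ≤ # (R.below? S?)
          below-many = estimate-52 (# L?) (# (λ l → L? l ×-dec edge? b w (f (nb l)))) n a (# (R.below? S?)) half L-many a≤ (#-mono (λ l → L? l ×-dec edge? b w (f (nb l))) (R.below? S?) below)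
            where
            below : ∀ l → L l × Edge b w (f (nb l)) → R.Below S? l
            below l (p , e) = let c , cv , dn , dl = L-branch l p in c , (cv , l , p , dn , e) , dl

      module BothWays (f₁ : Fin n → Fin N) (f₁∈ : ∀ v → ¬ L v → A (cls v xor true) (f₁ v))
        (placed₁ : ∀ u v → ¬ L u → ¬ L v → u ≢ v → f₁ u ≢ f₁ v × (Adj T u v → col G (f₁ u) (f₁ v) ≡ opp b))
        (f₂ : Fin n → Fin N) (f₂∈ : ∀ v → ¬ L v → A (cls v xor false) (f₂ v))
        (placed₂ : ∀ u v → ¬ L u → ¬ L v → u ≢ v → f₂ u ≢ f₂ v × (Adj T u v → col G (f₂ u) (f₂ v) ≡ opp b)) where

        module O₁ = OneWay true f₁ f₁∈ placed₁
        module O₂ = OneWay false f₂ f₂∈ placed₂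

        blue-cell : ∀ s w → A s w → Δ ≤ # (λ y → A? s y ×-dec edge? b w y)
        blue-cell s w p = estimate-53 (# (A? s)) (# edges?) (# rest?) (# (λ y → y F.≟ w)) (# missed?) d n Δ (#-cover (A? s) edges? rest? cases) (#-cover rest? (λ y → y F.≟ w) missed? rest-cases) (#-unique (λ y → y F.≟ w) (λ _ _ p q → trans p (sym q))) missed-few (sizes s) d-small Δ-small n-large
          where
          edges? : Decidable (λ y → A s y × Edge b w y)
          edges? y = A? s y ×-dec edge? b w y
          rest? : Decidable (λ y → A s y × ¬ Edge b w y)
          rest? y = A? s y ×-dec ¬? (edge? b w y)
          missed? : Decidable (λ y → A s y × Miss b w y)
          missed? y = A? s y ×-dec miss? b w y
          missed-few : # missed? ≤ d
          missed-few = subst (λ t → # (λ y → A? t y ×-dec miss? b w y) ≤ d) (same s) (blue-few s w p)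
            where
            same : ∀ s → s xor false ≡ s
            same true = refl
            same false = refl
          cases : ∀ y → A s y → A s y × Edge b w y ⊎ A s y × ¬ Edge b w y
          cases y q with edge? b w y
          ... | yes e = inj₁ (q , e)
          ... | no ne = inj₂ (q , ne)
          rest-cases : ∀ y → A s y × ¬ Edge b w y → y ≡ w ⊎ A s y × Miss b w y
          rest-cases y (q , ne) with y F.≟ w
          ... | yes eq = inj₁ eq
          ... | no y≢w = inj₂ (q , (λ eq → y≢w (sym eq)) , λ eq → ne ((λ eq → y≢w (sym eq)) , eq))

        red-cell : ∀ s w → # (λ y → A? s y ×-dec edge? b w y) < Δ → Δ ≤ # (λ y → A? s y ×-dec edge? (opp b) w y)
        red-cell s w lt = estimate-54 (# (A? s)) (# blue?) (# rest?) Δ (# (λ y → y F.≟ w)) (# red?) n (#-cover (A? s) blue? rest? cases) lt (#-cover rest? (λ y → y F.≟ w) red? rest-cases) (#-unique (λ y → y F.≟ w) (λ _ _ p q → trans p (sym q))) (sizes s) Δ-small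
          where
          blue? : Decidable (λ y → A s y × Edge b w y)
          blue? y = A? s y ×-dec edge? b w y
          red? : Decidable (λ y → A s y × Edge (opp b) w y)
          red? y = A? s y ×-dec edge? (opp b) w y
          rest? : Decidable (λ y → A s y × ¬ Edge b w y)
          rest? y = A? s y ×-dec ¬? (edge? b w y)
          cases : ∀ y → A s y → A s y × Edge b w y ⊎ A s y × ¬ Edge b w y
          cases y q with edge? b w y
          ... | yes e = inj₁ (q , e)
          ... | no ne = inj₂ (q , ne)
          rest-cases : ∀ y → A s y × ¬ Edge b w y → y ≡ w ⊎ A s y × Edge (opp b) w y
          rest-cases y (q , ne) with y F.≟ w
          ... | yes eq = inj₁ eq
          ... | no y≢w = inj₂ (q , (λ eq → y≢w (sym eq)) , ≢⇒opp λ eq → ne ((λ eq → y≢w (sym eq)) , eq))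

        -- The two embeddings put the second class into different cells, so `w` is not an image of
        -- it for both. If it is for one, `w` has many neighbours in colour `b` in its own cell, and
        -- the other embedding supplies leaf neighbours in the opposite cell. Otherwise `w` sees
        -- half of the leaf neighbours in both cells, so one cell with Δ neighbours in `b` suffices;
        -- if there is none, `w` has Δ neighbours in the other colour in both cells.
        both-failing : ∀ w → O₁.Failing w → O₂.Failing w → MonoCopy G T
        both-failing w (inj₂ (u , eq , refl)) (inj₂ (v , eq′ , e)) =
          ⊥-elim (disjoint (f₁ u) (O₁.second∈ u eq) (subst (A false) e (O₂.second∈ v eq′)))
        both-failing w (inj₂ (u , eq , refl)) (inj₁ half) = O₂.blue-bridge (f₁ u) half (blue-cell true (f₁ u) (O₁.second∈ u eq))
        both-failing w (inj₁ half) (inj₂ (v , eq , refl)) = O₁.blue-bridge (f₂ v) half (blue-cell false (f₂ v) (O₂.second∈ v eq))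
        both-failing w (inj₁ half₁) (inj₁ half₂) with Δ ≤? # (λ y → A? true y ×-dec edge? b w y) | Δ ≤? # (λ y → A? false y ×-dec edge? b w y)
        ... | yes many | _ = O₂.blue-bridge w half₂ many
        ... | no _ | yes many = O₁.blue-bridge w half₁ many
        ... | no few₁ | no few₂ = red-bridge w λ { true → red-cell true w (≰⇒> few₁) ; false → red-cell false w (≰⇒> few₂) }

        both-ways : MonoCopy G T
        both-ways with # L? ≤? # O₁.good? | # L? ≤? # O₂.good?
        ... | yes good | _ = O₁.red-copy good
        ... | no _ | yes good = O₂.red-copy good
        ... | no ¬good₁ | no ¬good₂ with any? (λ w → O₁.failing? w ×-dec O₂.failing? w)
        ...   | yes (w , p , q) = both-failing w p q
        -- Two disjoint sets of at least t₁ failing vertices do not fit into 2t₁ - 1 vertices.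
        ...   | no none = contradiction crowded (<-irrefl refl)
          where
          everything? : Decidable (λ (_ : Fin N) → ⊤)
          everything? _ = yes tt
          crowded : N < N
          crowded = estimate-55 (# (class? true)) (# O₁.failing?) (# O₂.failing?) N (# everything?) (O₁.failing-many (≰⇒> ¬good₁)) (O₂.failing-many (≰⇒> ¬good₂)) (≤-reflexive sizeᴺ) (#-disjoint everything? O₁.failing? O₂.failing? (λ _ _ → tt) (λ _ _ → tt) (λ w p q → none (w , p , q))) (#≤n everything?)

      two-cells : MonoCopy G T
      two-cells = combine (red-embedding true) (red-embedding false)
        where
        combine : RedEmbedding true → RedEmbedding false → MonoCopy G T
        combine (f₁ , f₁∈ , placed₁) (f₂ , f₂∈ , placed₂) = BothWays.both-ways f₁ f₁∈ placed₁ f₂ f₂∈ placed₂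

-- Enlarging one near-clique or finding a second one

cancel-factor : ∀ {m f l x n} K → m * K ≤ f → f * l ≤ x * (m * 3) → x ≤ n → 1 ≤ m → l * K ≤ n * 3
cancel-factor {m} {f} {l} {x} {n} K mK≤f fl≤ x≤n 1≤m = *-cancelʳ-≤ (l * K) (n * 3) m {{>-nonZero 1≤m}} (begin
  l * K * m      ≡⟨ trans (*-assoc l K m) (trans (*-comm l (K * m)) (cong (_* l) (*-comm K m))) ⟩
  m * K * l      ≤⟨ *-monoˡ-≤ l mK≤f ⟩
  f * l          ≤⟨ fl≤ ⟩
  x * (m * 3)    ≤⟨ *-monoˡ-≤ (m * 3) x≤n ⟩
  n * (m * 3)    ≡⟨ trans (cong (n *_) (*-comm m 3)) (sym (*-assoc n 3 m)) ⟩
  n * 3 * m      ∎)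
  where open ≤-Reasoning

estimate-56 = linear 3 (λ x1 m n → (x1 ⊕ m ⊑ n) ∷ [] ⊢ x1 ⊑ n) 0 (1 ∷ [])

estimate-57 = linear 4 (λ x1 e l n → (con 1 ⊕ x1 ⊛ 2 ⊑ e) ∷ (l ⊛ 10000000 ⊑ n ⊛ 3) ∷ (e ⊑ x1 ⊕ l) ∷ (con 1 ⊕ n ⊑ e ⊛ 300000 ⊕ con 300000) ∷ (con 1000000 ⊑ n) ∷ [] ⊢ con 1 ⊕ n ⊑ n) 22500046 (75000000000000000000000000000000000000000000000000000000000000000000000000000 ∷ 15000000000000000000000000000000000000000000000000000000000000000000000 ∷ 150000000000000000000000000000000000000000000000000000000000000000000000000000 ∷ 250000000000000000000000000000000000000000000000000000000000000000000000 ∷ 205000000000000000000000000000000000000000000000000000000000000000000000 ∷ [])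

estimate-58 = linear 9 (λ x1 x2 x3 m x5 x6 x7 x8 n → (x1 ⊕ x2 ⊑ x3) ∷ (m ⊛ 3 ⊑ x2) ∷ (x5 ⊑ x6 ⊕ m) ∷ (x7 ⊑ x8 ⊕ x5) ∷ (n ⊑ x7 ⊕ m) ∷ (x3 ⊕ x6 ⊑ n) ∷ [] ⊢ x1 ⊕ (m ⊕ con 0) ⊑ x8) 0 (1 ∷ 1 ∷ 1 ∷ 1 ∷ 1 ∷ 1 ∷ [])

estimate-59 = linear 4 (λ x1 x2 m x4 → (x1 ⊑ x2) ∷ (x2 ⊕ m ⊑ x4) ∷ [] ⊢ x1 ⊕ (m ⊕ con 0) ⊑ x4) 0 (1 ∷ 1 ∷ [])

estimate-60 = linear 5 (λ e x2 n x4 m → (e ⊑ x2 ⊛ 2) ∷ (con 1 ⊕ n ⊑ e ⊛ 300000 ⊕ con 300000) ∷ (x4 ⊛ 1000000 ⊑ n) ∷ (con 1000000 ⊑ n) ∷ (m ⊛ 10000000000000000000000000000000000 ⊑ n) ∷ [] ⊢ x4 ⊕ m ⊑ x2) 29999999999999999999999999999999999 (15000000000000000000000000000000000 ∷ 50000000000000000000000000000 ∷ 30000000000000000000000000000 ∷ 19999999999999999999999999997 ∷ 3 ∷ [])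

estimate-61 = linear 6 (λ x1 x2 x3 x4 n m → (x1 ⊑ x2 ⊕ x3) ∷ (x2 ⊑ x4) ∷ (x4 ⊛ 1000000 ⊑ n) ∷ (n ⊑ x1 ⊕ x4) ∷ (con 1000000 ⊑ n) ∷ (m ⊛ 10000000000000000000000000000000000 ⊑ n) ∷ [] ⊢ m ⊛ 3 ⊑ x3) 9999999999999999999999999999999999 (10000000000000000000000000000000000 ∷ 10000000000000000000000000000000000 ∷ 20000000000000000000000000000 ∷ 10000000000000000000000000000000000 ∷ 9999979999999999999999999999999997 ∷ 3 ∷ [])

estimate-62 = linear 8 (λ x1 x2 x3 n m N x7 x8 → (x1 ⊑ x2 ⊕ x3) ∷ (n ⊑ x1 ⊕ m) ∷ (x3 ⊛ 200 ⊑ N) ∷ (N ⊕ con 1 ⊑ x7 ⊛ 2) ∷ (x7 ⊕ x8 ⊑ n) ∷ (m ⊛ 10000000000000000000000000000000000 ⊑ n) ∷ [] ⊢ n ⊛ 98 ⊑ x2 ⊛ 100) 199999999999999999999999999999999 (20000000000000000000000000000000000 ∷ 20000000000000000000000000000000000 ∷ 199999999999999999999999999999999 ∷ 199999999999999999999999999999999 ∷ 399999999999999999999999999999998 ∷ 2 ∷ [])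

estimate-63 = linear 2 (λ n e → (con 1 ⊕ n ⊑ e ⊛ 300000 ⊕ con 300000) ∷ (con 1000000 ⊑ n) ∷ [] ⊢ con 1 ⊑ e) 299999 (1 ∷ 1 ∷ [])

estimate-64 = linear 9 (λ N x2 x3 x4 x5 m n x8 x9 → (N ⊑ x2 ⊕ x3) ∷ (x3 ⊑ x4 ⊕ x5) ∷ (con 1 ⊕ x4 ⊑ m ⊛ 10000000) ∷ (x2 ⊕ m ⊑ n) ∷ (x8 ⊛ 2 ⊑ N ⊕ con 1) ∷ (n ⊑ x8 ⊕ x9) ∷ (m ⊛ 10000000000000000000000000000000000 ⊑ n) ∷ (x9 ⊛ 1000000 ⊑ n) ∷ [] ⊢ n ⊛ 98 ⊑ x5 ⊛ 100) 99999 (10000000 ∷ 10000000 ∷ 199980000000000000000000000000001 ∷ 10000000 ∷ 10000000 ∷ 20000000 ∷ 199980 ∷ 20 ∷ [])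

estimate-65 = linear 1 (λ e → [] ⊢ e ⊑ e ⊛ 200) 0 ([])

estimate-66 = linear 2 (λ e n → (e ⊛ 300000 ⊑ n) ∷ [] ⊢ e ⊛ 200 ⊛ 1000 ⊑ n) 2 (2 ∷ [])

estimate-67 = linear 3 (λ Δ n e → (Δ ⊛ 10000000000 ⊑ n) ∷ (con 1 ⊕ n ⊑ e ⊛ 300000 ⊕ con 300000) ∷ (con 1000000 ⊑ n) ∷ [] ⊢ Δ ⊑ e ⊛ 200) 29999999999 (3 ∷ 20000000 ∷ 19999997 ∷ [])

estimate-68 = linear 6 (λ x1 x2 x3 e n Δ → (x1 ⊑ x2 ⊕ x3) ∷ (con 1 ⊕ x3 ⊑ e) ∷ (n ⊛ 98 ⊑ x1 ⊛ 100) ∷ (e ⊛ 300000 ⊑ n) ∷ (Δ ⊛ 10000000000 ⊑ n) ∷ [] ⊢ Δ ⊑ x2) 9999999999 (10000000000 ∷ 2939999999700000 ∷ 100000000 ∷ 9799999999 ∷ 1 ∷ [])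

estimate-69 = linear 3 (λ m n e → (m ⊛ 10000000000000000000000000000000000 ⊑ n) ∷ (con 1 ⊕ n ⊑ e ⊛ 300000 ⊕ con 300000) ∷ (con 1000000 ⊑ n) ∷ [] ⊢ m ⊑ e ⊛ 200) 29999999999999999999999999999999999 (3 ∷ 20000000000000000000000000000000 ∷ 19999999999999999999999999999997 ∷ [])

estimate-70 = linear 2 (λ m n → (m ⊛ 10000000000000000000000000000000000 ⊑ n) ∷ [] ⊢ m ⊑ n) 9999999999999999999999999999999999 (1 ∷ [])

module CaseTwo {n} (T : Graph n) (ordering : ∀ root → Ordering T root)
  (cls : Fin n → Bool) (bipartite : ∀ u v → Adj T u v → cls v ≡ not (cls u))
  (nb : Fin n → Fin n) (Adj-nb : ∀ v → Adj T v (nb v))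
  (root : Fin n) {N} (G : ColouredKN N) (d₀ : Fin N) (b : Colour)
  {Δ : ℕ} (degree≤Δ : ∀ v → # (adj? T v) ≤ Δ) (m e : ℕ)
  (sizeᴺ : N + 1 ≡ # (λ v → cls v B.≟ true) * 2) (classes : # (λ v → cls v B.≟ true) + # (λ v → cls v B.≟ false) ≡ n)
  (m-small : m * 10000000000000000000000000000000000 ≤ n) (Δ-small : Δ * 10000000000 ≤ n)
  (1≤m : 1 ≤ m) (n-large : 1000000 ≤ n) (narrow : # (λ v → cls v B.≟ false) * 1000000 ≤ n)
  (e≤ : e * 300000 ≤ n) (e> : n < e * 300000 + 300000) where
  open Trees T cls bipartite nb Adj-nb
  open Host G

  module _ {U : Fin N → Set} (U? : Decidable U) (sizeᵁ : # U? + m ≡ n)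
    (missᵇ : ∀ x → U x → # (λ y → U? y ×-dec miss? b x y) ≤ m) where

    F? : Decidable (λ y → ¬ U y × e ≤ # (λ u → U? u ×-dec edge? b y u))
    F? y = ¬? (U? y) ×-dec (e ≤? # (λ u → U? u ×-dec edge? b y u))

    -- `U` is m vertices short of n. The gap is closed outside: 3m first-class leaves go to `F?`,
    -- and the second class goes to vertices of `U` with at least 3m edges of colour `b` into that
    -- set.
    module Extended (F-many : m * 10000000 ≤ # F?) where

      FEdge? : ∀ u y → Dec ((¬ U y × e ≤ # (λ u → U? u ×-dec edge? b y u)) × Edge b u y)
      FEdge? u y = F? y ×-dec edge? b u y

      rich? : Decidable (λ u → U u × m * 3 ≤ # (FEdge? u))
      rich? u = U? u ×-dec (m * 3 ≤? # (FEdge? u))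

      poor? : Decidable (λ u → U u × ¬ (m * 3 ≤ # (FEdge? u)))
      poor? u = U? u ×-dec ¬? (m * 3 ≤? # (FEdge? u))

      -- Otherwise each vertex counted by `F?` has more than e/2 neighbours among the poor vertices.
      -- Poor vertices send fewer than 3m edges to the at least 10⁷m vertices there, so double
      -- counting bounds this number by 3n/10⁷, which is below e/2, about n/(6 · 10⁵).
      rich-many : e ≤ # rich? * 2
      rich-many with e ≤? # rich? * 2
      ... | yes le = le
      ... | no ≰ = contradiction impossible (<-irrefl refl)
        where
        l = e ∸ # rich?
        lower : ∀ y → (¬ U y × e ≤ # (λ u → U? u ×-dec edge? b y u)) → l ≤ # (λ u → poor? u ×-dec FEdge? u y)
        lower y f = ≤-trans (∸-monoˡ-≤ (# rich?) (≤-trans (proj₂ f) (#-cover (λ u → U? u ×-dec edge? b y u) rich? (λ u → poor? u ×-dec FEdge? u y) cases)))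
            (≤-reflexive (m+n∸m≡n (# rich?) _))
          where
          cases : ∀ u → U u × Edge b y u → (U u × m * 3 ≤ # (FEdge? u)) ⊎ ((U u × ¬ (m * 3 ≤ # (FEdge? u))) ×
            ((¬ U y × e ≤ # (λ u → U? u ×-dec edge? b y u)) × Edge b u y))
          cases u (p , ed) with m * 3 ≤? # (FEdge? u)
          ... | yes le = inj₁ (p , le)
          ... | no ¬le = inj₂ ((p , ¬le) , f , Edge-sym ed)
        l-bound : l * 10000000 ≤ n * 3
        l-bound = cancel-factor 10000000 F-many (double-count poor? FEdge? F? (λ u p → <⇒≤ (≰⇒> (proj₂ p))) lower) (#≤n′) 1≤m
          where
          #≤n′ : # poor? ≤ n
          #≤n′ = ≤-trans (#-mono poor? U? λ _ → proj₁) ((estimate-56 (# U?) m n (≤-reflexive sizeᵁ)))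
        impossible : n < n
        impossible = estimate-57 (# rich?) e l n (≰⇒> ≰) l-bound (m≤n+m∸n e (# rich?)) e> n-large

      module _ (v : Fin N → Bool) (v-rich : ∀ u → v u ≡ true → U u × m * 3 ≤ # (FEdge? u)) (v-size : # (∈? v) ≡ # (class? false) + m)
        (l : Fin n → Bool) (l-leaf : ∀ x → l x ≡ true → Leaf true x) (l-size : # (∈? l) ≡ m * 3) where

        L? : Decidable (λ x → l x ≡ true)
        L? = ∈? l

        K : Bool → Fin N → Set
        K true y = U y × v y ≢ true
        K false y = v y ≡ true

        K? : ∀ κ y → Dec (K κ y)
        K? true y = U? y ×-dec ¬? (∈? v y)
        K? false y = ∈? v y

        K⊆U : ∀ κ y → K κ y → U y
        K⊆U true y = proj₁
        K⊆U false y t = proj₁ (v-rich y t)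

        open Ordering (ordering root)
        open Embed G (adj? T) (Adj-sym T) (λ _ _ → b) (λ _ _ → refl)

        Trunk : Set
        Trunk = ∃ λ f → (∀ x → ⊥ → f x ≡ d₀) × (∀ x → ⊥ ⊎ l x ≢ true → K (cls x) (f x)) × Placed (λ x → ⊥ ⊎ l x ≢ true) f

        opaque
          trunk : Trunk
          trunk = embed {K = λ x → K (cls x)} (λ x → K? (cls x)) {S = λ _ → ⊥} {Q = λ x → l x ≢ true} (λ _ → no id) (¬? ∘ L?) (λ _ ())
            rank rank-injective {Same = λ x y → cls x ≡ cls y} (λ x y → cls x B.≟ cls y) (λ _ → refl) cells 1 m (λ _ → d₀) (λ _ ()) (λ _ _ ())
            (λ x y z _ _ _ k → ≤-trans (#-mono _ (λ w → U? w ×-dec miss? b z w) λ { w (k′ , ms) → K⊆U (cls y) w k′ , ms }) (missᵇ z (K⊆U (cls x) z k)))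
            (λ y _ → #-unique _ λ { i j (inj₂ (_ , lt) , ed) (inj₂ (_ , lt′) , ed′) → earlier-unique y (Adj-sym T ed) (Adj-sym T ed′) lt lt′ }) room
            where
            same-cell : ∀ s t z → K s z → K t z → s ≡ t
            same-cell true true z _ _ = refl
            same-cell true false z p q = contradiction q (proj₂ p)
            same-cell false true z p q = contradiction p (proj₂ q)
            same-cell false false z _ _ = refl
            cells : ∀ x y z → cls x ≢ cls y → K (cls x) z → K (cls y) z → ⊥
            cells x y z ne p q = ne (same-cell (cls x) (cls y) z p q)
            room : ∀ x → l x ≢ true → # (λ y → (no id ⊎-dec ¬? (L? y)) ×-dec (cls y B.≟ cls x)) + 1 * m ≤ # (K? (cls x))
            room x _ = by-class (cls x)
              where
              cell? : ∀ κ → Decidable (λ y → (⊥ ⊎ l y ≢ true) × cls y ≡ κ)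
              cell? κ y = (no id ⊎-dec ¬? (L? y)) ×-dec (cls y B.≟ κ)
              by-class : ∀ κ → # (cell? κ) + 1 * m ≤ # (K? κ)
              -- The removal of 3m leaves balances exactly: t₁ - 3m kept vertices and m missed ones
              -- fit into the (n - m) - (t₂ + m) = t₁ - 2m vertices of this cell.
              by-class true = estimate-58 (# (cell? true)) (# L?) (# (class? true)) m (# (∈? v)) (# (class? false)) (# U?) (# (K? true)) n (#-disjoint (class? true) (cell? true) L? (λ _ → proj₂) (λ y t → proj₁ (l-leaf y t)) (λ { y (inj₂ nl , _) t → nl t })) (≤-reflexive (sym l-size)) (≤-reflexive v-size) (#-cover U? (K? true) (∈? v) cases) (≤-reflexive (sym sizeᵁ)) (≤-reflexive classes)
                where
                cases : ∀ y → U y → (U y × v y ≢ true) ⊎ v y ≡ true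
                cases y p with ∈? v y
                ... | yes t = inj₂ t
                ... | no ¬t = inj₁ (p , ¬t)
              by-class false = estimate-59 (# (cell? false)) (# (class? false)) m (# (∈? v)) (#-mono (cell? false) (class? false) (λ _ → proj₂)) (≤-reflexive (sym v-size))

        from-trunk : Trunk → MonoCopy G T
        -- Each removed leaf has at least 3m candidates and there are only 3m leaves, so distinct
        -- positions can be picked one by one.
        from-trunk (f , _ , f∈ , placed) = attach (transversal L? (λ x → FEdge? (f (nb x))) d₀ λ x t → ≤-trans (≤-reflexive l-size) (proj₂ (v-rich _ (nb∈ x t))))
          where
          nb∈ : ∀ x → l x ≡ true → v (f (nb x)) ≡ true
          nb∈ x t = subst (λ κ → K κ (f (nb x))) (leaf-parent-class (proj₁ (l-leaf x t)))
            (f∈ (nb x) (inj₂ λ t′ → not-self (trans (sym (leaf-parent-class (proj₁ (l-leaf x t)))) (proj₁ (l-leaf (nb x) t′)))))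
          attach : (∃ λ g → (∀ x → l x ≡ true → (¬ U (g x) × e ≤ # (λ u → U? u ×-dec edge? b (g x) u)) × Edge b (f (nb x)) (g x)) ×
                            InjectiveOn (λ x → l x ≡ true) g) → MonoCopy G T
          attach (g , g∈ , g-inj) = LeafAttachment.assemble T cls bipartite nb Adj-nb G b true L? l-leaf f g (λ x y p q → placed x y (inj₂ p) (inj₂ q)) (λ x t → proj₂ (g∈ x t))
            (λ x y t nl eq → proj₁ (proj₁ (g∈ x t)) (subst U eq (K⊆U (cls y) (f y) (f∈ y (inj₂ nl))))) g-inj

        copy : MonoCopy G T
        copy = from-trunk trunk

      extended-copy : MonoCopy G T
      extended-copy = choose-both
        (choose rich? (# (class? false) + m) (estimate-60 e (# rich?) n (# (class? false)) m rich-many e> narrow n-large m-small))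
        (choose (leaf? true) (m * 3) (estimate-61 (# (class? true)) (# (λ x → class? true x ×-dec ¬? (leaf? true x))) (# (leaf? true)) (# (class? false)) n m (#-cover (class? true) (λ x → class? true x ×-dec ¬? (leaf? true x)) (leaf? true) cases) (ClassCounting.nonleaves₁ T ordering cls bipartite nb Adj-nb root) narrow (≤-reflexive (sym classes)) n-large m-small))
        where
        cases : ∀ x → cls x ≡ true → (cls x ≡ true × ¬ Leaf true x) ⊎ Leaf true x
        cases x p with leaf? true x
        ... | yes q = inj₂ q
        ... | no nq = inj₁ (p , nq)
        choose-both : (∃ λ v → (∀ u → v u ≡ true → U u × m * 3 ≤ # (FEdge? u)) × # (∈? v) ≡ # (class? false) + m) →
          (∃ λ l → (∀ x → l x ≡ true → Leaf true x) × # (∈? l) ≡ m * 3) → MonoCopy G T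
        choose-both (v , v-rich , v-size) (l , l-leaf , l-size) = copy v v-rich v-size l l-leaf l-size

    module Separated (F-few : # F? < m * 10000000) where

      B₀ : Fin N → Set
      B₀ y = ¬ U y × # (λ u → U? u ×-dec edge? b y u) < e

      B₀? : Decidable B₀
      B₀? y = ¬? (U? y) ×-dec (# (λ u → U? u ×-dec edge? b y u) <? e)

      -- A vertex of `B₀` has fewer than e neighbours in `U` in colour `b`, so at most N/200
      -- vertices of `U` have more than 200e in `B₀`. Dropping these makes the cells almost
      -- completely joined in the other colour from both sides.
      A : Bool → Fin N → Set
      A true x = U x × # (λ y → B₀? y ×-dec edge? b x y) ≤ e * 200
      A false y = B₀ y

      A? : ∀ s x → Dec (A s x)
      A? true x = U? x ×-dec (# (λ y → B₀? y ×-dec edge? b x y) ≤? e * 200)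
      A? false y = B₀? y

      disjoint : ∀ x → A true x → A false x → ⊥
      disjoint x (u , _) (¬u , _) = ¬u u

      sizes : ∀ s → n * 98 ≤ # (A? s) * 100
      sizes true = estimate-62 (# U?) (# (A? true)) (# bad?) n m N (# (class? true)) (# (class? false)) (#-cover U? (A? true) bad? cases) (≤-reflexive (sym sizeᵁ)) bad-few (≤-reflexive sizeᴺ) (≤-reflexive classes) m-small
        where
        bad? : Decidable (λ x → U x × e * 200 < # (λ y → B₀? y ×-dec edge? b x y))
        bad? x = U? x ×-dec (e * 200 <? # (λ y → B₀? y ×-dec edge? b x y))
        cases : ∀ x → U x → A true x ⊎ (U x × e * 200 < # (λ y → B₀? y ×-dec edge? b x y))
        cases x p with # (λ y → B₀? y ×-dec edge? b x y) ≤? e * 200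
        ... | yes le = inj₁ (p , le)
        ... | no ≰ = inj₂ (p , ≰⇒> ≰)
        1≤e : 1 ≤ e
        1≤e = estimate-63 n e e> n-large
        bad-few : # bad? * 200 ≤ N
        bad-few = *-cancelʳ-≤ (# bad? * 200) N e {{>-nonZero 1≤e}} (begin
          # bad? * 200 * e     ≡⟨ trans (*-assoc (# bad?) 200 e) (cong (# bad? *_) (*-comm 200 e)) ⟩
          # bad? * (e * 200)   ≤⟨ double-count B₀? (λ y x → U? x ×-dec edge? b y x) bad? (λ y p → <⇒≤ (proj₂ p))
                                    (λ { x (p , lt) → ≤-trans (<⇒≤ lt) (#-mono _ _ λ { y (q , ed) → q , p , Edge-sym ed }) }) ⟩
          # B₀? * e            ≤⟨ *-monoˡ-≤ e (#≤n B₀?) ⟩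
          N * e                ∎)
          where open ≤-Reasoning
      sizes false = estimate-64 N (# U?) (# (¬? ∘ U?)) (# F?) (# B₀?) m n (# (class? true)) (# (class? false)) (≤-reflexive (sym (#-complement U?))) (#-cover (¬? ∘ U?) F? B₀? cases) F-few (≤-reflexive sizeᵁ) (≤-reflexive (sym sizeᴺ)) (≤-reflexive (sym classes)) m-small narrow
        where
        cases : ∀ y → ¬ U y → (¬ U y × e ≤ # (λ u → U? u ×-dec edge? b y u)) ⊎ B₀ y
        cases y ¬u with e ≤? # (λ u → U? u ×-dec edge? b y u)
        ... | yes le = inj₁ (¬u , le)
        ... | no ≰ = inj₂ (¬u , ≰⇒> ≰)

      miss⇒edge : ∀ {x y} → Miss (opp b) x y → Edge b x y
      miss⇒edge {x} {y} (ne , nr) = ne , go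
        where
        go : col G x y ≡ b
        go with col G x y ≟ᶜ b
        ... | yes eq = eq
        ... | no neq = contradiction (≢⇒opp neq) nr

      red-few : ∀ s x → A s x → # (λ y → A? (s xor true) y ×-dec miss? (opp b) x y) ≤ e * 200
      red-few true x (_ , le) = ≤-trans (#-mono _ (λ y → B₀? y ×-dec edge? b x y) λ { y (q , ms) → q , miss⇒edge ms }) le
      red-few false x (_ , lt) = ≤-trans (≤-trans (#-mono _ (λ y → U? y ×-dec edge? b x y) λ { y ((q , _) , ms) → q , miss⇒edge ms }) (<⇒≤ lt))
        ((estimate-65 e))

      open Rooted T (ordering root) using (Child)
      open Branching T (ordering root) using (desc?; pivot)

      module Pivoted (v₀ : Fin n) (big : n ≤ # (desc? v₀) * 3) (small : ∀ c → Child c v₀ → # (desc? c) * 3 < n)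
        (a : ℕ) (a≤ : a * 10 ≤ n) (a> : n < a * 10 + 10) where

        d-small : e * 200 * 1000 ≤ n
        d-small = estimate-66 e n e≤

        Δ≤d : Δ ≤ e * 200
        Δ≤d = estimate-67 Δ n e Δ-small e> n-large

        red? : ∀ w → Decidable (λ y → B₀ y × Edge (opp b) w y)
        red? w y = B₀? y ×-dec edge? (opp b) w y

        red-to-A : ∀ w → B₀ w → Δ ≤ # (λ y → A? true y ×-dec edge? (opp b) w y)
        red-to-A w (¬u , lt) = estimate-68 (# (A? true)) (# redᴬ?) (# blueᴬ?) e n Δ (#-cover (A? true) redᴬ? blueᴬ? cases) lt (sizes true) e≤ Δ-small
          where
          redᴬ? : Decidable (λ y → A true y × Edge (opp b) w y)
          redᴬ? y = A? true y ×-dec edge? (opp b) w y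
          blueᴬ? : Decidable (λ y → U y × Edge b w y)
          blueᴬ? y = U? y ×-dec edge? b w y
          cases : ∀ y → A true y → (A true y × Edge (opp b) w y) ⊎ (U y × Edge b w y)
          cases y p with col G w y ≟ᶜ b
          ... | yes eq = inj₂ (proj₁ p , (λ { refl → ¬u (proj₁ p) }) , eq)
          ... | no neq = inj₁ (p , (λ { refl → ¬u (proj₁ p) }) , ≢⇒opp neq)

        both-red : ∀ w → B₀ w → Δ ≤ # (red? w) → ∀ s → Δ ≤ # (λ y → A? s y ×-dec edge? (opp b) w y)
        both-red w p many true = red-to-A w p
        both-red w p many false = many

        -- A vertex of `B₀` with Δ neighbours inside `B₀` in the other colour also has Δ of them in
        -- the opposite cell, and a bridge exists. Without such a vertex `B₀` is a near-clique in
        -- `b`.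
        separated-copy : MonoCopy G T
        separated-copy with any? (λ w → B₀? w ×-dec (Δ ≤? # (red? w)))
        ... | yes (w , p , many) = TwoCells.red-bridge T ordering cls bipartite nb Adj-nb root G d₀ b A? disjoint degree≤Δ v₀ small a (e * 200) big a≤ a> d-small sizes narrow Δ-small n-large red-few w (both-red w p many)
        ... | no none = TwoCells.two-cells T ordering cls bipartite nb Adj-nb root G d₀ b A? disjoint degree≤Δ v₀ small a (e * 200) big a≤ a> d-small sizes narrow Δ-small n-large red-few blue-few sizeᴺ classes
          where
          blue-few : ∀ s x → A s x → # (λ y → A? (s xor false) y ×-dec miss? b x y) ≤ e * 200
          blue-few true x (u , _) = ≤-trans (#-mono _ (λ y → U? y ×-dec miss? b x y) λ { y ((q , _) , ms) → q , ms }) (≤-trans (missᵇ x u)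
            (estimate-69 m n e m-small e> n-large))
          blue-few false x p = ≤-trans (#-mono _ (red? x) λ { y (q , ne , nb) → q , ne , ≢⇒opp nb }) (≤-trans (<⇒≤ (≰⇒> λ le → none (x , p , le))) Δ≤d)

      separated : MonoCopy G T
      separated = combine pivot (quotient n 10)
        where
        combine : (∃ λ v → n ≤ # (desc? v) * 3 × (∀ c → Child c v → # (desc? c) * 3 < n)) → (∃ λ a → a * 10 ≤ n × n < a * 10 + 10) → MonoCopy G T
        combine (v₀ , big , small) (a , a≤ , a>) = Pivoted.separated-copy v₀ big small a a≤ a>

    copy-in : MonoCopy G T
    copy-in with m * 10000000 ≤? # F?
    ... | yes many = Extended.extended-copy many
    ... | no few = Separated.separated (≰⇒> few)

  -- `U₁` may be large, so it is cut down to n - m vertices; enough vertices then lie outside to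
  -- form the second cell.
  case-two : ∀ {U₁ : Fin N → Set} (U₁? : Decidable U₁) → n ≤ # U₁? + m → (∀ x → U₁ x → # (λ y → U₁? y ×-dec miss? b x y) ≤ m) → MonoCopy G T
  case-two U₁? size missᵇ = with-subset (choose U₁? (n ∸ m) (≤-trans (∸-monoˡ-≤ m size) (≤-reflexive (trans (cong (_∸ m) (+-comm (# U₁?) m)) (m+n∸m≡n m (# U₁?))))))
    where
    with-subset : (∃ λ q → (∀ x → q x ≡ true → _) × # (∈? q) ≡ n ∸ m) → MonoCopy G T
    with-subset (q , q⊆U , q-size) = copy-in (∈? q)
      (trans (cong (_+ m) q-size) (m∸n+n≡m (estimate-70 m n m-small)))
      (λ x t → ≤-trans (#-mono _ (λ y → U₁? y ×-dec miss? b x y) λ { y (t′ , ms) → q⊆U y t′ , ms }) (missᵇ x (q⊆U x t)))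

-- From the extremal structure to the two cases

Member : ∀ {n} → Subset n → Fin n → Set
Member S i = lookup S i ≡ true

member? : ∀ {n} (S : Subset n) → Decidable (Member S)
member? S i = lookup S i B.≟ true

opaque
  unfolding # sum

  size-# : ∀ {n} (S : Subset n) → ∣ S ∣ ≡ # (member? S)
  size-# [] = refl
  size-# (true ∷ S) = cong suc (size-# S)
  size-# (false ∷ S) = size-# S

estimate-71 = linear 3 (λ n x2 x3 → (n ⊑ x2 ⊕ x3) ∷ (x2 ⊑ con 1) ∷ (con 2 ⊑ n) ∷ [] ⊢ con 1 ⊑ x3) 0 (1 ∷ 1 ∷ 1 ∷ [])

estimate-72 = linear 1 (λ n → (con 1000000 ⊑ n) ∷ [] ⊢ con 2 ⊑ n) 0 (1 ∷ [])

estimate-73 = linear 1 (λ n → (con 1000000 ⊑ n) ∷ [] ⊢ con 1 ⊑ n) 0 (1 ∷ [])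

estimate-74 = linear 3 (λ n t₂ N → (n ⊕ t₂ ⊑ N ⊕ con 1) ∷ (con 1000000 ⊑ n) ∷ [] ⊢ con 1 ⊑ N) 0 (1 ∷ 1 ∷ [])

estimate-75 = linear 5 (λ x1 x2 n t₁ t₂ → (x1 ⊕ x2 ⊑ n) ∷ (t₁ ⊑ x1) ∷ (n ⊑ t₁ ⊕ t₂) ∷ [] ⊢ x2 ⊑ t₂) 0 (1 ∷ 1 ∷ 1 ∷ [])
estimate-76 = linear 5 (λ n x2 x3 t₁ t₂ → (n ⊑ x2 ⊕ x3) ∷ (x2 ⊑ t₁) ∷ (t₁ ⊕ t₂ ⊑ n) ∷ [] ⊢ t₂ ⊑ x3) 0 (1 ∷ 1 ∷ 1 ∷ [])

module Reduction {n} (T : Graph n) (connected : Connected T) (acyclic : Acyclic T)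
  (X : Subset n) (crossing : ∀ u v → Adj T u v → ¬ ((u ∈ X → v ∈ X) × (v ∈ X → u ∈ X)))
  {N} (G : ColouredKN N) where
  open Host G

  cls : Fin n → Bool
  cls = lookup X

  bipartite : ∀ u v → Adj T u v → cls v ≡ not (cls u)
  bipartite u v e with cls u in p | cls v in q
  ... | true | true = contradiction ((λ _ → lookup⇒[]= v X q) , λ _ → lookup⇒[]= u X p) (crossing u v e)
  ... | true | false = refl
  ... | false | true = refl
  ... | false | false = contradiction ((λ i → absurd (trans (sym p) ([]=⇒lookup i))) , λ i → absurd (trans (sym q) ([]=⇒lookup i))) (crossing u v e)
    where
    absurd : ∀ {A : Set} → false ≡ true → A
    absurd ()

  neighbour-exists : 2 ≤ n → ∀ v → ∃ λ u → Adj T v u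
  neighbour-exists 2≤n v = first-step (connected v w) w≢v
    where
    others? : Decidable (λ u → ¬ u ≡ v)
    others? u = ¬? (u F.≟ v)
    other : ∃ λ u → ¬ u ≡ v
    other = nonempty others? (estimate-71 n (# (λ u → u F.≟ v)) (# others?) (≤-reflexive (sym (#-complement (λ u → u F.≟ v)))) (#-unique (λ u → u F.≟ v) (λ _ _ p q → trans p (sym q))) 2≤n)
    w = proj₁ other
    w≢v = proj₂ other
    first-step : ∀ {v w} → Walk T v w → ¬ w ≡ v → ∃ λ u → Adj T v u
    first-step [] ne = contradiction refl ne
    first-step (e ∷ _) _ = _ , e

  member-nbhd : ∀ c x y → Edge c x y → lookup (nbhd G c x) y ≡ true
  member-nbhd c x y (x≢y , eq) = trans (lookup∘tabulate _ y) both
    where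
    both : not ⌊ x F.≟ y ⌋ ∧ (col G x y ==ᶜ c) ≡ true
    both with x F.≟ y
    ... | yes x≡y = contradiction x≡y x≢y
    ... | no _ rewrite eq = refl′ c
      where
      refl′ : ∀ c → (c ==ᶜ c) ≡ true
      refl′ red = refl
      refl′ blue = refl

  count≤deg : ∀ c x (S : Subset N) → # (λ y → member? S y ×-dec edge? c x y) ≤ deg G c x S
  count≤deg c x S = ≤-trans (#-mono _ (member? (S ∩ nbhd G c x)) λ { y (p , e) →
      trans (lookup-zipWith _∧_ y S (nbhd G c x)) (cong₂ _∧_ p (member-nbhd c x y e)) }) (≤-reflexive (sym (size-# (S ∩ nbhd G c x))))

  missed≤deg : ∀ c x (S : Subset N) → # (λ y → member? S y ×-dec miss? c x y) ≤ deg G (opp c) x S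
  missed≤deg c x S = ≤-trans (#-mono _ (λ y → member? S y ×-dec edge? (opp c) x y) λ { y (p , ne , nc) → p , ne , ≢⇒opp nc }) (count≤deg (opp c) x S)

  opp-opp : ∀ c → opp (opp c) ≡ c
  opp-opp red = refl
  opp-opp blue = refl

  reduced : ∀ {t₁ t₂ m Δ} b (U₁ U₂ : Subset N) → t₁ + t₂ ≡ n → t₂ ≤ t₁ → ∣ X ∣ ≡ t₁ →
    m * 10000000000000000000000000000000000 ≤ n → Δ * 10000000000 ≤ n → 1 ≤ m → 1000000 ≤ n → (∀ v → degree T v ≤ Δ) →
    n + t₂ ≤ N + 1 → (t₂ * 1000000 ≤ n → N + 1 ≡ t₁ * 2) → Disjoint U₁ U₂ → n ≤ ∣ U₁ ∣ + m → t₂ ≤ ∣ U₂ ∣ + m →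
    (∀ u → u ∈ U₁ → deg G (opp b) u U₁ ≤ m) → (∀ u → u ∈ U₁ → deg G b u U₂ ≤ m) → (∀ u → u ∈ U₂ → deg G b u U₁ ≤ m) → MonoCopy G T
  reduced {t₁} {t₂} {m} {Δ} b U₁ U₂ total larger size m-small Δ-small 1≤m n-large degree≤Δ sizeᴺ sizeᴺ′ disj size₁ size₂ few₁ few₂ few₃ =
    with-class-two class₂-size
    where
    2≤n : 2 ≤ n
    2≤n = estimate-72 n n-large
    nb : Fin n → Fin n
    nb v = proj₁ (neighbour-exists 2≤n v)
    Adj-nb : ∀ v → Adj T v (nb v)
    Adj-nb v = proj₂ (neighbour-exists 2≤n v)
    root : Fin n
    root = F.fromℕ< {0} (estimate-73 n n-large)
    d₀ : Fin N
    d₀ = F.fromℕ< {0} (estimate-74 n t₂ N sizeᴺ n-large)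
    class₁? : Decidable (λ v → cls v ≡ true)
    class₁? v = cls v B.≟ true
    class₂? : Decidable (λ v → cls v ≡ false)
    class₂? v = cls v B.≟ false
    class₁-size : # class₁? ≡ t₁
    class₁-size = trans (sym (size-# X)) size
    classes : # class₁? + # class₂? ≡ n
    classes = trans (cong (# class₁? +_) (#-cong class₂? (¬? ∘ class₁?) (λ v p q → true≢false (trans (sym q) p)) λ v → not-true)) (#-complement class₁?)
      where
      true≢false : true ≢ false
      true≢false ()
      not-true : ∀ {x} → x ≢ true → x ≡ false
      not-true {true} ne = contradiction refl ne
      not-true {false} _ = refl
    class₂-size : # class₂? ≡ t₂
    class₂-size = (≤-antisym (estimate-75 (# class₁?) (# class₂?) n t₁ t₂ (≤-reflexive classes) (≤-reflexive (sym class₁-size)) (≤-reflexive (sym total))) (estimate-76 n (# class₁?) (# class₂?) t₁ t₂ (≤-reflexive (sym classes)) (≤-reflexive class₁-size) (≤-reflexive total)))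
    degree′≤Δ : ∀ v → # (adj? T v) ≤ Δ
    degree′≤Δ v = ≤-trans (#-mono (adj? T v) (member? (tabulate (adj T v))) λ u e → trans (lookup∘tabulate (adj T v) u) e)
      (≤-trans (≤-reflexive (sym (size-# (tabulate (adj T v))))) (degree≤Δ v))
    missᵇ : ∀ x → Member U₁ x → # (λ y → member? U₁ y ×-dec miss? b x y) ≤ m
    missᵇ x p = ≤-trans (missed≤deg b x U₁) (few₁ x (lookup⇒[]= x U₁ p))
    missʳ : ∀ x → Member U₁ x → # (λ y → member? U₂ y ×-dec miss? (opp b) x y) ≤ m
    missʳ x p = ≤-trans (missed≤deg (opp b) x U₂) (subst (λ c → deg G c x U₂ ≤ m) (sym (opp-opp b)) (few₂ x (lookup⇒[]= x U₁ p)))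
    missʳ′ : ∀ x → Member U₂ x → # (λ y → member? U₁ y ×-dec miss? (opp b) x y) ≤ m
    missʳ′ x p = ≤-trans (missed≤deg (opp b) x U₁) (subst (λ c → deg G c x U₁ ≤ m) (sym (opp-opp b)) (few₃ x (lookup⇒[]= x U₂ p)))
    U₁∩U₂ : ∀ x → Member U₁ x → Member U₂ x → ⊥
    U₁∩U₂ x p q = disj (x , lookup⇒[]= x (U₁ ∩ U₂) (trans (lookup-zipWith _∧_ x U₁ U₂) (cong₂ _∧_ p q)))
    size₁′ : n ≤ # (member? U₁) + m
    size₁′ = subst (λ k → n ≤ k + m) (size-# U₁) size₁
    with-class-two : # class₂? ≡ t₂ → MonoCopy G T
    -- The border between a large and a tiny second class. Below it 2t₁ exceeds t₁ + 2t₂, so the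
    -- host has 2t₁ - 1 vertices.
    with-class-two eq with # class₂? * 1000000 ≤? n
    ... | no wide = CaseOne.case-one T (ordering T connected acyclic) cls bipartite nb Adj-nb G root d₀ b (member? U₁) (member? U₂) U₁∩U₂ m Δ degree′≤Δ size₁′
          (subst₂ (λ t k → t ≤ k + m) (sym eq) (size-# U₂) size₂) missᵇ missʳ missʳ′ (subst (λ t → n + t ≤ N + 1) (sym eq) sizeᴺ) classes
          m-small Δ-small 1≤m (subst₂ _≤_ (sym eq) (sym class₁-size) larger) (<⇒≤ (≰⇒> wide))
    ... | yes narrow = with-quotient (quotient n 300000)
      where
      with-quotient : (∃ λ e → e * 300000 ≤ n × n < e * 300000 + 300000) → MonoCopy G T
      with-quotient (e , e≤ , e>) = CaseTwo.case-two T (ordering T connected acyclic) cls bipartite nb Adj-nb root G d₀ b degree′≤Δ m e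
        (trans (sizeᴺ′ (subst (λ t → t * 1000000 ≤ n) eq narrow)) (cong (_* 2) (sym class₁-size))) classes m-small Δ-small 1≤m n-large narrow e≤ e>
        (member? U₁) size₁′ missᵇ

-- From rational parameters to integer inequalities

unit-fraction : ℕ → ℚ
unit-fraction k = ℚ.mkℚ (ℤ.+ 1) k (1-coprimeTo (suc k))

ℕ→ℚᵘ : ∀ d → ℚ.toℚᵘ (ℕ→ℚ d) ℚᵘ.≃ ℚᵘ.mkℚᵘ (ℤ.+ d) 0
ℕ→ℚᵘ d = ℚₚ.toℚᵘ-fromℚᵘ (ℚᵘ.mkℚᵘ (ℤ.+ d) 0)

scale-bound : ∀ k n {μ} → μ ℚ.≤ unit-fraction k → ℚ.toℚᵘ (μ ℚ.* ℕ→ℚ n) ℚᵘ.≤ ℚᵘ.mkℚᵘ (ℤ.+ 1) k ℚᵘ.* ℚᵘ.mkℚᵘ (ℤ.+ n) 0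
scale-bound k n {μ} μ≤ = begin
  ℚ.toℚᵘ (μ ℚ.* ℕ→ℚ n)                       ≃⟨ ℚₚ.toℚᵘ-homo-* μ (ℕ→ℚ n) ⟩
  ℚ.toℚᵘ μ ℚᵘ.* ℚ.toℚᵘ (ℕ→ℚ n)               ≃⟨ ℚᵘₚ.*-congˡ {ℚ.toℚᵘ μ} (ℕ→ℚᵘ n) ⟩
  ℚ.toℚᵘ μ ℚᵘ.* ℚᵘ.mkℚᵘ (ℤ.+ n) 0             ≤⟨ ℚᵘₚ.*-monoˡ-≤-nonNeg (ℚᵘ.mkℚᵘ (ℤ.+ n) 0) (ℚₚ.toℚᵘ-mono-≤ μ≤) ⟩
  ℚᵘ.mkℚᵘ (ℤ.+ 1) k ℚᵘ.* ℚᵘ.mkℚᵘ (ℤ.+ n) 0    ∎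
  where open ℚᵘₚ.≤-Reasoning

-- In unnormalised rationals the comparison is a cross-multiplication of integers, with no gcd to
-- cancel.
fraction-bound : ∀ k n d {μ} → μ ℚ.≤ unit-fraction k → ℕ→ℚ d ℚ.≤ μ ℚ.* ℕ→ℚ n → d * suc k ≤ n
fraction-bound k n d {μ} μ≤ d≤ = lower (ℚᵘₚ.drop-*≤* bound)
  where
  open ℚᵘₚ.≤-Reasoning
  bound : ℚᵘ.mkℚᵘ (ℤ.+ d) 0 ℚᵘ.≤ ℚᵘ.mkℚᵘ (ℤ.+ 1) k ℚᵘ.* ℚᵘ.mkℚᵘ (ℤ.+ n) 0
  bound = begin
    ℚᵘ.mkℚᵘ (ℤ.+ d) 0                          ≃⟨ ℚᵘₚ.≃-sym (ℕ→ℚᵘ d) ⟩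
    ℚ.toℚᵘ (ℕ→ℚ d)                             ≤⟨ ℚₚ.toℚᵘ-mono-≤ d≤ ⟩
    ℚ.toℚᵘ (μ ℚ.* ℕ→ℚ n)                       ≤⟨ scale-bound k n μ≤ ⟩
    ℚᵘ.mkℚᵘ (ℤ.+ 1) k ℚᵘ.* ℚᵘ.mkℚᵘ (ℤ.+ n) 0    ∎
  lower : (ℤ.+ d) ℤ.* (ℤ.+ (suc k * 1)) ℤ.≤ ((ℤ.+ 1) ℤ.* (ℤ.+ n)) ℤ.* (ℤ.+ 1) → d * suc k ≤ n
  lower h = subst₂ _≤_ (cong (d *_) (*-identityʳ (suc k))) (trans (*-identityʳ (1 * n)) (*-identityˡ n))
    (ℤₚ.drop‿+≤+ (subst₂ ℤ._≤_ (sym (ℤₚ.pos-* d (suc k * 1))) (trans (cong (ℤ._* (ℤ.+ 1)) (sym (ℤₚ.pos-* 1 n))) (sym (ℤₚ.pos-* (1 * n) 1))) h))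

-- Adding μn back on both sides removes the difference 1 - μ; the term is then bounded by n/(k + 1).
complement-bound : ∀ k n u {μ} → μ ℚ.≤ unit-fraction k → (1ℚ ℚ.- μ) ℚ.* ℕ→ℚ n ℚ.≤ ℕ→ℚ u → n * suc k ≤ u * suc k + n
complement-bound k n u {μ} μ≤ h = lower (ℚᵘₚ.drop-*≤* bound)
  where
  x = ℕ→ℚ n
  recombine : (1ℚ ℚ.- μ) ℚ.* x ℚ.+ μ ℚ.* x ≡ x
  recombine = trans (sym (ℚₚ.*-distribʳ-+ x (1ℚ ℚ.- μ) μ))
    (trans (cong (ℚ._* x) (trans (ℚₚ.+-assoc 1ℚ (ℚ.- μ) μ) (trans (cong (1ℚ ℚ.+_) (ℚₚ.+-inverseˡ μ)) (ℚₚ.+-identityʳ 1ℚ)))) (ℚₚ.*-identityˡ x))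
  split : x ℚ.≤ ℕ→ℚ u ℚ.+ μ ℚ.* x
  split = subst (ℚ._≤ ℕ→ℚ u ℚ.+ μ ℚ.* x) recombine (ℚₚ.+-monoˡ-≤ (μ ℚ.* x) h)
  open ℚᵘₚ.≤-Reasoning
  bound : ℚᵘ.mkℚᵘ (ℤ.+ n) 0 ℚᵘ.≤ ℚᵘ.mkℚᵘ (ℤ.+ u) 0 ℚᵘ.+ ℚᵘ.mkℚᵘ (ℤ.+ 1) k ℚᵘ.* ℚᵘ.mkℚᵘ (ℤ.+ n) 0
  bound = begin
    ℚᵘ.mkℚᵘ (ℤ.+ n) 0                            ≃⟨ ℚᵘₚ.≃-sym (ℕ→ℚᵘ n) ⟩
    ℚ.toℚᵘ x                                     ≤⟨ ℚₚ.toℚᵘ-mono-≤ split ⟩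
    ℚ.toℚᵘ (ℕ→ℚ u ℚ.+ μ ℚ.* x)                   ≃⟨ ℚₚ.toℚᵘ-homo-+ (ℕ→ℚ u) (μ ℚ.* x) ⟩
    ℚ.toℚᵘ (ℕ→ℚ u) ℚᵘ.+ ℚ.toℚᵘ (μ ℚ.* x)         ≤⟨ ℚᵘₚ.+-mono-≤ (ℚᵘₚ.≤-reflexive (ℕ→ℚᵘ u)) (scale-bound k n μ≤) ⟩
    ℚᵘ.mkℚᵘ (ℤ.+ u) 0 ℚᵘ.+ ℚᵘ.mkℚᵘ (ℤ.+ 1) k ℚᵘ.* ℚᵘ.mkℚᵘ (ℤ.+ n) 0  ∎
  lower : (ℤ.+ n) ℤ.* (ℤ.+ (1 * (suc k * 1))) ℤ.≤ ((ℤ.+ u) ℤ.* (ℤ.+ (suc k * 1)) ℤ.+ ((ℤ.+ 1) ℤ.* (ℤ.+ n)) ℤ.* (ℤ.+ 1)) ℤ.* (ℤ.+ 1) →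
    n * suc k ≤ u * suc k + n
  lower h = subst₂ _≤_ (cong (n *_) (trans (*-identityˡ (suc k * 1)) (*-identityʳ (suc k))))
      (trans (*-identityʳ _) (cong₂ _+_ (cong (u *_) (*-identityʳ (suc k))) (trans (*-identityʳ (1 * n)) (*-identityˡ n))))
      (ℤₚ.drop‿+≤+ (subst₂ ℤ._≤_ (sym (ℤₚ.pos-* n (1 * (suc k * 1)))) right h))
    where
    right : ((ℤ.+ u) ℤ.* (ℤ.+ (suc k * 1)) ℤ.+ ((ℤ.+ 1) ℤ.* (ℤ.+ n)) ℤ.* (ℤ.+ 1)) ℤ.* (ℤ.+ 1) ≡ ℤ.+ ((u * (suc k * 1) + 1 * n * 1) * 1)
    right = trans (cong (ℤ._* (ℤ.+ 1)) (cong₂ ℤ._+_ (sym (ℤₚ.pos-* u (suc k * 1)))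
        (trans (cong (ℤ._* (ℤ.+ 1)) (sym (ℤₚ.pos-* 1 n))) (sym (ℤₚ.pos-* (1 * n) 1)))))
      (sym (ℤₚ.pos-* (u * (suc k * 1) + 1 * n * 1) 1))

unit-fraction-positive : ∀ k → 0ℚ ℚ.< unit-fraction k
unit-fraction-positive k = ℚₚ.positive⁻¹ (unit-fraction k)

estimate-77 = linear 4 (λ t₁ t₂ max N → (t₁ ⊕ (t₂ ⊕ (t₂ ⊕ con 0)) ⊑ max) ∷ (max ⊑ con 1 ⊕ N) ∷ [] ⊢ t₁ ⊕ t₂ ⊕ t₂ ⊑ N ⊕ con 1) 0 (1 ∷ 1 ∷ [])

estimate-78 = linear 2 (λ t₂ t₁ → (t₂ ⊑ t₁) ∷ (con 1000000000000000000000000000000000000 ⊑ t₁ ⊕ t₂) ∷ [] ⊢ con 1 ⊑ t₁ ⊕ (t₁ ⊕ con 0)) 0 (1 ∷ 1 ∷ [])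

estimate-79 = linear 2 (λ t₂ t₁ → (t₂ ⊛ 1000000 ⊑ t₁ ⊕ t₂) ∷ [] ⊢ t₁ ⊕ (t₂ ⊕ (t₂ ⊕ con 0)) ⊑ t₁ ⊕ (t₁ ⊕ con 0)) 999998 (2 ∷ [])

estimate-80 = linear 3 (λ q n m → (q ⊛ 1000000000000000000000000000000000000 ⊑ n) ∷ (con 1000000000000000000000000000000000000 ⊑ n) ∷ (m ⊑ con 1 ⊕ q) ∷ [] ⊢ m ⊛ 10000000000000000000000000000000000 ⊑ n) 99 (1 ∷ 99 ∷ 1000000000000000000000000000000000000 ∷ [])

estimate-81 = linear 2 (λ q m → (con 1 ⊕ q ⊑ m) ∷ [] ⊢ con 1 ⊑ m) 0 (1 ∷ [])

estimate-82 = linear 1 (λ n → (con 1000000000000000000000000000000000000 ⊑ n) ∷ [] ⊢ con 1000000 ⊑ n) 0 (1 ∷ [])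

estimate-83 = linear 4 (λ d n q m → (d ⊛ 1000000000000000000000000000000000000 ⊑ n) ∷ (con 1 ⊕ n ⊑ q ⊛ 1000000000000000000000000000000000000 ⊕ con 1000000000000000000000000000000000000) ∷ (con 1 ⊕ q ⊑ m) ∷ [] ⊢ d ⊑ m) 999999999999999999999999999999999999 (1 ∷ 1 ∷ 1000000000000000000000000000000000000 ∷ [])

estimate-84 = linear 5 (λ t u n q m → (t ⊛ 1000000000000000000000000000000000000 ⊑ u ⊛ 1000000000000000000000000000000000000 ⊕ t) ∷ (t ⊑ n) ∷ (con 1 ⊕ n ⊑ q ⊛ 1000000000000000000000000000000000000 ⊕ con 1000000000000000000000000000000000000) ∷ (con 1 ⊕ q ⊑ m) ∷ [] ⊢ t ⊑ u ⊕ m) 999999999999999999999999999999999999 (1 ∷ 1 ∷ 1 ∷ 1000000000000000000000000000000000000 ∷ [])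

estimate-85 = linear 3 (λ x1 n Δ → (x1 ⊛ 10000000000 ⊑ n) ∷ (con 1 ⊕ n ⊑ Δ ⊛ 10000000000 ⊕ con 10000000000) ∷ [] ⊢ x1 ⊑ Δ) 9999999999 (1 ∷ 1 ∷ [])

-- The constants 1 / suc k and 1 / suc kc are kept abstract, since unfolding their denominators
-- would be unary.
module Conclusion (k kc : ℕ) (k-value : suc k ≡ 1000000000000000000000000000000000000) (kc-value : suc kc ≡ 10000000000) where

  rescale : ∀ {d n} → d * suc k ≤ n → d * 1000000000000000000000000000000000000 ≤ n
  rescale {d} {n} = subst (λ x → d * x ≤ n) k-value

  extremal-copy : ∀ b {t₁ t₂ μ c} → μ ℚ.≤ unit-fraction k → c ℚ.≤ unit-fraction kc →
    t₁ + t₂ ≥ 1000000000000000000000000000000000000 → t₁ ≥ t₂ →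
    (G : ColouredKN (((t₁ + 2 * t₂) ⊔ (2 * t₁)) ∸ 1)) → ExtremalWith (opp b) b μ t₁ t₂ G →
    (T : Graph (t₁ + t₂)) → IsTree T → MaxDegreeAtMost T c → HasBipartition T t₁ t₂ → MonoCopy G T
  extremal-copy b {t₁} {t₂} {μ} μ≤ c≤ large t₁≥t₂ G (U₁ , U₂ , disj , size₁ , size₂ , few₁ , few₂ , few₃) T (connected , acyclic) maxdeg (X , crossing , sizeˣ , _) =
    with-quotients (quotient n 1000000000000000000000000000000000000) (quotient n 10000000000)
    where
    n = t₁ + t₂
    max = (t₁ + 2 * t₂) ⊔ (2 * t₁)
    N = max ∸ 1
    N+1 : n + t₂ ≤ N + 1
    N+1 = estimate-77 t₁ t₂ max N (m≤m⊔n (t₁ + 2 * t₂) (2 * t₁)) (m≤n+m∸n max 1)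
    narrow-case : t₂ * 1000000 ≤ n → N + 1 ≡ t₁ * 2
    narrow-case narrow = trans (m∸n+n≡m {max} {1} (≤-trans 1≤2t₁ (m≤n⊔m (t₁ + 2 * t₂) (2 * t₁)))) (trans (m≤n⇒m⊔n≡n smaller) (*-comm 2 t₁))
      where
      1≤2t₁ : 1 ≤ 2 * t₁
      1≤2t₁ = estimate-78 t₂ t₁ t₁≥t₂ large
      smaller : t₁ + 2 * t₂ ≤ 2 * t₁
      smaller = estimate-79 t₂ t₁ narrow
    with-quotients : (∃ λ q → q * 1000000000000000000000000000000000000 ≤ n × n < q * 1000000000000000000000000000000000000 + 1000000000000000000000000000000000000) →
      (∃ λ Δ → Δ * 10000000000 ≤ n × n < Δ * 10000000000 + 10000000000) → MonoCopy G T
    with-quotients (q , q≤ , q>) (Δ , Δ≤ , Δ>) = with-error (suc q) refl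
      where
      -- The error is ⌊n/10³⁶⌋ + 1. Rounding up makes it positive and at least n/10³⁶; since n ≥
      -- 10³⁶, it is at most 2n/10³⁶ and so below n/10³⁴.
      with-error : ∀ m → m ≡ suc q → MonoCopy G T
      with-error m m≡ = Reduction.reduced T connected acyclic X crossing G b U₁ U₂ refl t₁≥t₂ sizeˣ
        ((estimate-80 q n m q≤ large (≤-reflexive m≡)))
        Δ≤ ((estimate-81 q m (≤-reflexive (sym m≡)))) ((estimate-82 n large)) degree≤Δ N+1 narrow-case disj
        (size n ≤-refl size₁) (size t₂ (m≤n+m t₂ t₁) size₂) (λ u i → few {deg G (opp b) u U₁} (few₁ u i)) (λ u i → few {deg G b u U₂} (few₂ u i)) (λ u i → few {deg G b u U₁} (few₃ u i))
        where
        few : ∀ {d} → ℕ→ℚ d ℚ.≤ μ ℚ.* ℕ→ℚ n → d ≤ m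
        few {d} h = estimate-83 d n q m (rescale {d} (fraction-bound k n d μ≤ h)) q> (≤-reflexive (sym m≡))
        size : ∀ t {u} → t ≤ n → (1ℚ ℚ.- μ) ℚ.* ℕ→ℚ t ℚ.≤ ℕ→ℚ u → t ≤ u + m
        size t {u} t≤n h = estimate-84 t u n q m (subst (λ x → t * x ≤ u * x + t) k-value (complement-bound k t u μ≤ h)) t≤n q> (≤-reflexive (sym m≡))
        degree≤Δ : ∀ v → degree T v ≤ Δ
        degree≤Δ v = estimate-85 (degree T v) n Δ (subst (λ x → degree T v * x ≤ n) kc-value (fraction-bound kc n (degree T v) c≤ (maxdeg v))) Δ>

  conclusion : Σ ℚ λ μ₀ → 0ℚ ℚ.< μ₀ × (∀ μ → 0ℚ ℚ.< μ → μ ℚ.≤ μ₀ →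
    Σ ℚ λ c₀ → 0ℚ ℚ.< c₀ × (∀ c → 0ℚ ℚ.< c → c ℚ.≤ c₀ →
    Σ ℕ λ n₀ → ∀ n → n ≥ n₀ → ∀ t₁ t₂ → t₁ + t₂ ≡ n → t₁ ≥ t₂ →
    (G : ColouredKN (((t₁ + 2 * t₂) ⊔ (2 * t₁)) ∸ 1)) →
    TypeIExtremal μ t₁ t₂ G →
    (T : Graph n) → IsTree T → MaxDegreeAtMost T c →
    HasBipartition T t₁ t₂ →
    MonoCopy G T))
  conclusion = unit-fraction k , unit-fraction-positive k , λ μ _ μ≤ → unit-fraction kc , unit-fraction-positive kc , λ c _ c≤ →
    1000000000000000000000000000000000000 , λ { n large t₁ t₂ refl t₁≥t₂ G ext T → by-colour μ≤ c≤ large t₁≥t₂ G ext T }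
    where
    by-colour : ∀ {t₁ t₂ μ c} → μ ℚ.≤ unit-fraction k → c ℚ.≤ unit-fraction kc → t₁ + t₂ ≥ 1000000000000000000000000000000000000 → t₁ ≥ t₂ →
      (G : ColouredKN (((t₁ + 2 * t₂) ⊔ (2 * t₁)) ∸ 1)) → TypeIExtremal μ t₁ t₂ G →
      (T : Graph (t₁ + t₂)) → IsTree T → MaxDegreeAtMost T c → HasBipartition T t₁ t₂ → MonoCopy G T
    by-colour μ≤ c≤ large t₁≥t₂ G (inj₁ ext) = extremal-copy blue μ≤ c≤ large t₁≥t₂ G ext
    by-colour μ≤ c≤ large t₁≥t₂ G (inj₂ ext) = extremal-copy red μ≤ c≤ large t₁≥t₂ G ext

theorem2p3 : Σ ℚ λ μ₀ → 0ℚ ℚ.< μ₀ × (∀ μ → 0ℚ ℚ.< μ → μ ℚ.≤ μ₀ →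
    Σ ℚ λ c₀ → 0ℚ ℚ.< c₀ × (∀ c → 0ℚ ℚ.< c → c ℚ.≤ c₀ →
    Σ ℕ λ n₀ → ∀ n → n ≥ n₀ → ∀ t₁ t₂ → t₁ + t₂ ≡ n → t₁ ≥ t₂ →
    (G : ColouredKN (((t₁ + 2 * t₂) ⊔ (2 * t₁)) ∸ 1)) →
    TypeIExtremal μ t₁ t₂ G →
    (T : Graph n) → IsTree T → MaxDegreeAtMost T c →
    HasBipartition T t₁ t₂ →
    MonoCopy G T))
theorem2p3 = Conclusion.conclusion 999999999999999999999999999999999999 9999999999 refl refl
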